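{- Let $q$ be a prime power and let $n$ be a positive integer with $\gcd(n,q)=1$. Then $\operatorname{Aut}_q(n)\neq\operatorname{Aff}_q(n)$ if and only if at least one of the following holds: (E1) $\operatorname{idx}_{n/p}(q)=\operatorname{idx}_n(q)$ for some prime $p\ge5$ with $p\,\|\,n$; (E2) $\operatorname{idx}_{n/p}(q)=\operatorname{idx}_n(q)$ for some odd prime $p$ with $p^2\mid n$; (E3) $8\mid n$ and $\operatorname{idx}_{n/4}(q)=\operatorname{idx}_n(q)$.
   Context: For a positive integer $d$ coprime to $q$, $\operatorname{ord}_d(q)$ is the order of $q$ in $\mathbb{Z}_d^\times=(\mathbb{Z}/d\mathbb{Z})^\times$, and $\operatorname{idx}_d(q):=\varphi(d)/\operatorname{ord}_d(q)$, where $\varphi$ is Euler's totient function. For a prime $p$, $p\,\|\,n$ means that $p\mid n$ and $p^2\nmid n$. Let $\langle q\rangle$ be the subgroup of $\mathbb{Z}_n^\times$ generated by $q$, where $\mathbb{Z}_n=\mathbb{Z}/n\mathbb{Z}$. The cyclotomic association scheme $\operatorname{Cyc}(\langle q\rangle,\mathbb{Z}_n)$ is the pair $(\mathbb{Z}_n,\pi)$ with coloring $\pi(x,y):=(y-x)\langle q\rangle$ (the orbit of $y-x$ under multiplication by $\langle q\rangle$), and $\operatorname{Aut}_q(n):=\operatorname{Aut}(\operatorname{Cyc}(\langle q\rangle,\mathbb{Z}_n))$ is the group of all permutations $\sigma$ of $\mathbb{Z}_n$ with $\pi(\sigma x,\sigma y)=\pi(x,y)$ for all $x,y\in\mathbb{Z}_n$.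 The $q$-affine group is $\operatorname{Aff}_q(n):=\{x\mapsto kx+b:\ k\in\langle q\rangle,\ b\in\mathbb{Z}_n\}=\mathbb{Z}_n\rtimes\langle q\rangle\le\operatorname{Sym}(\mathbb{Z}_n)$, generated by the shift $i\mapsto i+1$ and the multiplier $i\mapsto qi$. It is a subgroup of $\operatorname{Aut}_q(n)$. -}

module Defs where

open import Data.Bool.Base using (if_then_else_)
open import Data.Fin.Base using (Fin; toℕ)
open import Data.Fin.Permutation using (Permutation′; _⟨$⟩ʳ_)
open import Data.List.Base using (length; filter; upTo)
open import Data.Nat.Base
open import Data.Nat.Coprimality using (coprime?)
open import Data.Nat.DivMod using (_mod_)
open import Data.Nat.Divisibility using (_∣_; _∣?_)
open import Data.Nat.Primality using (Prime)
open import Data.Product.Base using (_×_; ∃-syntax)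
open import Function.Base using (_∘_)
open import Level using (0ℓ)
open import Relation.Binary.PropositionalEquality.Core using (_≡_)
open import Relation.Nullary using (¬_; does)
open import Relation.Unary using (Pred; Decidable; _∈_; _≐_)

PrimePower : ℕ → Set
PrimePower q = ∃[ p ] ∃[ k ] Prime p × 1 ≤ k × q ≡ p ^ k

infix 4 _∥_

_∥_ : ℕ → ℕ → Set
p ∥ n = p ∣ n × ¬ (p ^ 2 ∣ n)

-- The residues are represented by 0, …, d - 1; since gcd 0 1 ≡ 1, this
-- gives φ 1 ≡ 1.
φ : ℕ → ℕ
φ d = length (filter (λ k → coprime? k d) (upTo d))

-- The least i < b satisfying P, or b if there is none.
least : {P : Pred ℕ 0ℓ} → Decidable P → ℕ → ℕ
least P? zero    = 0
least P? (suc b) = if does (P? 0) then 0 else suc (least (P? ∘ suc) b)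

-- The least k ≥ 1 with q ^ k ≡ 1 (mod d).  When d is positive and coprime
-- to q, such a k exists with k ≤ φ d ≤ d, so the search bound is harmless.
-- For other arguments the value is meaningless.
ord : ℕ → ℕ → ℕ
ord d q = suc (least (λ i → d ∣? ∣ q ^ suc i - 1 ∣) d)

-- The division is exact for positive d coprime to q, by Lagrange's theorem.
idx : ℕ → ℕ → ℕ
idx d q = φ d / ord d q

module _ (q n : ℕ) .{{_ : NonZero n}} where

  infixl 6 _⊕_ _⊖_
  infixl 7 _⊗_

  _⊕_ : Fin n → Fin n → Fin n
  a ⊕ b = (toℕ a + toℕ b) mod n

  _⊖_ : Fin n → Fin n → Fin n
  a ⊖ b = (toℕ a + (n ∸ toℕ b)) mod n

  _⊗_ : Fin n → Fin n → Fin n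
  a ⊗ b = (toℕ a * toℕ b) mod n

  -- For q coprime to n, the class of q has finite order in the unit group,
  -- so the subgroup it generates consists of its nonnegative powers.
  ⟨q⟩ : Pred (Fin n) 0ℓ
  ⟨q⟩ k = ∃[ j ] k ≡ (q ^ j) mod n

  orbit : Fin n → Pred (Fin n) 0ℓ
  orbit a z = ∃[ k ] k ∈ ⟨q⟩ × z ≡ a ⊗ k

  colour : Fin n → Fin n → Pred (Fin n) 0ℓ
  colour x y = orbit (y ⊖ x)

  -- Colours are compared as subsets, by _≐_.
  Aut : Pred (Permutation′ n) 0ℓ
  Aut σ = ∀ x y → colour (σ ⟨$⟩ʳ x) (σ ⟨$⟩ʳ y) ≐ colour x y

  Aff : Pred (Permutation′ n) 0ℓ
  Aff σ = ∃[ k ] ∃[ b ] k ∈ ⟨q⟩ × (∀ x → σ ⟨$⟩ʳ x ≡ (k ⊗ x) ⊕ b)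

{-# OPTIONS --safe #-}

-- The equality idx (n / k) q ≡ idx n q says that ⟨q⟩ contains the whole kernel
-- of reduction from the units mod n to the units mod n / k.  If it does, then
-- many orbits of ⟨q⟩ are unions of cosets of (n / k)ℤ, and permuting or
-- shifting single residue classes mod p (or mod 4) gives an automorphism that
-- is not affine.
--
-- Conversely, an automorphism s multiplies every difference by an element of
-- ⟨q⟩, and it is affine once its slopes s (x + 1) - s x agree mod each
-- N = p ^ a exactly dividing n.  By the Chinese remainder theorem, s mod N
-- multiplies differences, up to a common factor, by elements of the subgroup H
-- of ⟨q⟩ that is trivial mod n / N.
--  * If p is odd and p² ∣ n, then H ∩ (1 + pℤ) is trivial, so a multiplier is
--    determined by its residue mod p, that is, by residues of s mod p.
--  * If p = 2 (or N = 3), then consecutive slopes a, b satisfy a + b = 2c with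
--    c ∈ H, and 1 + u = 2v has only the solution u = 1 in H.
--  * If p ∥ n and p ≥ 5, then H has exponent t < p / 2 mod p, whence
--    (s x - s y) ^ t = (x - y) ^ t.  Comparing coefficients in s y shows that
--    s ^ j has degree ≤ t for all j ≤ t; if s had degree d ≥ 2, then the degree
--    jd of s ^ j would fall between t and p for some such j.
module Submission where

-- The indices enter through the order L of the kernel of reduction: p - 1, p or 4 in (E1), (E2),
-- (E3). Totients give `φ n ≡ L * φ d`, and `ord n q` is t times `ord d q` with t dividing L. Equal
-- indices mean t = L; otherwise t ≤ L / 2. For L = p - 1 this is the bound t < p / 2, for L = p it
-- forces t = 1, and for L = 4 it leaves at most one nontrivial element of ⟨q⟩ that is 1 mod n / 4.
-- For p² ∣ n this says something only about elements that are 1 mod n / p, whereas `H ∩ (1 + pℤ)`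
-- is much larger a priori. But if h is 1 mod p and not 1 mod N, some p-power of h is 1 mod N / p
-- and still not 1 mod N. This is lifting the exponent; for p = 2 it holds only from 1 mod 4 on, and
-- the equation 1 + u = 2v has to make up for the difference. The comparison of coefficients is done
-- without polynomials: degree is read off from iterated differences mod p, and every constant that
-- has to be cancelled is a product of numbers below p. The nonaffine maps all fix two consecutive
-- integers and move 0.

open import Defs

-- Totients of multiples, by counting residues.

module Totient where

  open import Data.Bool.Base using (true; false; if_then_else_)
  open import Data.List.Base using (length; filter; upTo; _++_; [_])
  open import Data.List.Properties using (upTo-∷ʳ; filter-++; length-++)
  open import Data.Nat.Base
  open import Data.Nat.Coprimality using (Coprime; coprime-divisor; coprime?)
  open import Data.Nat.Divisibility
  open import Data.Nat.Primality using (Prime; prime⇒irreducible; prime⇒nonZero; ¬prime[1])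
  open import Data.Nat.Properties
  open import Data.Product.Base using (_,_; proj₂)
  open import Data.Sum.Base using ([_,_]′)
  open import Function.Base using (_∘_; id)
  open import Level using (0ℓ)
  open import Relation.Binary.PropositionalEquality hiding ([_])
  open import Relation.Nullary
  open import Relation.Unary using (Pred; Decidable)

  private
    variable
      P R : Pred ℕ 0ℓ

  indicator : ∀ {A : Set} → Dec A → ℕ
  indicator A? = if does A? then 1 else 0

  indicator-cong : ∀ {A B : Set} (A? : Dec A) (B? : Dec B) → (A → B) → (B → A) → indicator A? ≡ indicator B?
  indicator-cong (yes a) (yes b) f g = refl
  indicator-cong (yes a) (no ¬b) f g = contradiction (f a) ¬b
  indicator-cong (no ¬a) (yes b) f g = contradiction (g b) ¬a
  indicator-cong (no ¬a) (no ¬b) f g = refl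

  count : Decidable P → ℕ → ℕ
  count P? zero    = 0
  count P? (suc N) = count P? N + indicator (P? N)

  length-filter-upTo : (P? : Decidable P) → ∀ N → length (filter P? (upTo N)) ≡ count P? N
  length-filter-upTo P? zero    = refl
  length-filter-upTo P? (suc N) = begin
    length (filter P? (upTo (suc N)))                             ≡⟨ cong (length ∘ filter P?) (upTo-∷ʳ N) ⟨
    length (filter P? (upTo N ++ [ N ]))           ≡⟨ cong length (filter-++ P? (upTo N) [ N ]) ⟩
    length (filter P? (upTo N) ++ filter P? [ N ]) ≡⟨ length-++ (filter P? (upTo N)) ⟩
    length (filter P? (upTo N)) + length (filter P? [ N ])        ≡⟨ cong₂ _+_ (length-filter-upTo P? N) singleton ⟩
    count P? N + indicator (P? N)                                 ∎
    where
    open ≡-Reasoning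
    singleton : length (filter P? [ N ]) ≡ indicator (P? N)
    singleton with does (P? N)
    ... | true  = refl
    ... | false = refl

  count-cong : (P? : Decidable P) (R? : Decidable R) → ∀ N →
    (∀ k → k < N → P k → R k) → (∀ k → k < N → R k → P k) → count P? N ≡ count R? N
  count-cong P? R? zero    f g = refl
  count-cong P? R? (suc N) f g = cong₂ _+_
    (count-cong P? R? N (λ k k<N → f k (m<n⇒m<1+n k<N)) (λ k k<N → g k (m<n⇒m<1+n k<N)))
    (indicator-cong (P? N) (R? N) (f N ≤-refl) (g N ≤-refl))

  count-none : (P? : Decidable P) → ∀ N → (∀ k → k < N → ¬ P k) → count P? N ≡ 0
  count-none P? zero    f = refl
  count-none P? (suc N) f = cong₂ _+_ (count-none P? N λ k k<N → f k (m<n⇒m<1+n k<N))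
    (indicator-cong (P? N) (no id) (f N ≤-refl) λ ())

  count-+ : (P? : Decidable P) → ∀ M N → count P? (M + N) ≡ count P? M + count (λ k → P? (M + k)) N
  count-+ P? M zero    rewrite +-identityʳ M = sym (+-identityʳ _)
  count-+ P? M (suc N) rewrite +-suc M N =
    trans (cong (_+ indicator (P? (M + N))) (count-+ P? M N)) (+-assoc (count P? M) _ _)

  count-periodic : (P? : Decidable P) → ∀ d → (∀ k → P (d + k) → P k) → (∀ k → P k → P (d + k)) →
    ∀ j → count P? (j * d) ≡ j * count P? d
  count-periodic P? d f g zero    = refl
  count-periodic P? d f g (suc j) = trans (count-+ P? d (j * d)) (cong (count P? d +_) (trans
    (count-cong (λ k → P? (d + k)) P? (j * d) (λ k _ → f k) (λ k _ → g k))
    (count-periodic P? d f g j)))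

  count-split : (P? : Decidable P) (R? : Decidable R) → ∀ N →
    count P? N ≡ count (λ k → P? k ×-dec ¬? (R? k)) N + count (λ k → R? k ×-dec P? k) N
  count-split P? R? zero    = refl
  count-split {P} {R} P? R? (suc N) = begin
    count P? N + indicator (P? N)                   ≡⟨ cong₂ _+_ (count-split P? R? N) (split (P? N) (R? N)) ⟩
    (a + b) + (c + d)                               ≡⟨ +-assoc a b (c + d) ⟩
    a + (b + (c + d))                               ≡⟨ cong (a +_) (trans (sym (+-assoc b c d)) (trans (cong (_+ d) (+-comm b c)) (+-assoc c b d))) ⟩
    a + (c + (b + d))                               ≡⟨ +-assoc a c (b + d) ⟨
    (a + c) + (b + d)                               ∎
    where
    open ≡-Reasoning
    a = count (λ k → P? k ×-dec ¬? (R? k)) N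
    b = count (λ k → R? k ×-dec P? k) N
    c = indicator (P? N ×-dec ¬? (R? N))
    d = indicator (R? N ×-dec P? N)
    split : ∀ {A B : Set} (A? : Dec A) (B? : Dec B) →
      indicator A? ≡ indicator (A? ×-dec ¬? B?) + indicator (B? ×-dec A?)
    split (yes _) (yes _) = refl
    split (yes _) (no _)  = refl
    split (no _)  (yes _) = refl
    split (no _)  (no _)  = refl

  -- Each block of p consecutive numbers starting at `j * p` contains just one multiple of p, its
  -- first element.
  count-multiples : (P? : Decidable P) → ∀ p .{{_ : NonZero p}} j →
    count (λ k → (p ∣? k) ×-dec P? k) (j * p) ≡ count (λ k → P? (k * p)) j
  count-multiples P? p zero = refl
  count-multiples {P} P? p@(suc p-1) (suc j) = begin
    count M? (p + j * p)                                  ≡⟨ cong (count M?) (+-comm p (j * p)) ⟩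
    count M? (j * p + p)                                  ≡⟨ count-+ M? (j * p) p ⟩
    count M? (j * p) + count (λ k → M? (j * p + k)) p     ≡⟨ cong₂ _+_ (count-multiples P? p j) block ⟩
    count (λ k → P? (k * p)) j + indicator (P? (j * p))   ∎
    where
    open ≡-Reasoning
    M? = λ k → (p ∣? k) ×-dec P? k
    B? = λ k → M? (j * p + k)
    block : count B? (1 + p-1) ≡ indicator (P? (j * p))
    block = begin
      count B? (1 + p-1)                                  ≡⟨ count-+ B? 1 p-1 ⟩
      indicator (B? 0) + count (λ k → B? (1 + k)) p-1     ≡⟨ cong₂ _+_
        (indicator-cong (B? 0) (P? (j * p)) (subst P (+-identityʳ (j * p)) ∘ proj₂)
          (λ h → subst (p ∣_) (sym (+-identityʳ (j * p))) (n∣m*n j) , subst P (sym (+-identityʳ (j * p))) h))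
        (count-none (λ k → B? (1 + k)) p-1 λ k k<p-1 (p∣ , _) →
          >⇒∤ (s≤s k<p-1) (∣m+n∣m⇒∣n p∣ (n∣m*n j))) ⟩
      indicator (P? (j * p)) + 0                          ≡⟨ +-identityʳ _ ⟩
      indicator (P? (j * p))                              ∎

  private
    coprime-sucPeriod : ∀ d k → Coprime (d + k) d → Coprime k d
    coprime-sucPeriod d k c (e∣k , e∣d) = c (∣m∣n⇒∣m+n e∣d e∣k , e∣d)

    coprime-period : ∀ d k → Coprime k d → Coprime (d + k) d
    coprime-period d k c (e∣d+k , e∣d) = c (∣m+n∣m⇒∣n e∣d+k e∣d , e∣d)

    coprime-∣ˡ : ∀ {e k d} → e ∣ k → Coprime k d → Coprime e d
    coprime-∣ˡ e∣k c (f∣e , f∣d) = c (∣-trans f∣e e∣k , f∣d)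

  φ≡count : ∀ d → φ d ≡ count (λ k → coprime? k d) d
  φ≡count d = length-filter-upTo (λ k → coprime? k d) d

  count-coprime : ∀ d j → count (λ k → coprime? k d) (j * d) ≡ j * φ d
  count-coprime d j = trans
    (count-periodic (λ k → coprime? k d) d (coprime-sucPeriod d) (coprime-period d) j)
    (cong (j *_) (sym (φ≡count d)))

  -- Because p divides d, coprimality to `p * d` is coprimality to d, here counted over p periods.
  φ-*-∣ : ∀ p d → p ∣ d → φ (p * d) ≡ p * φ d
  φ-*-∣ p d p∣d = trans (φ≡count (p * d)) (trans
    (count-cong (λ k → coprime? k (p * d)) (λ k → coprime? k d) (p * d)
      (λ k _ c (e∣k , e∣d) → c (e∣k , ∣n⇒∣m*n p e∣d))
      (λ k _ c {e} (e∣k , e∣p*d) → c (e∣k , ∣-trans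
        (coprime-divisor (coprime-∣ˡ e∣k c) (subst (e ∣_) (*-comm p d) e∣p*d)) p∣d)))
    (count-coprime d p))

  -- Below `p * d`, the numbers coprime to d split into the units mod `p * d` and the multiples of
  -- p; the latter are p times the units mod d. Adding `φ d` on the left avoids a subtraction.
  φ-*-prime : ∀ {p} → Prime p → ∀ d → ¬ p ∣ d → φ (p * d) + φ d ≡ p * φ d
  φ-*-prime {p} pr d p∤d = begin
    φ (p * d) + φ d
      ≡⟨ cong₂ _+_ (trans (φ≡count (p * d)) units) (trans (φ≡count d) multiples) ⟩
    count (λ k → C? k ×-dec ¬? (p ∣? k)) (p * d) + count (λ k → (p ∣? k) ×-dec C? k) (p * d)
      ≡⟨ count-split C? (p ∣?_) (p * d) ⟨
    count C? (p * d)
      ≡⟨ count-coprime d p ⟩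
    p * φ d ∎
    where
    open ≡-Reasoning
    instance _ = prime⇒nonZero pr
    C? = λ k → coprime? k d
    units : count (λ k → coprime? k (p * d)) (p * d) ≡ count (λ k → C? k ×-dec ¬? (p ∣? k)) (p * d)
    units = count-cong (λ k → coprime? k (p * d)) (λ k → C? k ×-dec ¬? (p ∣? k)) (p * d)
      (λ k _ c → (λ (e∣k , e∣d) → c (e∣k , ∣n⇒∣m*n p e∣d))
               , λ p∣k → ¬prime[1] (subst Prime (c (p∣k , m∣m*n d)) pr))
      (λ k _ (c , p∤k) {e} (e∣k , e∣p*d) →
        [ id , (λ e≡p → contradiction (subst (_∣ k) e≡p e∣k) p∤k) ]′
        (prime⇒irreducible pr (coprime-divisor (coprime-∣ˡ e∣k c) (subst (e ∣_) (*-comm p d) e∣p*d))))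
    multiples : count C? d ≡ count (λ k → (p ∣? k) ×-dec C? k) (p * d)
    multiples = sym (trans (cong (count (λ k → (p ∣? k) ×-dec C? k)) (*-comm p d)) (trans
      (count-multiples C? p d)
      (count-cong (λ k → C? (k * p)) C? d
        (λ k _ c (e∣k , e∣d) → c (∣m⇒∣m*n p e∣k , e∣d))
        (λ k _ c {e} (e∣k*p , e∣d) → c (coprime-divisor (e⊥p e∣d) (subst (e ∣_) (*-comm k p) e∣k*p) , e∣d)))))
      where
      e⊥p : ∀ {e} → e ∣ d → Coprime e p
      e⊥p e∣d (f∣e , f∣p) = [ id , (λ f≡p → contradiction (subst (_∣ d) f≡p (∣-trans f∣e e∣d)) p∤d) ]′
        (prime⇒irreducible pr f∣p)

-- Congruences between integers.

module Congruence where

  open import Data.Integer.Base hiding (suc; NonZero)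
  open import Data.Integer.Divisibility.Signed using (divides; ∣ᵤ⇒∣; ∣⇒∣ᵤ)
  open import Data.Integer.DivMod using (_%ℕ_; _/ℕ_; a≡a%ℕn+[a/ℕn]*n)
  open import Data.Integer.Properties
  open import Data.Integer.Tactic.RingSolver using (solve-∀)
  open import Data.Nat.Base as ℕ using (ℕ; zero; suc; NonZero)
  open import Data.Nat.Coprimality as Coprimality using (Coprime; coprime-divisor; coprime-Bézout)
  import Data.Nat.Divisibility as ℕ
  open import Data.Nat.GCD using (module Bézout)
  open import Data.Nat.Primality using (Prime; euclidsLemma)
  import Data.Nat.Properties as ℕ
  open import Data.Product.Base using (_×_; _,_; ∃-syntax)
  open import Data.Sum.Base using (_⊎_; inj₁; inj₂)
  open import Function.Base using (_∘_)
  open import Relation.Binary.Bundles using (Setoid)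
  open import Relation.Binary.PropositionalEquality
  open import Relation.Nullary
  import Relation.Binary.Reasoning.Setoid as SetoidReasoning

  infix 4 _≈_[_]

  -- The quotient is kept as data, so that deriving one congruence from others amounts to a ring
  -- identity exhibiting the new quotient.
  record _≈_[_] (x y : ℤ) (n : ℕ) : Set where
    constructor mk
    field
      quot : ℤ
      equality : x - y ≡ quot * + n

  private
    variable
      n m : ℕ
      x y z x′ y′ u v : ℤ

  ≡⇒≈ : x ≡ y → x ≈ y [ n ]
  ≡⇒≈ {x} refl = mk 0ℤ (+-inverseʳ x)

  -- With `lin₂`, the standard way to derive a congruence: u - v is written as a combination of
  -- known differences, which leaves an identity for the ring solver.
  lin₁ : ∀ c → x ≈ x′ [ n ] → u - v ≡ c * (x - x′) → u ≈ v [ n ]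
  lin₁ {n = n} c (mk k e) f = mk (c * k) (trans f (trans (cong (c *_) e) (sym (*-assoc c k (+ n)))))

  lin₂ : ∀ c d → x ≈ x′ [ n ] → y ≈ y′ [ n ] →
         u - v ≡ c * (x - x′) + d * (y - y′) → u ≈ v [ n ]
  lin₂ {n = n} c d (mk k e) (mk l f) g = mk (c * k + d * l)
    (trans g (trans (cong₂ (λ s t → c * s + d * t) e f) (lemma c k d l (+ n))))
    where
    lemma : ∀ c k d l n → c * (k * n) + d * (l * n) ≡ (c * k + d * l) * n
    lemma = solve-∀

  ≈-refl : x ≈ x [ n ]
  ≈-refl = ≡⇒≈ refl

  ≈-sym : x ≈ y [ n ] → y ≈ x [ n ]
  ≈-sym {x} {y} p = lin₁ -1ℤ p (lemma x y)
    where
    lemma : ∀ x y → y - x ≡ -1ℤ * (x - y)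
    lemma = solve-∀

  ≈-trans : x ≈ y [ n ] → y ≈ z [ n ] → x ≈ z [ n ]
  ≈-trans {x} {y} {z = z} p q = lin₂ 1ℤ 1ℤ p q (lemma x y z)
    where
    lemma : ∀ x y z → x - z ≡ 1ℤ * (x - y) + 1ℤ * (y - z)
    lemma = solve-∀

  ≈-setoid : ℕ → Setoid _ _
  ≈-setoid n = record
    { Carrier = ℤ ; _≈_ = _≈_[ n ]
    ; isEquivalence = record { refl = ≈-refl ; sym = ≈-sym ; trans = ≈-trans } }

  module ≈-Reasoning (n : ℕ) = SetoidReasoning (≈-setoid n)

  +-cong : x ≈ x′ [ n ] → y ≈ y′ [ n ] → x + y ≈ x′ + y′ [ n ]
  +-cong {x} {x′} {y = y} {y′} p q = lin₂ 1ℤ 1ℤ p q (lemma x x′ y y′)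
    where
    lemma : ∀ x x′ y y′ → (x + y) - (x′ + y′) ≡ 1ℤ * (x - x′) + 1ℤ * (y - y′)
    lemma = solve-∀

  -‿cong : x ≈ x′ [ n ] → y ≈ y′ [ n ] → x - y ≈ x′ - y′ [ n ]
  -‿cong {x} {x′} {y = y} {y′} p q = lin₂ 1ℤ -1ℤ p q (lemma x x′ y y′)
    where
    lemma : ∀ x x′ y y′ → (x - y) - (x′ - y′) ≡ 1ℤ * (x - x′) + -1ℤ * (y - y′)
    lemma = solve-∀

  *-cong : x ≈ x′ [ n ] → y ≈ y′ [ n ] → x * y ≈ x′ * y′ [ n ]
  *-cong {x} {x′} {y = y} {y′} p q = lin₂ y x′ p q (lemma x x′ y y′)
    where
    lemma : ∀ x x′ y y′ → (x * y) - (x′ * y′) ≡ y * (x - x′) + x′ * (y - y′)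
    lemma = solve-∀

  *-congˡ : ∀ k → x ≈ y [ n ] → k * x ≈ k * y [ n ]
  *-congˡ k = *-cong (≈-refl {x = k})

  *-congʳ : ∀ k → x ≈ y [ n ] → x * k ≈ y * k [ n ]
  *-congʳ k p = *-cong p (≈-refl {x = k})

  ^-cong : ∀ k → x ≈ y [ n ] → x ^ k ≈ y ^ k [ n ]
  ^-cong zero    p = ≈-refl
  ^-cong (suc k) p = *-cong p (^-cong k p)

  ≈⇒∣ : x ≈ y [ n ] → n ℕ.∣ ∣ x - y ∣
  ≈⇒∣ {n = n} (mk k e) = ∣⇒∣ᵤ {+ n} (divides k e)

  ∣⇒≈ : n ℕ.∣ ∣ x - y ∣ → x ≈ y [ n ]
  ∣⇒≈ {n} d with ∣ᵤ⇒∣ {+ n} d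
  ... | divides k e = mk k e

  ∣⇒≈0 : n ℕ.∣ ∣ x ∣ → x ≈ 0ℤ [ n ]
  ∣⇒≈0 {n} {x} d = ∣⇒≈ (subst (λ z → n ℕ.∣ ∣ z ∣) (sym (+-identityʳ x)) d)

  ≈0⇒∣ : x ≈ 0ℤ [ n ] → n ℕ.∣ ∣ x ∣
  ≈0⇒∣ {x} {n} p = subst (λ z → n ℕ.∣ ∣ z ∣) (+-identityʳ x) (≈⇒∣ p)

  _≈?_[_] : ∀ x y n → Dec (x ≈ y [ n ])
  x ≈? y [ n ] with n ℕ.∣? ∣ x - y ∣
  ... | yes d = yes (∣⇒≈ d)
  ... | no ¬d = no (¬d ∘ ≈⇒∣)

  ≈-weaken : m ℕ.∣ n → x ≈ y [ n ] → x ≈ y [ m ]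
  ≈-weaken m∣n p = ∣⇒≈ (ℕ.∣-trans m∣n (≈⇒∣ p))

  n≈0 : + n ≈ 0ℤ [ n ]
  n≈0 = ∣⇒≈0 ℕ.∣-refl

  x-y≈0⇒x≈y : x - y ≈ 0ℤ [ n ] → x ≈ y [ n ]
  x-y≈0⇒x≈y {x} {y} p = lin₁ 1ℤ p (lemma x y)
    where
    lemma : ∀ x y → x - y ≡ 1ℤ * ((x - y) - 0ℤ)
    lemma = solve-∀

  x≈y⇒x-y≈0 : x ≈ y [ n ] → x - y ≈ 0ℤ [ n ]
  x≈y⇒x-y≈0 {x} {y} p = lin₁ 1ℤ p (lemma x y)
    where
    lemma : ∀ x y → (x - y) - 0ℤ ≡ 1ℤ * (x - y)
    lemma = solve-∀

  *-scale : ∀ k → x ≈ y [ n ] → + k * x ≈ + k * y [ k ℕ.* n ]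
  *-scale {x} {y} {n} k (mk l e) = mk l (begin
    + k * x - + k * y  ≡⟨ lemma₁ (+ k) x y ⟩
    + k * (x - y)      ≡⟨ cong (+ k *_) e ⟩
    + k * (l * + n)    ≡⟨ lemma₂ (+ k) l (+ n) ⟩
    l * (+ k * + n)    ≡⟨ cong (l *_) (pos-* k n) ⟨
    l * + (k ℕ.* n)    ∎)
    where
    open ≡-Reasoning
    lemma₁ : ∀ k x y → k * x - k * y ≡ k * (x - y)
    lemma₁ = solve-∀
    lemma₂ : ∀ k l n → k * (l * n) ≡ l * (k * n)
    lemma₂ = solve-∀

  *-unscale : ∀ k .{{_ : NonZero k}} → + k * x ≈ + k * y [ k ℕ.* n ] → x ≈ y [ n ]
  *-unscale {x} {y} {n} k p = ∣⇒≈ (ℕ.*-cancelˡ-∣ k (subst (k ℕ.* n ℕ.∣_) eq (≈⇒∣ p)))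
    where
    lemma : ∀ k x y → k * x - k * y ≡ k * (x - y)
    lemma = solve-∀
    eq : ∣ + k * x - + k * y ∣ ≡ k ℕ.* ∣ x - y ∣
    eq = trans (cong ∣_∣ (lemma (+ k) x y)) (abs-* (+ k) (x - y))

  unit-cancel : ∀ w u → w * u ≈ 1ℤ [ n ] → u * x ≈ u * y [ n ] → x ≈ y [ n ]
  unit-cancel {x = x} {y} w u p q =
    lin₂ (- (x - y)) w p q (lemma w u x y)
    where
    lemma : ∀ w u x y → x - y ≡ - (x - y) * (w * u - 1ℤ) + w * (u * x - u * y)
    lemma = solve-∀

  coprime-cancel : ∀ k → Coprime n ∣ k ∣ → k * x ≈ k * y [ n ] → x ≈ y [ n ]
  coprime-cancel {n} {x} {y} k c p =
    ∣⇒≈ (coprime-divisor c (subst (n ℕ.∣_) eq (≈⇒∣ p)))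
    where
    lemma : ∀ k x y → k * x - k * y ≡ k * (x - y)
    lemma = solve-∀
    eq : ∣ k * x - k * y ∣ ≡ ∣ k ∣ ℕ.* ∣ x - y ∣
    eq = trans (cong ∣_∣ (lemma k x y)) (abs-* k (x - y))

  coprime⇒*∣ : ∀ {k} → Coprime m n → m ℕ.∣ k → n ℕ.∣ k → m ℕ.* n ℕ.∣ k
  coprime⇒*∣ {m} {n} c (ℕ.divides-refl l) d =
    subst (ℕ._∣ l ℕ.* m) (ℕ.*-comm n m)
      (ℕ.*-monoˡ-∣ m (coprime-divisor (Coprimality.sym c) (subst (n ℕ.∣_) (ℕ.*-comm l m) d)))

  ≈-crt : Coprime m n → x ≈ y [ m ] → x ≈ y [ n ] → x ≈ y [ m ℕ.* n ]
  ≈-crt c p q = ∣⇒≈ (coprime⇒*∣ c (≈⇒∣ p) (≈⇒∣ q))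

  -- The multiple of n in a Bézout identity, up to sign; the two cases are the two forms that the
  -- identity takes over ℕ.
  crt-idempotent : Coprime m n → ∃[ e ] e ≈ 1ℤ [ m ] × e ≈ 0ℤ [ n ]
  crt-idempotent {m} {n} c with coprime-Bézout c
  ... | Bézout.+- a b eq = - + (b ℕ.* n) , mk (- + a) (begin
        - + (b ℕ.* n) - 1ℤ          ≡⟨ lemma (+ (b ℕ.* n)) ⟩
        - (1ℤ + + (b ℕ.* n))        ≡⟨ cong -_ (cong +_ eq) ⟩
        - + (a ℕ.* m)               ≡⟨ cong -_ (pos-* a m) ⟩
        - (+ a * + m)               ≡⟨ neg-distribˡ-* (+ a) (+ m) ⟩
        - + a * + m                 ∎)
      , mk (- + b) (begin
        - + (b ℕ.* n) - 0ℤ          ≡⟨ +-identityʳ _ ⟩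
        - + (b ℕ.* n)               ≡⟨ cong -_ (pos-* b n) ⟩
        - (+ b * + n)               ≡⟨ neg-distribˡ-* (+ b) (+ n) ⟩
        - + b * + n                 ∎)
    where
    open ≡-Reasoning
    lemma : ∀ x → - x - 1ℤ ≡ - (1ℤ + x)
    lemma = solve-∀
  ... | Bézout.-+ a b eq = + (b ℕ.* n) , mk (+ a) (begin
        + (b ℕ.* n) - 1ℤ            ≡⟨ cong (λ z → + z - 1ℤ) eq ⟨
        1ℤ + + (a ℕ.* m) - 1ℤ       ≡⟨ lemma (+ (a ℕ.* m)) ⟩
        + (a ℕ.* m)                 ≡⟨ pos-* a m ⟩
        + a * + m                   ∎)
      , ∣⇒≈0 (ℕ.n∣m*n b)
    where
    open ≡-Reasoning
    lemma : ∀ x → 1ℤ + x - 1ℤ ≡ x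
    lemma = solve-∀

  prime-*≈0 : ∀ {p} → Prime p → x * y ≈ 0ℤ [ p ] → x ≈ 0ℤ [ p ] ⊎ y ≈ 0ℤ [ p ]
  prime-*≈0 {x} {y} {p} pr h with euclidsLemma ∣ x ∣ ∣ y ∣ pr
    (subst (p ℕ.∣_) (abs-* x y) (≈0⇒∣ h))
  ... | inj₁ d = inj₁ (∣⇒≈0 d)
  ... | inj₂ d = inj₂ (∣⇒≈0 d)

  prime-^≈0 : ∀ {p} → Prime p → ∀ k → x ^ k ≈ 0ℤ [ p ] → x ≈ 0ℤ [ p ]
  prime-^≈0 {x} pr zero    h =
    ≈-trans (≡⇒≈ (sym (*-identityʳ x))) (≈-trans (*-congˡ x h) (≡⇒≈ (*-zeroʳ x)))
  prime-^≈0 pr (suc k) h with prime-*≈0 pr h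
  ... | inj₁ e = e
  ... | inj₂ e = prime-^≈0 pr k e

  %ℕ-≈ : ∀ x n .{{_ : NonZero n}} → + (x %ℕ n) ≈ x [ n ]
  %ℕ-≈ x n = ≈-sym (mk (x /ℕ n) (begin
    x - + (x %ℕ n)                                     ≡⟨ cong (_- + (x %ℕ n)) (a≡a%ℕn+[a/ℕn]*n x n) ⟩
    + (x %ℕ n) + (x /ℕ n) * + n - + (x %ℕ n)           ≡⟨ lemma (+ (x %ℕ n)) _ ⟩
    (x /ℕ n) * + n                                     ∎))
    where
    open ≡-Reasoning
    lemma : ∀ r k → r + k - r ≡ k
    lemma = solve-∀

  ≈⇒≡ : ∀ {a b} → a ℕ.< n → b ℕ.< n → + a ≈ + b [ n ] → a ≡ b
  ≈⇒≡ {n} {a} {b} a<n b<n p = +-injective (i-j≡0⇒i≡j (+ a) (+ b) (∣i∣≡0⇒i≡0 lemma))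
    where
    ∣a-b∣<n : ∣ + a - + b ∣ ℕ.< n
    ∣a-b∣<n = ℕ.≤-<-trans
      (ℕ.≤-trans (ℕ.≤-reflexive (cong ∣_∣ (m-n≡m⊖n a b))) (∣m⊝n∣≤m⊔n a b))
      (ℕ.⊔-pres-<m a<n b<n)
    lemma : ∣ + a - + b ∣ ≡ 0
    lemma with ∣ + a - + b ∣ in eq
    ... | zero  = refl
    ... | suc k = contradiction (subst (n ℕ.∣_) eq (≈⇒∣ p)) (ℕ.>⇒∤ (subst (ℕ._< n) eq ∣a-b∣<n))

module CyclotomicScheme where

  open import Data.Fin.Base as Fin using (Fin; toℕ; fromℕ<)
  open import Data.Fin.Permutation using (Permutation′; permutation; _⟨$⟩ʳ_; _⟨$⟩ˡ_; inverseʳ)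
  open import Data.Fin.Properties
    using (toℕ-fromℕ<; toℕ-fromℕ; toℕ-inject₁; toℕ-injective; toℕ<n; pigeonhole; injective⇒≤)
  open import Data.Integer.Base as ℤ hiding (suc; NonZero; _⊖_; _≤_; _<_; _/_)
  open import Data.Integer.Divisibility.Signed using (divides; ∣ᵤ⇒∣)
  open import Data.Integer.DivMod using (_%ℕ_; n%ℕd<d)
  open import Data.Integer.Properties
  open import Data.Integer.Tactic.RingSolver using (solve-∀)
  open import Data.List.Base using (lookup; filter; upTo; []; _∷_)
  open import Data.List.Membership.Propositional using () renaming (_∈_ to _∈ᴸ_)
  open import Data.List.Membership.Propositional.Properties using (∈-filter⁺; ∈-upTo⁺)
  open import Data.List.Relation.Unary.All using (_∷_)
  open import Data.List.Relation.Unary.Any using (index)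
  open import Data.List.Relation.Unary.Any.Properties using (lookup-index)
  open import Data.Nat.Base as ℕ using (ℕ; zero; suc; NonZero)
  open import Data.Nat.Combinatorics
    using (_C_; nCn≡1; nCk≡nC[n∸k]; nCk+nC[k+1]≡[n+1]C[k+1]; nCk≡n!/k![n-k]!; k![n∸k]!∣n!)
  open import Data.Nat.Coprimality as Coprimality
    using (Coprime; coprime-divisor; coprime?)
  import Data.Nat.Divisibility as ℕ
  open import Data.Nat.DivMod as ℕ
    using (m/n*n≡m; m≡m%n+[m/n]*n; m%n<n; m/n*n≤m; m/n<m; m*n/o*n≡m/o; n/n≡1; /-monoˡ-≤;
           +-distrib-/-∣ʳ; /-congˡ; /-congʳ)
  open import Data.Nat.GCD using (gcd; gcd[m,n]∣m; gcd[m,n]∣n; gcd-greatest)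
  open import Data.Nat.Induction using (<-wellFounded)
  open import Data.Nat.Primality
    using (Prime; prime?; prime[2]; ¬prime[0]; ¬prime[1]; euclidsLemma; prime⇒irreducible;
           prime⇒nonZero; prime⇒nonTrivial)
  open import Data.Nat.Primality.Factorisation using (factorise)
  import Data.Nat.Properties as ℕ
  open import Data.Product.Base using (_×_; _,_; proj₁; proj₂; ∃-syntax; Σ-syntax)
  open import Data.Sum.Base as Sum using (_⊎_; inj₁; inj₂; [_,_]′)
  open import Function.Base using (_∘_; _$_; id)
  open import Induction.WellFounded using (Acc; acc)
  open import Level using (0ℓ)
  open import Relation.Binary.Definitions using (tri<; tri≈; tri>)
  open import Relation.Binary.PropositionalEquality hiding ([_])
  open import Relation.Nullary
  open import Relation.Nullary.Decidable using (map′; decidable-stable)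
  open import Relation.Unary using (Pred; Decidable; _∈_; _≐_; _⊆_)
  import Algebra.Properties.CommutativeSemiring.Binomial +-*-commutativeSemiring as Binomial
  import Algebra.Properties.Semiring.Exp +-*-semiring as Exp
  import Algebra.Properties.Semiring.Mult +-*-semiring as Mult
  import Algebra.Properties.Semiring.Sum +-*-semiring as ∑ᶠ
  open Congruence
  open Totient using (φ-*-∣; φ-*-prime)

  -- Finite sums and binomial coefficients.

  ∑ : ℕ → (ℕ → ℤ) → ℤ
  ∑ zero    f = 0ℤ
  ∑ (suc N) f = ∑ N f + f N

  ∑-cong≡ : ∀ N {f g : ℕ → ℤ} → (∀ k → f k ≡ g k) → ∑ N f ≡ ∑ N g
  ∑-cong≡ zero    e = refl
  ∑-cong≡ (suc N) e = cong₂ _+_ (∑-cong≡ N e) (e N)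

  ∑-≈0 : ∀ {n} N {f : ℕ → ℤ} → (∀ k → k ℕ.< N → f k ≈ 0ℤ [ n ]) → ∑ N f ≈ 0ℤ [ n ]
  ∑-≈0 zero    e = ≈-refl
  ∑-≈0 (suc N) e = +-cong (∑-≈0 N λ k k<N → e k (ℕ.m<n⇒m<1+n k<N)) (e N ℕ.≤-refl)

  sum-Fin≡∑ : ∀ N (f : ℕ → ℤ) → ∑ᶠ.sum {N} (f ∘ toℕ) ≡ ∑ N f
  sum-Fin≡∑ zero    f = refl
  sum-Fin≡∑ (suc N) f = trans (∑ᶠ.sum-init-last {N} (f ∘ toℕ))
    (cong₂ _+_
      (trans (∑ᶠ.sum-cong-≗ {N} (cong f ∘ toℕ-inject₁)) (sum-Fin≡∑ N f))
      (cong f (toℕ-fromℕ N)))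

  ^-agrees : ∀ x k → x Exp.^ k ≡ x ^ k
  ^-agrees x zero    = refl
  ^-agrees x (suc k) = cong (x *_) (^-agrees x k)

  ×-agrees : ∀ k x → k Mult.× x ≡ + k * x
  ×-agrees zero    x = refl
  ×-agrees (suc k) x = trans (cong (λ z → x + z) (×-agrees k x)) (sym (suc-* (+ k) x))

  binomial-theorem : ∀ t x y →
    (x + y) ^ t ≡ ∑ (suc t) λ k → + (t C k) * (x ^ k * y ^ (t ℕ.∸ k))
  binomial-theorem t x y = begin
    (x + y) ^ t                    ≡⟨ ^-agrees (x + y) t ⟨
    (x + y) Exp.^ t                ≡⟨ Binomial.theorem t x y ⟩
    ∑ᶠ.sum {suc t} (term ∘ toℕ)   ≡⟨ sum-Fin≡∑ (suc t) term ⟩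
    ∑ (suc t) term                 ≡⟨ ∑-cong≡ (suc t) (λ k →
        trans (×-agrees (t C k) _)
          (cong (+ (t C k) *_) (cong₂ _*_ (^-agrees x k) (^-agrees y (t ℕ.∸ k))))) ⟩
    ∑ (suc t) (λ k → + (t C k) * (x ^ k * y ^ (t ℕ.∸ k))) ∎
    where
    open ≡-Reasoning
    term : ℕ → ℤ
    term k = (t C k) Mult.× (x Exp.^ k * y Exp.^ (t ℕ.∸ k))

  nC0≡1 : ∀ n → n C 0 ≡ 1
  nC0≡1 n = trans (nCk≡nC[n∸k] {0} {n} ℕ.z≤n) (nCn≡1 n)

  prime∤! : ∀ {p} → Prime p → ∀ {n} → n ℕ.< p → ¬ p ℕ.∣ n ℕ.!
  prime∤! pr {zero}  n<p d = ¬prime[1] (subst Prime (ℕ.∣1⇒≡1 d) pr)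
  prime∤! pr {suc n} n<p d with euclidsLemma (suc n) (n ℕ.!) pr d
  ... | inj₁ p∣1+n = ℕ.>⇒∤ n<p p∣1+n
  ... | inj₂ p∣n!  = prime∤! pr (ℕ.<-trans (ℕ.n<1+n n) n<p) p∣n!

  -- The binomial coefficient divides n!, a product of numbers below p.
  prime∤C : ∀ {p} → Prime p → ∀ {n k} → k ℕ.≤ n → n ℕ.< p → ¬ p ℕ.∣ n C k
  prime∤C {p} pr {n} {k} k≤n n<p d =
    prime∤! pr n<p (subst (p ℕ.∣_) eq (ℕ.∣m⇒∣m*n _ d))
    where
    instance
      _ : NonZero (k ℕ.! ℕ.* (n ℕ.∸ k) ℕ.!)
      _ = ℕ.m*n≢0 (k ℕ.!) ((n ℕ.∸ k) ℕ.!) {{k ℕ.!≢0}} {{(n ℕ.∸ k) ℕ.!≢0}}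
    eq : (n C k) ℕ.* (k ℕ.! ℕ.* (n ℕ.∸ k) ℕ.!) ≡ n ℕ.!
    eq = trans (cong (λ c → c ℕ.* (k ℕ.! ℕ.* (n ℕ.∸ k) ℕ.!)) (nCk≡n!/k![n-k]! k≤n)) (m/n*n≡m (k![n∸k]!∣n! k≤n))

  -- Finite differences as a substitute for polynomial degree.

  Δ : (ℕ → ℤ) → ℕ → ℤ
  Δ g x = g (suc x) - g x

  -- The innermost difference is taken first, so that `Deg (suc d) g` unfolds to `Deg d (Δ g)`; the
  -- induction in `leibniz` relies on this.
  Δ^ : ℕ → (ℕ → ℤ) → ℕ → ℤ
  Δ^ zero    g = g
  Δ^ (suc d) g = Δ^ d (Δ g)

  Δ^-suc : ∀ d g x → Δ^ (suc d) g x ≡ Δ (Δ^ d g) x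
  Δ^-suc zero    g x = refl
  Δ^-suc (suc d) g x = Δ^-suc d (Δ g) x

  Δ^-+ : ∀ d e g → Δ^ (d ℕ.+ e) g ≡ Δ^ e (Δ^ d g)
  Δ^-+ zero    e g = refl
  Δ^-+ (suc d) e g = Δ^-+ d e (Δ g)

  Δ^-shift : ∀ d g x → Δ^ d (g ∘ suc) x ≡ Δ^ d g (suc x)
  Δ^-shift zero    g x = refl
  Δ^-shift (suc d) g x = Δ^-shift d (Δ g) x

  module Differences (n : ℕ) where

    infix 4 _≋_
    _≋_ : ℤ → ℤ → Set
    x ≋ y = x ≈ y [ n ]

    open ≈-Reasoning n

    Δ^-cong : ∀ d {g h} → (∀ x → g x ≋ h x) → ∀ x → Δ^ d g x ≋ Δ^ d h x
    Δ^-cong zero    e x = e x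
    Δ^-cong (suc d) {g} {h} e x = Δ^-cong d {Δ g} {Δ h} (λ x → -‿cong (e (suc x)) (e x)) x

    Δ^-plus : ∀ d g h x → Δ^ d (λ x → g x + h x) x ≋ Δ^ d g x + Δ^ d h x
    Δ^-plus zero    g h x = ≈-refl
    Δ^-plus (suc d) g h x = ≈-trans
      (Δ^-cong d (λ x → ≡⇒≈ (lemma (g (suc x)) (h (suc x)) (g x) (h x))) x)
      (Δ^-plus d (Δ g) (Δ h) x)
      where
      lemma : ∀ a b c d → (a + b) - (c + d) ≡ (a - c) + (b - d)
      lemma = solve-∀

    Δ^-scale : ∀ d c g x → Δ^ d (λ x → c * g x) x ≋ c * Δ^ d g x
    Δ^-scale zero    c g x = ≈-refl
    Δ^-scale (suc d) c g x = ≈-trans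
      (Δ^-cong d (λ x → ≡⇒≈ (lemma c (g (suc x)) (g x))) x)
      (Δ^-scale d c (Δ g) x)
      where
      lemma : ∀ c a b → c * a - c * b ≡ c * (a - b)
      lemma = solve-∀

    Δ^-0 : ∀ d {g} → (∀ x → g x ≋ 0ℤ) → ∀ x → Δ^ d g x ≋ 0ℤ
    Δ^-0 zero    e x = e x
    Δ^-0 (suc d) {g} e x = Δ^-0 d {Δ g} (λ x → -‿cong (e (suc x)) (e x)) x

    Δ^-∑ : ∀ d N (c : ℕ → ℤ) (g : ℕ → ℕ → ℤ) x →
      Δ^ d (λ x → ∑ N λ k → c k * g k x) x ≋ ∑ N λ k → c k * Δ^ d (g k) x
    Δ^-∑ d zero    c g x = Δ^-0 d (λ _ → ≈-refl) x
    Δ^-∑ d (suc N) c g x = ≈-trans (Δ^-plus d _ _ x)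
      (+-cong (Δ^-∑ d N c g x) (Δ^-scale d (c N) (g N) x))

    -- Plays the role of "degree at most d" for a function that is not given by a polynomial.
    Deg : ℕ → (ℕ → ℤ) → Set
    Deg d g = ∀ x → Δ^ (suc d) g x ≋ 0ℤ

    Deg-shift : ∀ d g → Deg d g → ∀ x → Δ^ d g (suc x) ≋ Δ^ d g x
    Deg-shift d g D x = x-y≈0⇒x≈y (≈-trans (≡⇒≈ (sym (Δ^-suc d g x))) (D x))

    Deg⇒0 : ∀ d D g → d ℕ.< D → Deg d g → ∀ x → Δ^ D g x ≋ 0ℤ
    Deg⇒0 d D g d<D Dg x with k , refl ← ℕ.m≤n⇒∃[o]m+o≡n d<D =
      ≈-trans (≡⇒≈ (cong (_$ x) (Δ^-+ (suc d) k g))) (Δ^-0 k Dg x)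

    private
      product-rule : ∀ g h x → Δ (λ x → g x * h x) x ≡ Δ g x * h (suc x) + g x * Δ h x
      product-rule g h x = lemma (g (suc x)) (h (suc x)) (g x) (h x)
        where
        lemma : ∀ a b c d → a * b - c * d ≡ (a - c) * b + c * (b - d)
        lemma = solve-∀

    -- The product rule splits the first difference into two products of lower total degree, and
    -- Pascal's rule adds the two resulting coefficients. The shifted argument of h is harmless
    -- because the top difference of h is constant.
    leibniz : ∀ d e g h → Deg d g → Deg e h → ∀ x →
      Δ^ (d ℕ.+ e) (λ x → g x * h x) x ≋ + ((d ℕ.+ e) C d) * (Δ^ d g x * Δ^ e h x)
    leibniz zero zero g h Dg Dh x = ≡⇒≈ (sym (*-identityˡ _))
    leibniz zero (suc e) g h Dg Dh x = begin
      Δ^ e (Δ (λ x → g x * h x)) x               ≈⟨ Δ^-cong e (λ x → begin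
        Δ (λ x → g x * h x) x                        ≡⟨ product-rule g h x ⟩
        Δ g x * h (suc x) + g x * Δ h x              ≈⟨ +-cong (*-congʳ (h (suc x)) (Dg x)) (≈-refl {x = g x * Δ h x}) ⟩
        0ℤ * h (suc x) + g x * Δ h x                 ≡⟨ +-identityˡ (g x * Δ h x) ⟩
        g x * Δ h x                                  ∎) x ⟩
      Δ^ e (λ x → g x * Δ h x) x                 ≈⟨ leibniz 0 e g (Δ h) Dg Dh x ⟩
      + (e C 0) * (g x * Δ^ e (Δ h) x)           ≡⟨ cong (λ c → + c * (g x * Δ^ e (Δ h) x)) (trans (nC0≡1 e) (sym (nC0≡1 (suc e)))) ⟩
      + (suc e C 0) * (g x * Δ^ e (Δ h) x)       ∎
    leibniz (suc d) zero g h Dg Dh x = begin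
      Δ^ (d ℕ.+ 0) (Δ (λ x → g x * h x)) x       ≈⟨ Δ^-cong (d ℕ.+ 0) (λ x → begin
        Δ (λ x → g x * h x) x                        ≡⟨ product-rule g h x ⟩
        Δ g x * h (suc x) + g x * Δ h x              ≈⟨ +-cong (≈-refl {x = Δ g x * h (suc x)}) (*-congˡ (g x) (Dh x)) ⟩
        Δ g x * h (suc x) + g x * 0ℤ                 ≡⟨ cong (λ z → Δ g x * h (suc x) + z) (*-zeroʳ (g x)) ⟩
        Δ g x * h (suc x) + 0ℤ                       ≡⟨ +-identityʳ _ ⟩
        Δ g x * h (suc x)                            ∎) x ⟩
      Δ^ (d ℕ.+ 0) (λ x → Δ g x * h (suc x)) x   ≈⟨ leibniz d 0 (Δ g) (h ∘ suc) Dg (Dh ∘ suc) x ⟩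
      + ((d ℕ.+ 0) C d) * (Δ^ d (Δ g) x * h (suc x))
          ≈⟨ *-cong (≡⇒≈ (cong +_ coeff)) (*-congˡ (Δ^ d (Δ g) x) (Deg-shift 0 h Dh x)) ⟩
      + ((suc d ℕ.+ 0) C suc d) * (Δ^ d (Δ g) x * h x) ∎
      where
      coeff : (d ℕ.+ 0) C d ≡ (suc d ℕ.+ 0) C suc d
      coeff rewrite ℕ.+-identityʳ d = trans (nCn≡1 d) (sym (nCn≡1 (suc d)))
    leibniz (suc d) (suc e) g h Dg Dh x = begin
      Δ^ (d ℕ.+ suc e) (Δ (λ x → g x * h x)) x
        ≈⟨ Δ^-cong (d ℕ.+ suc e) (λ x → ≡⇒≈ (product-rule g h x)) x ⟩
      Δ^ (d ℕ.+ suc e) (λ x → Δ g x * h (suc x) + g x * Δ h x) x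
        ≈⟨ Δ^-plus (d ℕ.+ suc e) _ _ x ⟩
      Δ^ (d ℕ.+ suc e) (λ x → Δ g x * h (suc x)) x + Δ^ (d ℕ.+ suc e) (λ x → g x * Δ h x) x
        ≈⟨ +-cong left right ⟩
      + (N C d) * (G * H) + + (N C suc d) * (G * H)
        ≡⟨ *-distribʳ-+ (G * H) (+ (N C d)) (+ (N C suc d)) ⟨
      + (N C d ℕ.+ N C suc d) * (G * H)
        ≡⟨ cong (λ c → + c * (G * H)) (nCk+nC[k+1]≡[n+1]C[k+1] N d) ⟩
      + (suc N C suc d) * (G * H) ∎
      where
      N = d ℕ.+ suc e
      G = Δ^ (suc d) g x
      H = Δ^ (suc e) h x
      left : Δ^ N (λ x → Δ g x * h (suc x)) x ≋ + (N C d) * (G * H)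
      left = begin
        Δ^ N (λ x → Δ g x * h (suc x)) x
          ≈⟨ leibniz d (suc e) (Δ g) (h ∘ suc) Dg
               (λ x → ≈-trans (≡⇒≈ (Δ^-shift (suc (suc e)) h x)) (Dh (suc x))) x ⟩
        + (N C d) * (G * Δ^ (suc e) (h ∘ suc) x)
          ≡⟨ cong (λ z → + (N C d) * (G * z)) (Δ^-shift (suc e) h x) ⟩
        + (N C d) * (G * Δ^ (suc e) h (suc x))
          ≈⟨ *-congˡ (+ (N C d)) (*-congˡ G (Deg-shift (suc e) h Dh x)) ⟩
        + (N C d) * (G * H) ∎
      right : Δ^ N (λ x → g x * Δ h x) x ≋ + (N C suc d) * (G * H)
      right rewrite ℕ.+-suc d e = leibniz (suc d) e g (Δ h) Dg Dh x

    Deg-* : ∀ d e g h → Deg d g → Deg e h → Deg (d ℕ.+ e) (λ x → g x * h x)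
    Deg-* d e g h Dg Dh x = begin
      Δ^ (suc (d ℕ.+ e)) gh x        ≡⟨ Δ^-suc (d ℕ.+ e) gh x ⟩
      Δ^ (d ℕ.+ e) gh (suc x) - Δ^ (d ℕ.+ e) gh x
        ≈⟨ -‿cong (leibniz d e g h Dg Dh (suc x)) (leibniz d e g h Dg Dh x) ⟩
      c * (Δ^ d g (suc x) * Δ^ e h (suc x)) - c * (Δ^ d g x * Δ^ e h x)
        ≈⟨ x≈y⇒x-y≈0 (*-congˡ c (*-cong (Deg-shift d g Dg x) (Deg-shift e h Dh x))) ⟩
      0ℤ ∎
      where
      gh = λ x → g x * h x
      c = + ((d ℕ.+ e) C d)

    Deg-^ : ∀ d g → Deg d g → ∀ j → Deg (j ℕ.* d) (λ x → g x ^ j)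
    Deg-^ d g Dg zero    x = ≈-refl
    Deg-^ d g Dg (suc j) = Deg-* d (j ℕ.* d) g (λ x → g x ^ j) Dg (Deg-^ d g Dg j)

    -- The multinomial coefficient (j d)! / (d!)^j as a product of binomials; for d = 1 it is j!.
    leadC : ℕ → ℕ → ℕ
    leadC d zero    = 1
    leadC d (suc j) = ((d ℕ.+ j ℕ.* d) C d) ℕ.* leadC d j

    leading-^ : ∀ d g → Deg d g → ∀ j x →
      Δ^ (j ℕ.* d) (λ x → g x ^ j) x ≋ + leadC d j * Δ^ d g x ^ j
    leading-^ d g Dg zero    x = ≈-refl
    leading-^ d g Dg (suc j) x = begin
      Δ^ (d ℕ.+ j ℕ.* d) (λ x → g x * g x ^ j) x
        ≈⟨ leibniz d (j ℕ.* d) g (λ x → g x ^ j) Dg (Deg-^ d g Dg j) x ⟩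
      + c * (G * Δ^ (j ℕ.* d) (λ x → g x ^ j) x)
        ≈⟨ *-congˡ (+ c) (*-congˡ G (leading-^ d g Dg j x)) ⟩
      + c * (G * (+ leadC d j * G ^ j))
        ≡⟨ lemma (+ c) G (+ leadC d j) (G ^ j) ⟩
      + c * + leadC d j * (G * G ^ j)
        ≡⟨ cong (_* (G * G ^ j)) (pos-* c (leadC d j)) ⟨
      + (c ℕ.* leadC d j) * (G * G ^ j) ∎
      where
      c = (d ℕ.+ j ℕ.* d) C d
      G = Δ^ d g x
      lemma : ∀ c G l P → c * (G * (l * P)) ≡ c * l * (G * P)
      lemma = solve-∀

  module PrimeDifferences {p : ℕ} (pr : Prime p) where

    open Differences p
    open ≈-Reasoning p

    prime∤leadC : ∀ d j → j ℕ.* d ℕ.< p → ¬ p ℕ.∣ leadC d j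
    prime∤leadC d zero    _  h = ¬prime[1] (subst Prime (ℕ.∣1⇒≡1 h) pr)
    prime∤leadC d (suc j) lt h with euclidsLemma ((d ℕ.+ j ℕ.* d) C d) (leadC d j) pr h
    ... | inj₁ h₁ = prime∤C pr (ℕ.m≤m+n d (j ℕ.* d)) lt h₁
    ... | inj₂ h₂ = prime∤leadC d j (ℕ.≤-<-trans (ℕ.m≤n+m (j ℕ.* d) d) lt) h₂

    pos-cancel : ∀ k x → ¬ p ℕ.∣ k → + k * x ≋ 0ℤ → x ≋ 0ℤ
    pos-cancel k x ¬p∣k h with prime-*≈0 {+ k} {x} pr h
    ... | inj₁ e = contradiction (≈0⇒∣ e) ¬p∣k
    ... | inj₂ e = e

    Deg-z : Deg 1 (λ z → + z)
    Deg-z z = ≡⇒≈ (lemma (+ z))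
      where
      lemma : ∀ z → ((1ℤ + (1ℤ + z)) - (1ℤ + z)) - ((1ℤ + z) - z) ≡ 0ℤ
      lemma = solve-∀

    -- Taking N differences kills the monomials below z ^ N and turns z ^ N into N!, which is
    -- invertible mod p since N < p.
    top-coefficient≈0 : ∀ N (a : ℕ → ℤ) → N ℕ.< p →
      (∀ z → ∑ (suc N) (λ k → a k * (+ z) ^ k) ≋ 0ℤ) → a N ≋ 0ℤ
    top-coefficient≈0 N a N<p vanish = top
      where
      N*1≡N : N ℕ.* 1 ≡ N
      N*1≡N = ℕ.*-identityʳ N
      lower : ∑ N (λ k → a k * Δ^ N (λ z → (+ z) ^ k) 0) ≋ 0ℤ
      lower = ∑-≈0 N λ k k<N → ≈-trans
        (*-congˡ (a k) (Deg⇒0 (k ℕ.* 1) N (λ z → (+ z) ^ k) (subst (ℕ._< N) (sym (ℕ.*-identityʳ k)) k<N) (Deg-^ 1 +_ Deg-z k) 0))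
        (≡⇒≈ (*-zeroʳ (a k)))
      leading : Δ^ N (λ z → (+ z) ^ N) 0 ≋ + leadC 1 N
      leading = begin
        Δ^ N (λ z → (+ z) ^ N) 0           ≡⟨ cong (λ m → Δ^ m (λ z → (+ z) ^ N) 0) N*1≡N ⟨
        Δ^ (N ℕ.* 1) (λ z → (+ z) ^ N) 0   ≈⟨ leading-^ 1 +_ Deg-z N 0 ⟩
        + leadC 1 N * 1ℤ ^ N               ≡⟨ cong (+ leadC 1 N *_) (^-zeroˡ N) ⟩
        + leadC 1 N * 1ℤ                   ≡⟨ *-identityʳ (+ leadC 1 N) ⟩
        + leadC 1 N                        ∎
      top : a N ≋ 0ℤ
      top = pos-cancel (leadC 1 N) (a N) (prime∤leadC 1 N (subst (ℕ._< p) (sym N*1≡N) N<p)) (begin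
        + leadC 1 N * a N                  ≡⟨ *-comm (+ leadC 1 N) (a N) ⟩
        a N * + leadC 1 N                  ≈⟨ *-congˡ (a N) leading ⟨
        a N * Δ^ N (λ z → (+ z) ^ N) 0     ≡⟨ +-identityˡ _ ⟨
        0ℤ + a N * Δ^ N (λ z → (+ z) ^ N) 0 ≈⟨ +-cong lower (≈-refl {x = a N * Δ^ N (λ z → (+ z) ^ N) 0}) ⟨
        ∑ (suc N) (λ k → a k * Δ^ N (λ z → (+ z) ^ k) 0) ≈⟨ Δ^-∑ N (suc N) a (λ k z → (+ z) ^ k) 0 ⟨
        Δ^ N (λ z → ∑ (suc N) (λ k → a k * (+ z) ^ k)) 0 ≈⟨ Δ^-0 N vanish 0 ⟩
        0ℤ                                 ∎)

    coefficients≈0 : ∀ N (a : ℕ → ℤ) → N ℕ.≤ p →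
      (∀ z → ∑ N (λ k → a k * (+ z) ^ k) ≋ 0ℤ) → ∀ k → k ℕ.< N → a k ≋ 0ℤ
    coefficients≈0 (suc N) a N<p vanish k k<1+N with ℕ.m≤n⇒m<n∨m≡n (ℕ.s≤s⁻¹ k<1+N)
    ... | inj₂ refl = top-coefficient≈0 N a N<p vanish
    ... | inj₁ k<N = coefficients≈0 N a (ℕ.<⇒≤ N<p) vanish′ k k<N
      where
      aN≈0 : a N ≋ 0ℤ
      aN≈0 = top-coefficient≈0 N a N<p vanish
      vanish′ : ∀ z → ∑ N (λ k → a k * (+ z) ^ k) ≋ 0ℤ
      vanish′ z = begin
        ∑ N (λ k → a k * (+ z) ^ k)                   ≡⟨ +-identityʳ _ ⟨
        ∑ N (λ k → a k * (+ z) ^ k) + 0ℤ              ≈⟨ +-cong (≈-refl {x = ∑ N (λ k → a k * (+ z) ^ k)}) (*-congʳ ((+ z) ^ N) aN≈0) ⟨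
        ∑ N (λ k → a k * (+ z) ^ k) + a N * (+ z) ^ N ≈⟨ vanish z ⟩
        0ℤ ∎

    module _ (t : ℕ) (t+t<p : t ℕ.+ t ℕ.< p) (f : ℕ → ℤ)
             (same-power : ∀ x y → (f x - f y) ^ t ≋ (+ x - + y) ^ t)
             (surjective : ∀ z → ∃[ y ] f y ≋ z) where

      private
        t<p : t ℕ.< p
        t<p = ℕ.≤-<-trans (ℕ.m≤m+n t t) t+t<p

      -- (f x + z) ^ t is (x - y) ^ t with y chosen so that f y = - z, so it has
      -- degree t in x for every z; now compare coefficients of powers of z.
      Deg-power : ∀ j → j ℕ.≤ t → Deg t (λ x → f x ^ j)
      Deg-power j j≤t x = subst (λ i → Δ^ (suc t) (λ x → f x ^ i) x ≋ 0ℤ) (ℕ.m∸[m∸n]≡n j≤t)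
        (pos-cancel (t C k) (D k) (prime∤C pr k≤t t<p)
          (coefficients≈0 (suc t) (λ k → + (t C k) * D k) t<p vanish k (ℕ.s≤s k≤t)))
        where
        k = t ℕ.∸ j
        k≤t = ℕ.m∸n≤m t j
        D : ℕ → ℤ
        D k = Δ^ (suc t) (λ x → f x ^ (t ℕ.∸ k)) x
        lemma₁ : ∀ c z y → c * (z * y) ≡ (c * z) * y
        lemma₁ = solve-∀
        lemma₂ : ∀ c z y → (c * z) * y ≡ (c * y) * z
        lemma₂ = solve-∀
        linear : ∀ y → Deg 1 (λ x → + x - + y)
        linear y z = ≡⇒≈ (lemma (+ z) (+ y))
          where
          lemma : ∀ z y → (((1ℤ + (1ℤ + z)) - y) - ((1ℤ + z) - y)) - (((1ℤ + z) - y) - (z - y)) ≡ 0ℤ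
          lemma = solve-∀
        vanish : ∀ z → ∑ (suc t) (λ k → + (t C k) * D k * (+ z) ^ k) ≋ 0ℤ
        vanish z with y , fy≈-z ← surjective (- + z) = begin
          ∑ (suc t) (λ k → + (t C k) * D k * (+ z) ^ k)
            ≡⟨ ∑-cong≡ (suc t) (λ k → lemma₂ (+ (t C k)) ((+ z) ^ k) (D k)) ⟨
          ∑ (suc t) (λ k → + (t C k) * (+ z) ^ k * D k)
            ≈⟨ Δ^-∑ (suc t) (suc t) (λ k → + (t C k) * (+ z) ^ k) (λ k x → f x ^ (t ℕ.∸ k)) x ⟨
          Δ^ (suc t) (λ x → ∑ (suc t) (λ k → + (t C k) * (+ z) ^ k * f x ^ (t ℕ.∸ k))) x
            ≈⟨ Δ^-cong (suc t) (λ x → begin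
              ∑ (suc t) (λ k → + (t C k) * (+ z) ^ k * f x ^ (t ℕ.∸ k))
                ≡⟨ ∑-cong≡ (suc t) (λ k → lemma₁ (+ (t C k)) ((+ z) ^ k) (f x ^ (t ℕ.∸ k))) ⟨
              ∑ (suc t) (λ k → + (t C k) * ((+ z) ^ k * f x ^ (t ℕ.∸ k)))
                ≡⟨ binomial-theorem t (+ z) (f x) ⟨
              (+ z + f x) ^ t
                ≡⟨ cong (_^ t) (trans (+-comm (+ z) (f x)) (cong (λ w → f x + w) (sym (neg-involutive (+ z))))) ⟩
              (f x - - + z) ^ t
                ≈⟨ ^-cong t (-‿cong (≈-refl {x = f x}) fy≈-z) ⟨
              (f x - f y) ^ t
                ≈⟨ same-power x y ⟩
              (+ x - + y) ^ t ∎) x ⟩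
          Δ^ (suc t) (λ x → (+ x - + y) ^ t) x
            ≡⟨ cong (λ i → Δ^ (suc i) (λ x → (+ x - + y) ^ t) x) (ℕ.*-identityʳ t) ⟨
          Δ^ (suc (t ℕ.* 1)) (λ x → (+ x - + y) ^ t) x
            ≈⟨ Deg-^ 1 (λ x → + x - + y) (linear y) t x ⟩
          0ℤ ∎

      Deg-drop : ∀ e → 2 ℕ.+ e ℕ.≤ t → Deg (2 ℕ.+ e) f → Deg (1 ℕ.+ e) f
      Deg-drop e d≤t Df x = prime-^≈0 pr j (pos-cancel (leadC d j) _
          (prime∤leadC d j (ℕ.≤-<-trans jd≤t+t t+t<p)) (begin
        + leadC d j * Δ^ d f x ^ j   ≈⟨ leading-^ d f Df j x ⟨
        Δ^ (j ℕ.* d) (λ x → f x ^ j) x  ≈⟨ Deg⇒0 t (j ℕ.* d) (λ x → f x ^ j) t<jd (Deg-power j j≤t) x ⟩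
        0ℤ ∎))
        where
        d = 2 ℕ.+ e
        -- The least j with t < j d. From d ≥ 2 follows j ≤ t, so f ^ j has degree at most t < j d
        -- and its difference of order j d vanishes; from d ≤ t follows j d ≤ t + t < p, so the
        -- constant `leadC d j` can be cancelled.
        j = suc (t ℕ./ d)
        instance
          _ : NonZero t
          _ = ℕ.>-nonZero (ℕ.<-≤-trans ℕ.z<s d≤t)
        j≤t : j ℕ.≤ t
        j≤t = m/n<m t d (ℕ.s≤s (ℕ.s≤s ℕ.z≤n))
        t<jd : t ℕ.< j ℕ.* d
        t<jd = ℕ.≤-<-trans (ℕ.≤-reflexive (m≡m%n+[m/n]*n t d)) (ℕ.+-monoˡ-< _ (m%n<n t d))
        jd≤t+t : j ℕ.* d ℕ.≤ t ℕ.+ t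
        jd≤t+t = ℕ.+-mono-≤ d≤t (m/n*n≤m t d)

      same-power⇒affine : 1 ℕ.≤ t → ∀ x → Δ^ 2 f x ≋ 0ℤ
      same-power⇒affine 1≤t = drop t ℕ.≤-refl 1≤t λ x →
        ≈-trans (Δ^-cong (suc t) (λ x → ≡⇒≈ (sym (^-identityʳ (f x)))) x) (Deg-power 1 1≤t x)
        where
        drop : ∀ d → d ℕ.≤ t → 1 ℕ.≤ d → Deg d f → Deg 1 f
        drop (suc zero)    _   _ Df = Df
        drop (suc (suc e)) d≤t _ Df =
          drop (suc e) (ℕ.≤-trans (ℕ.n≤1+n _) d≤t) (ℕ.s≤s ℕ.z≤n) (Deg-drop e d≤t Df)

  -- Orders of q and how the index changes with the modulus.

  least≤ : {P : Pred ℕ 0ℓ} (P? : Decidable P) → ∀ b {i} → P i → least P? b ℕ.≤ i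
  least≤ P? zero    Pi = ℕ.z≤n
  least≤ P? (suc b) {i} Pi with P? 0 | i | Pi
  ... | yes _   | _     | _  = ℕ.z≤n
  ... | no ¬P0  | zero  | P0 = contradiction P0 ¬P0
  ... | no _    | suc j | Pj = ℕ.s≤s (least≤ (P? ∘ suc) b Pj)

  least-satisfies : {P : Pred ℕ 0ℓ} (P? : Decidable P) → ∀ b {i} → i ℕ.< b → P i → P (least P? b)
  least-satisfies P? (suc b) {i} i<b Pi with P? 0 | i | i<b | Pi
  ... | yes P0  | _     | _         | _  = P0
  ... | no ¬P0  | zero  | _         | P0 = contradiction P0 ¬P0
  ... | no _    | suc j | ℕ.s≤s j<b | Pj = least-satisfies (P? ∘ suc) b j<b Pj

  pos-^ : ∀ q k → + (q ℕ.^ k) ≡ (+ q) ^ k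
  pos-^ q zero    = refl
  pos-^ q (suc k) = trans (pos-* q (q ℕ.^ k)) (cong (+ q *_) (pos-^ q k))

  ∣-∣≡∣-∣ : ∀ a b → ∣ + a - + b ∣ ≡ ℕ.∣ a - b ∣
  ∣-∣≡∣-∣ a b with ℕ.≤-total b a
  ... | inj₁ b≤a = begin
    ∣ + a - + b ∣  ≡⟨ cong ∣_∣ (trans (m-n≡m⊖n a b) (⊖-≥ b≤a)) ⟩
    a ℕ.∸ b        ≡⟨ ℕ.m≤n⇒∣n-m∣≡n∸m b≤a ⟨
    ℕ.∣ a - b ∣    ∎
    where open ≡-Reasoning
  ... | inj₂ a≤b = begin
    ∣ + a - + b ∣  ≡⟨ cong ∣_∣ (m-n≡m⊖n a b) ⟩
    ∣ a ℤ.⊖ b ∣      ≡⟨ ∣⊖∣-≤ a≤b ⟩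
    b ℕ.∸ a        ≡⟨ ℕ.m≤n⇒∣m-n∣≡n∸m a≤b ⟨
    ℕ.∣ a - b ∣    ∎
    where open ≡-Reasoning

  coprime-^ : ∀ {n} q k → Coprime n q → Coprime n (q ℕ.^ k)
  coprime-^ q zero    c (e∣n , e∣1) = ℕ.∣1⇒≡1 e∣1
  coprime-^ q (suc k) c {e} (e∣n , e∣q^) = coprime-^ q k c (e∣n , coprime-divisor e⊥q e∣q^)
    where
    e⊥q : Coprime e q
    e⊥q (f∣e , f∣q) = c (ℕ.∣-trans f∣e e∣n , f∣q)

  ≈1-^ : ∀ {x n} k → x ≈ 1ℤ [ n ] → x ^ k ≈ 1ℤ [ n ]
  ≈1-^ k p = ≈-trans (^-cong k p) (≡⇒≈ (^-zeroˡ k))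

  module Order (q : ℕ) where

    Q : ℤ
    Q = + q

    abs-Q^ : ∀ k → ∣ Q ^ k ∣ ≡ q ℕ.^ k
    abs-Q^ k = cong ∣_∣ (sym (pos-^ q k))

    module _ (n : ℕ) .{{_ : NonZero n}} (c : Coprime n q) where

      Q^-cancel : ∀ i k → Q ^ i ≈ Q ^ (i ℕ.+ k) [ n ] → Q ^ k ≈ 1ℤ [ n ]
      Q^-cancel i k h = ≈-sym (coprime-cancel (Q ^ i)
        (subst (Coprime n) (sym (abs-Q^ i)) (coprime-^ q i c))
        (≈-trans (≡⇒≈ (*-identityʳ (Q ^ i))) (≈-trans h (≡⇒≈ (^-distribˡ-+-* Q i k)))))

      private
        divides⇒≈1 : ∀ k → n ℕ.∣ ℕ.∣ q ℕ.^ k - 1 ∣ → Q ^ k ≈ 1ℤ [ n ]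
        divides⇒≈1 k d = ≈-trans (≡⇒≈ (sym (pos-^ q k)))
          (∣⇒≈ (subst (n ℕ.∣_) (sym (∣-∣≡∣-∣ (q ℕ.^ k) 1)) d))

        ≈1⇒divides : ∀ k → Q ^ k ≈ 1ℤ [ n ] → n ℕ.∣ ℕ.∣ q ℕ.^ k - 1 ∣
        ≈1⇒divides k p = subst (n ℕ.∣_) (∣-∣≡∣-∣ (q ℕ.^ k) 1)
          (≈⇒∣ (≈-trans (≡⇒≈ (pos-^ q k)) p))

        P : Pred ℕ 0ℓ
        P i = n ℕ.∣ ℕ.∣ q ℕ.^ suc i - 1 ∣

        P? : Decidable P
        P? i = n ℕ.∣? ℕ.∣ q ℕ.^ suc i - 1 ∣


        -- Two of the n + 1 powers with exponents 0, ..., n agree mod n. The period found is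
        -- therefore at most n, and the search in `ord`, which tries the exponents 1, ..., n,
        -- succeeds.
        some-power : ∃[ i ] i ℕ.< n × Q ^ suc i ≈ 1ℤ [ n ]
        some-power with i , j , i<j , eq ← pigeonhole (ℕ.n<1+n n) (λ i → fromℕ< (n%ℕd<d (Q ^ toℕ i) n))
          with k , 1+i+k≡j ← ℕ.m≤n⇒∃[o]m+o≡n i<j
          = k
          , ℕ.≤-trans (ℕ.s≤s (ℕ.m≤n+m k (toℕ i))) (ℕ.≤-trans (ℕ.≤-reflexive 1+i+k≡j) (ℕ.s≤s⁻¹ (toℕ<n j)))
          , Q^-cancel (toℕ i) (suc k) (begin
              Q ^ toℕ i                ≈⟨ %ℕ-≈ (Q ^ toℕ i) n ⟨
              + ((Q ^ toℕ i) %ℕ n)     ≡⟨ cong +_ (trans (sym (toℕ-fromℕ< _)) (trans (cong toℕ eq) (toℕ-fromℕ< _))) ⟩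
              + ((Q ^ toℕ j) %ℕ n)     ≈⟨ %ℕ-≈ (Q ^ toℕ j) n ⟩
              Q ^ toℕ j                ≡⟨ cong (Q ^_) (trans (sym 1+i+k≡j) (sym (ℕ.+-suc (toℕ i) k))) ⟩
              Q ^ (toℕ i ℕ.+ suc k)    ∎)
          where open ≈-Reasoning n

      Q^ord≈1 : Q ^ ord n q ≈ 1ℤ [ n ]
      Q^ord≈1 = let i , i<n , p = some-power in
        divides⇒≈1 (ord n q) (least-satisfies {P} P? n {i} i<n (≈1⇒divides (suc i) p))

      ord≤ : ∀ {k} → 1 ℕ.≤ k → Q ^ k ≈ 1ℤ [ n ] → ord n q ℕ.≤ k
      ord≤ {suc i} _ p = ℕ.s≤s (least≤ {P} P? n {i} (≈1⇒divides (suc i) p))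

      Q^*ord≈1 : ∀ k → Q ^ (k ℕ.* ord n q) ≈ 1ℤ [ n ]
      Q^*ord≈1 k = ≈-trans (≡⇒≈ (trans (cong (Q ^_) (ℕ.*-comm k (ord n q))) (sym (^-*-assoc Q (ord n q) k))))
        (≈1-^ k Q^ord≈1)

      ord∣ : ∀ {k} → Q ^ k ≈ 1ℤ [ n ] → ord n q ℕ.∣ k
      ord∣ {k} p = ℕ.m%n≡0⇒n∣m k o (r≡0 (k ℕ.% o) refl)
        where
        o = ord n q
        Q^r≈1 : Q ^ (k ℕ.% o) ≈ 1ℤ [ n ]
        Q^r≈1 = Q^-cancel (k ℕ./ o ℕ.* o) (k ℕ.% o) (begin
          Q ^ (k ℕ./ o ℕ.* o)               ≈⟨ Q^*ord≈1 (k ℕ./ o) ⟩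
          1ℤ                                ≈⟨ p ⟨
          Q ^ k                             ≡⟨ cong (Q ^_) (trans (m≡m%n+[m/n]*n k o) (ℕ.+-comm (k ℕ.% o) _)) ⟩
          Q ^ (k ℕ./ o ℕ.* o ℕ.+ k ℕ.% o)   ∎)
          where open ≈-Reasoning n
        r≡0 : ∀ r → k ℕ.% o ≡ r → k ℕ.% o ≡ 0
        r≡0 zero    e = e
        r≡0 (suc r) e = contradiction
          (ord≤ (ℕ.≤-trans (ℕ.s≤s ℕ.z≤n) (ℕ.≤-reflexive (sym e))) Q^r≈1)
          (ℕ.<⇒≱ (m%n<n k o))

      Q^-inverse : ∀ i → ∃[ j ] Q ^ j * Q ^ i ≈ 1ℤ [ n ]
      -- The exponent `i * (ord n q - 1)` represents -i, which keeps all exponents in ℕ.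
      Q^-inverse i = i ℕ.* o-1 , ≈-trans (≡⇒≈ (trans (sym (^-distribˡ-+-* Q (i ℕ.* o-1) i)) (cong (Q ^_) eq))) (Q^*ord≈1 i)
        where
        o-1 = ℕ.pred (ord n q)
        eq : i ℕ.* o-1 ℕ.+ i ≡ i ℕ.* ord n q
        eq = trans (ℕ.+-comm _ i) (sym (ℕ.*-suc i o-1))

      private
        powers-distinct< : ∀ {i j} → i ℕ.< j → j ℕ.< ord n q → ¬ Q ^ i ≈ Q ^ j [ n ]
        powers-distinct< {i} {j} i<j j<o p =
          let k , 1+i+k≡j = ℕ.m≤n⇒∃[o]m+o≡n i<j
              1+k≤j = ℕ.≤-trans (ℕ.s≤s (ℕ.m≤n+m k i)) (ℕ.≤-reflexive 1+i+k≡j)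
              Q^1+k≈1 = Q^-cancel i (suc k)
                (≈-trans p (≡⇒≈ (cong (Q ^_) (trans (sym 1+i+k≡j) (sym (ℕ.+-suc i k))))))
          in contradiction (ord≤ (ℕ.s≤s ℕ.z≤n) Q^1+k≈1) (ℕ.<⇒≱ (ℕ.≤-<-trans 1+k≤j j<o))

      powers-distinct : ∀ {i j} → i ℕ.< ord n q → j ℕ.< ord n q → Q ^ i ≈ Q ^ j [ n ] → i ≡ j
      powers-distinct {i} {j} i<o j<o p with ℕ.<-cmp i j
      ... | tri≈ _ i≡j _ = i≡j
      ... | tri< i<j _ _ = contradiction p (powers-distinct< i<j j<o)
      ... | tri> _ _ j<i = contradiction (≈-sym p) (powers-distinct< j<i i<o)

      -- The residues of the first `ord n q` powers are distinct units, so their positions in the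
      -- list whose length is `φ n` are distinct.
      ord≤φ : ord n q ℕ.≤ φ n
      ord≤φ = injective⇒≤ {f = λ i → index (member i)} inj
        where
        residue : Fin (ord n q) → ℕ
        residue i = (Q ^ toℕ i) %ℕ n
        coprime : ∀ i → Coprime (residue i) n
        coprime i {e} (e∣r , e∣n) = coprime-^ q (toℕ i) c (e∣n , subst (e ℕ.∣_) (abs-Q^ (toℕ i)) (≈0⇒∣ (≈-trans
          (≈-sym (≈-weaken e∣n (%ℕ-≈ (Q ^ toℕ i) n))) (∣⇒≈0 e∣r))))
        units = filter (λ k → coprime? k n) (upTo n)
        member : ∀ i → residue i ∈ᴸ units
        member i = ∈-filter⁺ (λ k → coprime? k n) (∈-upTo⁺ (n%ℕd<d (Q ^ toℕ i) n)) (coprime i)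
        index-residue : ∀ i → residue i ≡ lookup units (index (member i))
        index-residue i = lookup-index (member i)
        inj : ∀ {i j} → index (member i) ≡ index (member j) → i ≡ j
        inj {i} {j} eq = toℕ-injective (powers-distinct (toℕ<n i) (toℕ<n j)
          (≈-trans (≈-sym (%ℕ-≈ (Q ^ toℕ i) n)) (≈-trans (≡⇒≈ (cong +_ residue≡)) (%ℕ-≈ (Q ^ toℕ j) n))))
          where
          residue≡ : residue i ≡ residue j
          residue≡ = trans (index-residue i) (trans (cong (lookup units) eq) (sym (index-residue j)))

    module _ (d n L : ℕ) .{{_ : NonZero d}} .{{_ : NonZero n}} .{{_ : NonZero L}}
             (c : Coprime n q) (d∣n : d ℕ.∣ n) (φn≡Lφd : φ n ≡ L ℕ.* φ d)
             (kernel-order : Q ^ (L ℕ.* ord d q) ≈ 1ℤ [ n ]) where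

      private
        s = ord d q

        coprime-d : Coprime d q
        coprime-d (e∣d , e∣q) = c (ℕ.∣-trans e∣d d∣n , e∣q)

        s∣ord : s ℕ.∣ ord n q
        s∣ord = ord∣ d coprime-d (≈-weaken d∣n (Q^ord≈1 n c))

        -- Here t is the order of Q ^ s mod n, and r is the index of its powers in the kernel of
        -- reduction, a group of order L.
        ratio : ∃[ r ] ∃[ t ] ord n q ≡ t ℕ.* s × L ≡ r ℕ.* t
        ratio = ℕ.quotient t∣L , ℕ.quotient s∣ord , ℕ._∣_.equality s∣ord , ℕ._∣_.equality t∣L
          where
          t∣L : ℕ.quotient s∣ord ℕ.∣ L
          t∣L = ℕ.*-cancelʳ-∣ s
            (subst (ℕ._∣ L ℕ.* s) (ℕ._∣_.equality s∣ord) (ord∣ n c kernel-order))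

        idx-n : ∀ r t → ord n q ≡ t ℕ.* s → L ≡ r ℕ.* t → idx n q ≡ (r ℕ.* φ d) ℕ./ s
        idx-n r zero    () _
        idx-n r t@(suc _) e f = begin
          φ n ℕ./ ord n q                      ≡⟨ /-congʳ {m = φ n} e ⟩
          φ n ℕ./ (t ℕ.* s)                    ≡⟨ /-congˡ {t ℕ.* s} (begin
            φ n                                    ≡⟨ φn≡Lφd ⟩
            L ℕ.* φ d                              ≡⟨ cong (ℕ._* φ d) f ⟩
            r ℕ.* t ℕ.* φ d                        ≡⟨ ℕ.*-assoc r t (φ d) ⟩
            r ℕ.* (t ℕ.* φ d)                      ≡⟨ cong (r ℕ.*_) (ℕ.*-comm t (φ d)) ⟩
            r ℕ.* (φ d ℕ.* t)                      ≡⟨ ℕ.*-assoc r (φ d) t ⟨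
            r ℕ.* φ d ℕ.* t                        ∎) ⟩
          (r ℕ.* φ d ℕ.* t) ℕ./ (t ℕ.* s)      ≡⟨ /-congʳ {m = r ℕ.* φ d ℕ.* t} (ℕ.*-comm t s) ⟩
          (r ℕ.* φ d ℕ.* t) ℕ./ (s ℕ.* t)      ≡⟨ m*n/o*n≡m/o (r ℕ.* φ d) t s ⟩
          (r ℕ.* φ d) ℕ./ s                    ∎
          where open ≡-Reasoning

        -- Division rounds down, so a larger numerator is not enough: at least one further summand
        -- `φ d` is added, and s ≤ `φ d` makes it raise the quotient by at least 1.
        idx-increases : ∀ r → idx d q ℕ.< ((2 ℕ.+ r) ℕ.* φ d) ℕ./ s
        idx-increases r = begin-strict
          φ d ℕ./ s                            <⟨ ℕ.n<1+n _ ⟩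
          1 ℕ.+ φ d ℕ./ s                      ≡⟨ ℕ.+-comm 1 _ ⟩
          φ d ℕ./ s ℕ.+ 1                      ≡⟨ cong (φ d ℕ./ s ℕ.+_) (n/n≡1 s) ⟨
          φ d ℕ./ s ℕ.+ s ℕ./ s                ≡⟨ +-distrib-/-∣ʳ (φ d) (ℕ.∣-refl {s}) ⟨
          (φ d ℕ.+ s) ℕ./ s                    ≤⟨ /-monoˡ-≤ s (ℕ.+-monoʳ-≤ (φ d) (ℕ.≤-trans (ord≤φ d coprime-d) (ℕ.m≤m+n (φ d) (r ℕ.* φ d)))) ⟩
          ((2 ℕ.+ r) ℕ.* φ d) ℕ./ s            ∎
          where open ℕ.≤-Reasoning

      -- Equal indices force r = 1, so that t = L and Q ^ s has the full order L mod n.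
      idx≡⇒order≡L : idx d q ≡ idx n q → ∀ {k} → (Q ^ s) ^ k ≈ 1ℤ [ n ] → L ℕ.∣ k
      idx≡⇒order≡L eq {k} p = go ratio
        where
        ord∣s*k : ord n q ℕ.∣ s ℕ.* k
        ord∣s*k = ord∣ n c (≈-trans (≡⇒≈ (sym (^-*-assoc Q s k))) p)
        go : ∃[ r ] ∃[ t ] ord n q ≡ t ℕ.* s × L ≡ r ℕ.* t → L ℕ.∣ k
        go (zero , t , e , f) = contradiction f (ℕ.≢-nonZero⁻¹ L)
        go (suc (suc r) , t , e , f) = contradiction
          (trans eq (idx-n (2 ℕ.+ r) t e f)) (ℕ.<⇒≢ (idx-increases r))
        go (suc zero , t , e , f) = ℕ.*-cancelʳ-∣ s (subst₂ ℕ._∣_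
          (trans e (cong (ℕ._* s) (trans (sym (ℕ.+-identityʳ t)) (sym f)))) (ℕ.*-comm s k) ord∣s*k)

      idx≢⇒order∣L : ¬ idx d q ≡ idx n q →
        ∃[ r ] ∃[ t ] 2 ℕ.≤ r × L ≡ r ℕ.* t × (Q ^ s) ^ t ≈ 1ℤ [ n ]
      idx≢⇒order∣L neq = go ratio
        where
        go : ∃[ r ] ∃[ t ] ord n q ≡ t ℕ.* s × L ≡ r ℕ.* t →
          ∃[ r ] ∃[ t ] 2 ℕ.≤ r × L ≡ r ℕ.* t × (Q ^ s) ^ t ≈ 1ℤ [ n ]
        go (zero , t , e , f) = contradiction f (ℕ.≢-nonZero⁻¹ L)
        go (suc zero , t , e , f) = contradiction
          (sym (trans (idx-n 1 t e f) (/-congˡ {s} (ℕ.*-identityˡ (φ d))))) neq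
        go (suc (suc r) , t , e , f) = 2 ℕ.+ r , t , ℕ.s≤s (ℕ.s≤s ℕ.z≤n) , f ,
          ≈-trans (≡⇒≈ (trans (^-*-assoc Q s t) (cong (Q ^_) (trans (ℕ.*-comm s t) (sym e))))) (Q^ord≈1 n c)

  -- Lifting the exponent.

  geometric : ℤ → ℕ → ℤ
  geometric x N = ∑ N (x ^_)

  geometric-telescopes : ∀ x N → (x - 1ℤ) * geometric x N ≡ x ^ N - 1ℤ
  geometric-telescopes x zero    = *-zeroʳ (x - 1ℤ)
  geometric-telescopes x (suc N) = begin
    (x - 1ℤ) * (geometric x N + x ^ N)               ≡⟨ *-distribˡ-+ (x - 1ℤ) (geometric x N) (x ^ N) ⟩
    (x - 1ℤ) * geometric x N + (x - 1ℤ) * x ^ N      ≡⟨ cong (_+ (x - 1ℤ) * x ^ N) (geometric-telescopes x N) ⟩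
    x ^ N - 1ℤ + (x - 1ℤ) * x ^ N                    ≡⟨ lemma x (x ^ N) ⟩
    x * x ^ N - 1ℤ                                   ∎
    where
    open ≡-Reasoning
    lemma : ∀ x y → y - 1ℤ + (x - 1ℤ) * y ≡ x * y - 1ℤ
    lemma = solve-∀

  geometric≈ : ∀ {x n} N → x ≈ 1ℤ [ n ] → geometric x N ≈ + N [ n ]
  geometric≈ zero    p = ≈-refl
  geometric≈ {x} (suc N) p = ≈-trans
    (+-cong (geometric≈ N p) (≈-trans (^-cong N p) (≡⇒≈ (^-zeroˡ N))))
    (≡⇒≈ (+-comm (+ N) 1ℤ))

  -- x ^ p - 1 is the product of x - 1 and a sum of p terms, each congruent to 1 mod p.
  ^-lift : ∀ {x} p k → p ℕ.∣ k → x ≈ 1ℤ [ k ] → x ^ p ≈ 1ℤ [ p ℕ.* k ]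
  ^-lift {x} p k p∣k x≈1 = x-y≈0⇒x≈y (≈-trans (≡⇒≈ (sym (geometric-telescopes x p)))
    (∣⇒≈0 (subst₂ ℕ._∣_ (ℕ.*-comm k p) (sym (abs-* (x - 1ℤ) (geometric x p)))
      (ℕ.*-pres-∣ (≈⇒∣ x≈1) (≈0⇒∣ (≈-trans (geometric≈ p (≈-weaken p∣k x≈1)) n≈0))))))

  p∣p^suc : ∀ p b → p ℕ.∣ p ℕ.^ suc b
  p∣p^suc p b = ℕ.m∣m*n (p ℕ.^ b)

  ^-lift* : ∀ p b i {x} → x ≈ 1ℤ [ p ℕ.^ suc b ] → x ^ (p ℕ.^ i) ≈ 1ℤ [ p ℕ.^ (i ℕ.+ suc b) ]
  ^-lift* p b zero    {x} h = ≈-trans (≡⇒≈ (^-identityʳ x)) h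
  ^-lift* p b (suc i) {x} h = ≈-trans
    (≡⇒≈ (trans (cong (x ^_) (ℕ.*-comm p (p ℕ.^ i))) (sym (^-*-assoc x (p ℕ.^ i) p))))
    (^-lift p (p ℕ.^ (i ℕ.+ suc b)) (subst (λ e → p ℕ.∣ p ℕ.^ e) (sym (ℕ.+-suc i b)) (p∣p^suc p (i ℕ.+ b)))
      (^-lift* p b i h))

  prime-coprime : ∀ {p} → Prime p → ∀ {k} → ¬ p ℕ.∣ k → Coprime p k
  prime-coprime pr p∤k (e∣p , e∣k) =
    [ id , (λ e≡p → contradiction (subst (ℕ._∣ _) e≡p e∣k) p∤k) ]′ (prime⇒irreducible pr e∣p)

  coprime-* : ∀ {m n k} → Coprime m k → Coprime n k → Coprime (m ℕ.* n) k
  coprime-* {m} c d {e} (e∣mn , e∣k) = d (Coprimality.coprime-divisor e⊥m e∣mn , e∣k)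
    where
    e⊥m : Coprime e m
    e⊥m (f∣e , f∣m) = c (f∣m , ℕ.∣-trans f∣e e∣k)

  coprime-^ˡ : ∀ {m k} a → Coprime m k → Coprime (m ℕ.^ a) k
  coprime-^ˡ zero    c (e∣1 , _) = ℕ.∣1⇒≡1 e∣1
  coprime-^ˡ {m} (suc a) c = coprime-* {m} c (coprime-^ˡ a c)

  -- The converse of `^-lift`: close to 1, the geometric sum is divisible by p exactly once. "Close"
  -- is mod p for odd p (ℓ = 0) and mod 4 for p = 2 (ℓ = 1), as 1 + x is divisible by 4 when x is 3
  -- mod 4.
  module Descent {p : ℕ} (pr : Prime p) (ℓ : ℕ)
    (geometric≈p : ∀ x → x ≈ 1ℤ [ p ℕ.^ suc ℓ ] → geometric x p ≈ + p [ p ℕ.* p ]) where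

    private instance
      _ = prime⇒nonZero pr

    ^-descend : ∀ c {x} → x ≈ 1ℤ [ p ℕ.^ suc ℓ ] → x ^ p ≈ 1ℤ [ p ℕ.^ suc c ] → x ≈ 1ℤ [ p ℕ.^ c ]
    ^-descend c {x} h x^p≈1 = go (geometric≈p x h)
      where
      go : geometric x p ≈ + p [ p ℕ.* p ] → x ≈ 1ℤ [ p ℕ.^ c ]
      go (mk k e) = x-y≈0⇒x≈y (coprime-cancel w p^c⊥w (≈-trans w*[x-1]≈0 (≡⇒≈ (sym (*-zeroʳ w)))))
        where
        -- The geometric sum is p w with w prime to p, so that dividing by it costs a single factor
        -- p of the modulus.
        w = 1ℤ + k * + p
        geo≡p*w : geometric x p ≡ + p * w
        geo≡p*w = begin
          geometric x p                        ≡⟨ lemma₁ (geometric x p) (+ p) ⟩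
          (geometric x p - + p) + + p          ≡⟨ cong (_+ + p) e ⟩
          k * + (p ℕ.* p) + + p                ≡⟨ cong (λ z → k * z + + p) (pos-* p p) ⟩
          k * (+ p * + p) + + p                ≡⟨ lemma₂ k (+ p) ⟩
          + p * w                              ∎
          where
          open ≡-Reasoning
          lemma₁ : ∀ g p → g ≡ (g - p) + p
          lemma₁ = solve-∀
          lemma₂ : ∀ k p → k * (p * p) + p ≡ p * (1ℤ + k * p)
          lemma₂ = solve-∀
        w≈1 : w ≈ 1ℤ [ p ]
        w≈1 = mk k (lemma (k * + p))
          where
          lemma : ∀ y → (1ℤ + y) - 1ℤ ≡ y
          lemma = solve-∀
        p^c⊥w : Coprime (p ℕ.^ c) ∣ w ∣
        p^c⊥w = coprime-^ˡ c (prime-coprime pr λ p∣w →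
          ¬prime[1] (subst Prime (ℕ.∣1⇒≡1 (≈0⇒∣ (≈-trans (≈-sym w≈1) (∣⇒≈0 p∣w)))) pr))
        w*[x-1]≈0 : w * (x - 1ℤ) ≈ 0ℤ [ p ℕ.^ c ]
        w*[x-1]≈0 = *-unscale p (begin
          + p * (w * (x - 1ℤ))         ≡⟨ lemma (+ p) w (x - 1ℤ) ⟩
          (x - 1ℤ) * (+ p * w)         ≡⟨ cong ((x - 1ℤ) *_) geo≡p*w ⟨
          (x - 1ℤ) * geometric x p     ≡⟨ geometric-telescopes x p ⟩
          x ^ p - 1ℤ                   ≈⟨ x≈y⇒x-y≈0 x^p≈1 ⟩
          0ℤ                           ≡⟨ *-zeroʳ (+ p) ⟨
          + p * 0ℤ                     ∎)
          where
          open ≈-Reasoning (p ℕ.* p ℕ.^ c)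
          lemma : ∀ p w y → p * (w * y) ≡ y * (p * w)
          lemma = solve-∀

    ^-descend* : ∀ c i {x} → x ≈ 1ℤ [ p ℕ.^ suc ℓ ] →
      x ^ (p ℕ.^ i) ≈ 1ℤ [ p ℕ.^ (i ℕ.+ c) ] → x ≈ 1ℤ [ p ℕ.^ c ]
    ^-descend* c zero    {x} h g = ≈-trans (≡⇒≈ (sym (^-identityʳ x))) g
    ^-descend* c (suc i) {x} h g = ^-descend* c i h (^-descend (i ℕ.+ c) (≈1-^ (p ℕ.^ i) h)
      (≈-trans (≡⇒≈ (trans (^-*-assoc x (p ℕ.^ i) p) (cong (x ^_) (ℕ.*-comm (p ℕ.^ i) p)))) g))

    -- Induction on b, gaining one factor p at a time. If h is 1 mod p ^ b, its power with exponent
    -- p ^ (a - b) is 1 mod p ^ a; `boost` then raises the modulus by ℓ + 1 factors at the price of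
    -- p ^ ℓ in the exponent; descending along all these p-th powers ends at p ^ (b + 1).
    lift-to-top : ∀ a {h} → h ≈ 1ℤ [ p ℕ.^ suc ℓ ] →
      (∀ k → h ^ k ≈ 1ℤ [ p ℕ.^ a ] → h ^ (k ℕ.* p ℕ.^ ℓ) ≈ 1ℤ [ p ℕ.^ (suc ℓ ℕ.+ a) ]) →
      ∀ b → b ℕ.≤ suc a → h ≈ 1ℤ [ p ℕ.^ b ]
    lift-to-top a h≈1 boost zero    _    = ∣⇒≈ (ℕ.1∣ _)
    lift-to-top a {h} h≈1 boost (suc b) b<1+a with suc b ℕ.≤? suc ℓ
    ... | yes b<1+ℓ = let k , eq = ℕ.m≤n⇒∃[o]m+o≡n b<1+ℓ in
      ≈-weaken (ℕ.divides (p ℕ.^ k)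
        (trans (cong (p ℕ.^_) (trans (sym eq) (ℕ.+-comm (suc b) k))) (ℕ.^-distribˡ-+-* p k (suc b)))) h≈1
    ... | no b≮1+ℓ = extend b (ℕ.≤-trans (ℕ.s≤s ℕ.z≤n) (ℕ.s≤s⁻¹ (ℕ.≰⇒> b≮1+ℓ)))
                         (ℕ.s≤s⁻¹ b<1+a) (lift-to-top a h≈1 boost b (ℕ.≤-trans (ℕ.n≤1+n b) b<1+a))
      where
      extend : ∀ b → 1 ℕ.≤ b → b ℕ.≤ a → h ≈ 1ℤ [ p ℕ.^ b ] → h ≈ 1ℤ [ p ℕ.^ suc b ]
      extend (suc b) _ b<a h≈1′ = ^-descend* (2 ℕ.+ b) (i ℕ.+ ℓ) h≈1
        (subst₂ (λ j e → h ^ j ≈ 1ℤ [ p ℕ.^ e ]) (sym (ℕ.^-distribˡ-+-* p i ℓ)) exponent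
          (boost (p ℕ.^ i) (subst (λ e → h ^ (p ℕ.^ i) ≈ 1ℤ [ p ℕ.^ e ]) i+1+b≡a (^-lift* p b i h≈1′))))
        where
        i = a ℕ.∸ suc b
        i+1+b≡a : i ℕ.+ suc b ≡ a
        i+1+b≡a = ℕ.m∸n+n≡m b<a
        exponent : suc ℓ ℕ.+ a ≡ (i ℕ.+ ℓ) ℕ.+ (2 ℕ.+ b)
        exponent = begin
          suc ℓ ℕ.+ a                        ≡⟨ cong (suc ℓ ℕ.+_) i+1+b≡a ⟨
          suc (ℓ ℕ.+ (i ℕ.+ suc b))          ≡⟨ cong suc (trans (sym (ℕ.+-assoc ℓ i (suc b))) (cong (ℕ._+ suc b) (ℕ.+-comm ℓ i))) ⟩
          suc (i ℕ.+ ℓ ℕ.+ suc b)            ≡⟨ ℕ.+-suc (i ℕ.+ ℓ) (suc b) ⟨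
          i ℕ.+ ℓ ℕ.+ (2 ℕ.+ b)              ∎
          where open ≡-Reasoning

  -- For x = 1 + p k, the power x ^ i is 1 + p k i mod p², so the sum is p + p k T with T = p (p -
  -- 1) / 2, and p divides T because p is odd.
  geometric≈p-odd : ∀ {p} → Prime p → ¬ 2 ℕ.∣ p → ∀ x → x ≈ 1ℤ [ p ℕ.^ 1 ] → geometric x p ≈ + p [ p ℕ.* p ]
  geometric≈p-odd {p} pr p-odd x (mk k e) = begin
    geometric x p                        ≈⟨ expand p ⟩
    + p + + p * k * T p                  ≈⟨ +-cong (≈-refl {x = + p}) p*k*T≈0 ⟩
    + p + 0ℤ                             ≡⟨ +-identityʳ (+ p) ⟩
    + p                                  ∎
    where
    open ≈-Reasoning (p ℕ.* p)
    T : ℕ → ℤ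
    T N = ∑ N (λ i → + i)
    p² : ∀ z → + p * (+ p * z) ≈ 0ℤ [ p ℕ.* p ]
    p² z = mk z (trans (lemma (+ p) z) (cong (z *_) (sym (pos-* p p))))
      where
      lemma : ∀ p z → p * (p * z) - 0ℤ ≡ z * (p * p)
      lemma = solve-∀
    x≡ : x ≡ 1ℤ + + p * k
    x≡ = trans (lemma x) (cong (λ z → 1ℤ + z) (trans e (trans (cong (k *_) (cong +_ (ℕ.*-identityʳ p))) (*-comm k (+ p)))))
      where
      lemma : ∀ x → x ≡ 1ℤ + (x - 1ℤ)
      lemma = solve-∀
    power : ∀ i → x ^ i ≈ 1ℤ + + p * k * + i [ p ℕ.* p ]
    power zero    = ≡⇒≈ (sym (cong (λ z → 1ℤ + z) (*-zeroʳ (+ p * k))))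
    power (suc i) = begin
      x * x ^ i                                            ≈⟨ *-congˡ x (power i) ⟩
      x * (1ℤ + + p * k * + i)                             ≡⟨ cong (_* (1ℤ + + p * k * + i)) x≡ ⟩
      (1ℤ + + p * k) * (1ℤ + + p * k * + i)                ≡⟨ lemma (+ p) k (+ i) ⟩
      (1ℤ + + p * k * (1ℤ + + i)) + + p * (+ p * (k * k * + i)) ≈⟨ +-cong (≈-refl {x = 1ℤ + + p * k * (1ℤ + + i)}) (p² (k * k * + i)) ⟩
      (1ℤ + + p * k * (1ℤ + + i)) + 0ℤ                     ≡⟨ +-identityʳ _ ⟩
      1ℤ + + p * k * + suc i                               ∎
      where
      lemma : ∀ p k i → (1ℤ + p * k) * (1ℤ + p * k * i) ≡ (1ℤ + p * k * (1ℤ + i)) + p * (p * (k * k * i))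
      lemma = solve-∀
    expand : ∀ N → geometric x N ≈ + N + + p * k * T N [ p ℕ.* p ]
    expand zero    = ≡⇒≈ (sym (trans (+-identityˡ (+ p * k * 0ℤ)) (*-zeroʳ (+ p * k))))
    expand (suc N) = ≈-trans (+-cong (expand N) (power N)) (≡⇒≈ (lemma (+ N) (+ p * k) (T N)))
      where
      lemma : ∀ N c t → (N + c * t) + (1ℤ + c * N) ≡ (1ℤ + N) + c * (t + N)
      lemma = solve-∀
    2T : ∀ N → + 2 * T N ≡ + N * (+ N - 1ℤ)
    2T zero    = refl
    2T (suc N) = trans (*-distribˡ-+ (+ 2) (T N) (+ N)) (trans (cong (_+ + 2 * + N) (2T N)) (lemma (+ N)))
      where
      lemma : ∀ N → N * (N - 1ℤ) + + 2 * N ≡ (1ℤ + N) * ((1ℤ + N) - 1ℤ)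
      lemma = solve-∀
    T≈0 : T p ≈ 0ℤ [ p ]
    T≈0 = coprime-cancel (+ 2) (prime-coprime pr p∤2) (≈-trans (≡⇒≈ (2T p))
      (≈-trans (*-congʳ (+ p - 1ℤ) n≈0) (≡⇒≈ refl)))
      where
      p∤2 : ¬ p ℕ.∣ 2
      p∤2 p∣2 with prime⇒irreducible prime[2] p∣2
      ... | inj₁ refl = ¬prime[1] pr
      ... | inj₂ refl = p-odd ℕ.∣-refl
    p*k*T≈0 : + p * k * T p ≈ 0ℤ [ p ℕ.* p ]
    p*k*T≈0 = ≈-trans (≡⇒≈ (lemma (+ p) k (T p))) (≈-trans (*-scale p (*-congˡ k T≈0))
      (≡⇒≈ (trans (cong (+ p *_) (*-zeroʳ k)) (*-zeroʳ (+ p)))))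
      where
      lemma : ∀ p k t → p * k * t ≡ p * (k * t)
      lemma = solve-∀

  geometric≈p-even : ∀ x → x ≈ 1ℤ [ 2 ℕ.^ 2 ] → geometric x 2 ≈ + 2 [ 2 ℕ.* 2 ]
  geometric≈p-even x h = geometric≈ 2 h

  -- Fermat's little theorem.

  ∑-head : ∀ N f → ∑ (suc N) f ≡ f 0 + ∑ N (f ∘ suc)
  ∑-head zero    f = +-comm 0ℤ (f 0)
  ∑-head (suc N) f = trans (cong (_+ f (suc N)) (∑-head N f)) (+-assoc (f 0) (∑ N (f ∘ suc)) (f (suc N)))

  prime∣C : ∀ {p k} → Prime p → 1 ℕ.≤ k → k ℕ.< p → p ℕ.∣ p C k
  prime∣C {p@(suc p-1)} {k} pr 1≤k k<p = [ id , (λ h → contradiction h p∤denominator) ]′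
    (euclidsLemma (p C k) D pr (subst (p ℕ.∣_) (sym eq) (ℕ.m∣m*n (p-1 ℕ.!))))
    where
    D = k ℕ.! ℕ.* (p ℕ.∸ k) ℕ.!
    instance
      _ : NonZero D
      _ = ℕ.m*n≢0 (k ℕ.!) ((p ℕ.∸ k) ℕ.!) {{k ℕ.!≢0}} {{(p ℕ.∸ k) ℕ.!≢0}}
    eq : (p C k) ℕ.* D ≡ p ℕ.!
    eq = trans (cong (ℕ._* D) (nCk≡n!/k![n-k]! (ℕ.<⇒≤ k<p))) (m/n*n≡m (k![n∸k]!∣n! (ℕ.<⇒≤ k<p)))
    p∤denominator : ¬ p ℕ.∣ D
    p∤denominator h with euclidsLemma (k ℕ.!) ((p ℕ.∸ k) ℕ.!) pr h
    ... | inj₁ h₁ = prime∤! pr k<p h₁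
    ... | inj₂ h₂ = prime∤! pr (ℕ.∸-monoʳ-< {p} {k} {0} 1≤k (ℕ.<⇒≤ k<p)) h₂

  fermat : ∀ {p} → Prime p → ∀ x → (+ x) ^ p ≈ + x [ p ]
  fermat {zero}      pr x = contradiction pr ¬prime[0]
  fermat {p@(suc p-1)} pr zero = ≡⇒≈ refl
  fermat {p@(suc p-1)} pr (suc x) = begin
    (1ℤ + + x) ^ p                            ≡⟨ binomial-theorem p 1ℤ (+ x) ⟩
    ∑ p term + term p                         ≡⟨ cong (_+ term p) (∑-head p-1 term) ⟩
    (term 0 + ∑ p-1 (term ∘ suc)) + term p    ≈⟨ +-cong (+-cong bottom middle) top ⟩
    (+ x + 0ℤ) + 1ℤ                           ≡⟨ lemma (+ x) ⟩
    1ℤ + + x                                  ∎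
    where
    open ≈-Reasoning p
    lemma : ∀ x → (x + 0ℤ) + 1ℤ ≡ 1ℤ + x
    lemma = solve-∀
    term : ℕ → ℤ
    term k = + (p C k) * (1ℤ ^ k * (+ x) ^ (p ℕ.∸ k))
    bottom : term 0 ≈ + x [ p ]
    bottom = begin
      + (p C 0) * (1ℤ * (+ x) ^ p)   ≡⟨ cong (λ c → + c * (1ℤ * (+ x) ^ p)) (nC0≡1 p) ⟩
      1ℤ * (1ℤ * (+ x) ^ p)          ≡⟨ trans (*-identityˡ (1ℤ * (+ x) ^ p)) (*-identityˡ ((+ x) ^ p)) ⟩
      (+ x) ^ p                      ≈⟨ fermat pr x ⟩
      + x                            ∎
    top : term p ≈ 1ℤ [ p ]
    top = ≡⇒≈ (trans (cong₂ (λ c e → + c * (1ℤ ^ p * (+ x) ^ e)) (nCn≡1 p) (ℕ.n∸n≡0 p))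
      (trans (*-identityˡ (1ℤ ^ p * 1ℤ)) (trans (*-identityʳ (1ℤ ^ p)) (^-zeroˡ p))))
    middle : ∑ p-1 (term ∘ suc) ≈ 0ℤ [ p ]
    middle = ∑-≈0 p-1 λ k k<p-1 →
      *-congʳ {x = + (p C suc k)} {y = 0ℤ} (1ℤ ^ suc k * (+ x) ^ (p ℕ.∸ suc k))
        (∣⇒≈0 (prime∣C pr (ℕ.s≤s ℕ.z≤n) (ℕ.s≤s k<p-1)))

  -- Maps whose difference quotients lie in a group of units.

  *-^ : ∀ x y k → (x * y) ^ k ≡ x ^ k * y ^ k
  *-^ x y zero    = refl
  *-^ x y (suc k) = trans (cong (x * y *_) (*-^ x y k)) (lemma x y (x ^ k) (y ^ k))
    where
    lemma : ∀ x y a b → x * y * (a * b) ≡ x * a * (y * b)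
    lemma = solve-∀

  -- H is a set of integers closed under literal products, with inverses only mod N; sets of powers
  -- of q have this form.
  record UnitGroup (N : ℕ) (H : ℤ → Set) : Set where
    field
      mul : ∀ {u v} → H u → H v → H (u * v)
      inv : ∀ {u} → H u → ∃[ w ] H w × w * u ≈ 1ℤ [ N ]

    nonzero : ∀ {p} → Prime p → p ℕ.∣ N → ∀ {u} → H u → ¬ u ≈ 0ℤ [ p ]
    nonzero {p} pr p∣N {u} Hu u≈0 = let w , _ , w*u≈1 = inv Hu in
      ¬prime[1] (subst Prime (ℕ.∣1⇒≡1 (≈0⇒∣ (≈-trans (≈-sym (≈-weaken p∣N w*u≈1))
        (≈-trans (*-congˡ w u≈0) (≡⇒≈ (*-zeroʳ w)))))) pr)

  module LocallyAffine {N : ℕ} {H : ℤ → Set} (group : UnitGroup N H) (s : ℤ → ℤ)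
    (quotient∈H : ∀ x y → ∃[ h ] H h × s x - s y ≈ (x - y) * h [ N ]) where

    open UnitGroup group

    ConstantSlope : Set
    ConstantSlope = ∀ x → s (+ 2 + x) - s (1ℤ + x) ≈ s (1ℤ + x) - s x [ N ]

    private
      diff : ∀ x y k → x - y ≡ k → ∃[ h ] H h × s x - s y ≈ k * h [ N ]
      diff x y k refl = quotient∈H x y

      slope : ∀ x → ∃[ h ] H h × s (1ℤ + x) - s x ≈ h [ N ]
      slope x = let h , Hh , e = diff (1ℤ + x) x 1ℤ (lemma x) in
        h , Hh , ≈-trans e (≡⇒≈ (*-identityˡ h))
        where
        lemma : ∀ x → (1ℤ + x) - x ≡ 1ℤ
        lemma = solve-∀

      slope′ : ∀ x → ∃[ h ] H h × s (+ 2 + x) - s (1ℤ + x) ≈ h [ N ]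
      slope′ x = let h , Hh , e = diff (+ 2 + x) (1ℤ + x) 1ℤ (lemma x) in
        h , Hh , ≈-trans e (≡⇒≈ (*-identityˡ h))
        where
        lemma : ∀ x → (+ 2 + x) - (1ℤ + x) ≡ 1ℤ
        lemma = solve-∀

    constantSlope-if-1+u≈2v⇒u≈1 :
      (∀ {u v} → H u → H v → 1ℤ + u ≈ + 2 * v [ N ] → u ≈ 1ℤ [ N ]) → ConstantSlope
    constantSlope-if-1+u≈2v⇒u≈1 star x =
      let u , Hu , eu = slope x
          v , Hv , ev = slope′ x
          w , Hw , ew = diff (+ 2 + x) x (+ 2) (lemma₀ x)
          i , Hi , ei = inv Hu
          u+v≈2w : u + v ≈ + 2 * w [ N ]
          u+v≈2w = ≈-trans (≈-sym (+-cong eu ev)) (≈-trans (≡⇒≈ (lemma₁ (s x) (s (1ℤ + x)) (s (+ 2 + x)))) ew)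
          -- Dividing u + v = 2w by u brings it to the form treated by `star`, with i v in the place
          -- of u.
          1+iv≈2iw : 1ℤ + i * v ≈ + 2 * (i * w) [ N ]
          1+iv≈2iw = lin₂ -1ℤ i ei u+v≈2w (lemma₂ i u v w)
          iv≈1 = star (mul Hi Hv) (mul Hi Hw) 1+iv≈2iw
          v≈u : v ≈ u [ N ]
          v≈u = lin₂ (- v) u ei iv≈1 (lemma₃ i u v)
      in ≈-trans ev (≈-trans v≈u (≈-sym eu))
      where
      lemma₀ : ∀ x → (+ 2 + x) - x ≡ + 2
      lemma₀ = solve-∀
      lemma₁ : ∀ a b c → (b - a) + (c - b) ≡ c - a
      lemma₁ = solve-∀
      lemma₂ : ∀ i u v w → (1ℤ + i * v) - + 2 * (i * w) ≡ -1ℤ * (i * u - 1ℤ) + i * ((u + v) - + 2 * w)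
      lemma₂ = solve-∀
      lemma₃ : ∀ i u v → v - u ≡ - v * (i * u - 1ℤ) + u * (i * v - 1ℤ)
      lemma₃ = solve-∀

    -- Comparing the slopes at x and x + 1 through the extra point x + 1 + p.
    constantSlope-if-H∩[1+p]-trivial : ∀ p .{{_ : NonZero p}} M → N ≡ p ℕ.* (p ℕ.* M) →
      (∀ {u} → H u → u ≈ 1ℤ [ p ] → u ≈ 1ℤ [ N ]) → ConstantSlope
    constantSlope-if-H∩[1+p]-trivial p M N≡ trivial x =
      let u , Hu , eu = slope x
          v , Hv , ev = slope′ x
          a , Ha , ea = diff (1ℤ + x + + p) x (1ℤ + + p) (lemma₀ x (+ p))
          b , Hb , eb = diff (+ 2 + x) (1ℤ + x + + p) (1ℤ - + p) (lemma₁ x (+ p))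
          near = congruent (1ℤ + x + + p) (1ℤ + x) (mk 1ℤ (lemma₂ x (+ p)))
          a≈u : a ≈ u [ N ]
          a≈u = separate Ha Hu (begin
            a                                  ≡⟨ *-identityˡ a ⟨
            1ℤ * a                             ≡⟨ cong (_* a) (+-identityʳ 1ℤ) ⟨
            (1ℤ + 0ℤ) * a                      ≈⟨ *-congʳ a (+-cong (≈-refl {x = 1ℤ}) (n≈0 {p})) ⟨
            (1ℤ + + p) * a                     ≈⟨ ≈-weaken p∣N ea ⟨
            s (1ℤ + x + + p) - s x             ≈⟨ -‿cong near (≈-refl {x = s x}) ⟩
            s (1ℤ + x) - s x                   ≈⟨ ≈-weaken p∣N eu ⟩
            u                                  ∎)
          b≈v : b ≈ v [ N ]
          b≈v = separate Hb Hv (begin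
            b                                  ≡⟨ *-identityˡ b ⟨
            1ℤ * b                             ≡⟨ cong (_* b) (+-identityʳ 1ℤ) ⟨
            (1ℤ - 0ℤ) * b                      ≈⟨ *-congʳ b (-‿cong (≈-refl {x = 1ℤ}) (n≈0 {p})) ⟨
            (1ℤ - + p) * b                     ≈⟨ ≈-weaken p∣N eb ⟨
            s (+ 2 + x) - s (1ℤ + x + + p)     ≈⟨ -‿cong (≈-refl {x = s (+ 2 + x)}) near ⟩
            s (+ 2 + x) - s (1ℤ + x)           ≈⟨ ≈-weaken p∣N ev ⟩
            v                                  ∎)
          sum : (1ℤ + + p) * u + (1ℤ - + p) * v ≈ u + v [ N ]
          sum = ≈-trans (+-cong (*-congˡ (1ℤ + + p) (≈-sym a≈u)) (*-congˡ (1ℤ - + p) (≈-sym b≈v)))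
            (≈-trans (≈-sym (+-cong ea eb))
            (≈-trans (≡⇒≈ (lemma₃ (s (1ℤ + x + + p)) (s x) (s (+ 2 + x)) (s (1ℤ + x)))) (+-cong eu ev)))
          -- Dividing by p leaves u = v mod p M. The second factor p of N makes this a congruence
          -- mod p, which `separate` extends to N.
          pu≈pv : + p * u ≈ + p * v [ p ℕ.* (p ℕ.* M) ]
          pu≈pv = subst (+ p * u ≈ + p * v [_]) N≡ (lin₁ 1ℤ sum (lemma₄ (+ p) u v))
          u≈v = separate Hu Hv (≈-weaken (ℕ.m∣m*n M) (*-unscale p pu≈pv))
      in ≈-trans ev (≈-trans (≈-sym u≈v) (≈-sym eu))
      where
      open ≈-Reasoning p
      p∣N : p ℕ.∣ N
      p∣N = subst (p ℕ.∣_) (sym N≡) (ℕ.m∣m*n (p ℕ.* M))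
      lemma₀ : ∀ x p → (1ℤ + x + p) - x ≡ 1ℤ + p
      lemma₀ = solve-∀
      lemma₁ : ∀ x p → (+ 2 + x) - (1ℤ + x + p) ≡ 1ℤ - p
      lemma₁ = solve-∀
      lemma₂ : ∀ x p → (1ℤ + x + p) - (1ℤ + x) ≡ 1ℤ * p
      lemma₂ = solve-∀
      lemma₃ : ∀ a b c d → (a - b) + (c - a) ≡ (d - b) + (c - d)
      lemma₃ = solve-∀
      lemma₄ : ∀ p u v → p * u - p * v ≡ 1ℤ * ((1ℤ + p) * u + (1ℤ - p) * v - (u + v))
      lemma₄ = solve-∀
      congruent : ∀ x y → x ≈ y [ p ] → s x ≈ s y [ p ]
      congruent x y x≈y = let h , _ , e = quotient∈H x y in
        x-y≈0⇒x≈y (≈-trans (≈-weaken p∣N e) (*-congʳ h (x≈y⇒x-y≈0 x≈y)))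
      separate : ∀ {u v} → H u → H v → u ≈ v [ p ] → u ≈ v [ N ]
      separate {u} {v} Hu Hv u≈v =
        let i , Hi , ei = inv Hv
            iu≈1 = trivial (mul Hi Hu) (≈-trans (*-congˡ i u≈v) (≈-weaken p∣N ei))
        in lin₂ (- u) v ei iu≈1 (lemma i u v)
        where
        lemma : ∀ i u v → u - v ≡ - u * (i * v - 1ℤ) + v * (i * u - 1ℤ)
        lemma = solve-∀

    constantSlope-if-small-exponent : ∀ t → Prime N → 1 ℕ.≤ t → t ℕ.+ t ℕ.< N →
      (∀ {h} → H h → h ^ t ≈ 1ℤ [ N ]) → (∀ z → ∃[ y ] s (+ y) ≈ z [ N ]) →
      ∀ x → s (+ (2 ℕ.+ x)) - s (+ (1 ℕ.+ x)) ≈ s (+ (1 ℕ.+ x)) - s (+ x) [ N ]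
    constantSlope-if-small-exponent t pr 1≤t t+t<N exponent surjective x = x-y≈0⇒x≈y
      (PrimeDifferences.same-power⇒affine pr t t+t<N (s ∘ +_) same-power surjective 1≤t x)
      where
      same-power : ∀ x y → (s (+ x) - s (+ y)) ^ t ≈ (+ x - + y) ^ t [ N ]
      same-power x y = let h , Hh , e = quotient∈H (+ x) (+ y) in
        ≈-trans (^-cong t e) (≈-trans (≡⇒≈ (*-^ (+ x - + y) h t))
          (≈-trans (*-congˡ ((+ x - + y) ^ t) (exponent Hh)) (≡⇒≈ (*-identityʳ ((+ x - + y) ^ t)))))

  residue-cases : ∀ x N .{{_ : NonZero N}} → ∃[ r ] r ℕ.< N × x ≈ + r [ N ]
  residue-cases x N = x %ℕ N , n%ℕd<d x N , ≈-sym (%ℕ-≈ x N)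

  odd⇒≈1 : ∀ {x} → ¬ x ≈ 0ℤ [ 2 ] → x ≈ 1ℤ [ 2 ]
  odd⇒≈1 {x} x≉0 with residue-cases x 2
  ... | 0 , _ , e = contradiction e x≉0
  ... | 1 , _ , e = e
  ... | suc (suc r) , ℕ.s≤s (ℕ.s≤s ()) , _

  -- Doubling v = 1 gains a factor 2 in the modulus.
  1+u≈2v⇒u≈1 : ∀ {M u v} → v ≈ 1ℤ [ M ] → 1ℤ + u ≈ + 2 * v [ 2 ℕ.* M ] → u ≈ 1ℤ [ 2 ℕ.* M ]
  1+u≈2v⇒u≈1 {M} {u} {v} v≈1 h = lin₂ 1ℤ 1ℤ h (*-scale 2 v≈1) (lemma u v)
    where
    lemma : ∀ u v → u - 1ℤ ≡ 1ℤ * ((1ℤ + u) - + 2 * v) + 1ℤ * (+ 2 * v - + 2 * 1ℤ)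
    lemma = solve-∀

  prime-pred-nonZero : ∀ {p} → Prime p → NonZero (ℕ.pred p)
  prime-pred-nonZero {zero}        pr = contradiction pr ¬prime[0]
  prime-pred-nonZero {suc zero}    pr = contradiction pr ¬prime[1]
  prime-pred-nonZero {suc (suc p)} pr = _

  -- Kernels of reduction and the part of ⟨q⟩ inside them.

  module Multipliers (q : ℕ) where

    open Order q public

    module _ (n : ℕ) .{{_ : NonZero n}} (c : Coprime n q) where

      -- The hypotheses shared by the three exceptional cases: L is the order of
      -- the kernel of reduction from units mod n to units mod d.
      record Kernel (d L : ℕ) : Set where
        field
          {{d≢0}} : NonZero d
          {{L≢0}} : NonZero L
          d∣n     : d ℕ.∣ n
          φn≡Lφd  : φ n ≡ L ℕ.* φ d
          order   : ∀ i → Q ^ i ≈ 1ℤ [ d ] → (Q ^ i) ^ L ≈ 1ℤ [ n ]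

        d⊥q : Coprime d q
        d⊥q (e∣d , e∣q) = c (ℕ.∣-trans e∣d d∣n , e∣q)

        private
          kernel-order : Q ^ (L ℕ.* ord d q) ≈ 1ℤ [ n ]
          kernel-order = ≈-trans
            (≡⇒≈ (trans (cong (Q ^_) (ℕ.*-comm L (ord d q))) (sym (^-*-assoc Q (ord d q) L))))
            (order (ord d q) (Q^ord≈1 d d⊥q))

        -- G generates the part of ⟨q⟩ that is trivial mod d. Equality of integers can be asked for,
        -- because the exponents i concerned are the multiples of `ord d q`.
        Generator : ℤ → Set
        Generator G = ∀ i → Q ^ i ≈ 1ℤ [ d ] → ∃[ k ] Q ^ i ≡ G ^ k

        generator : Generator (Q ^ ord d q)
        generator i h = k , (begin
          Q ^ i              ≡⟨ cong (Q ^_) (trans (ℕ._∣_.equality s∣i) (ℕ.*-comm k s)) ⟩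
          Q ^ (s ℕ.* k)      ≡⟨ ^-*-assoc Q s k ⟨
          (Q ^ s) ^ k        ∎)
          where
          open ≡-Reasoning
          s = ord d q
          s∣i : s ℕ.∣ i
          s∣i = ord∣ d d⊥q {i} h
          k = ℕ.quotient s∣i

        -- The power found has as many distinct powers mod n as the kernel has elements: this is how
        -- an exception is used to build automorphisms.
        idx≡⇒full : idx d q ≡ idx n q →
          ∃[ i ] Q ^ i ≈ 1ℤ [ d ] × (∀ k → (Q ^ i) ^ k ≈ 1ℤ [ n ] → L ℕ.∣ k)
        idx≡⇒full eq = ord d q , Q^ord≈1 d d⊥q , λ k → idx≡⇒order≡L d n L c d∣n φn≡Lφd kernel-order eq {k}

        -- The form in which the absence of an exception is used: the relevant part of ⟨q⟩ is killed
        -- by t = L / r, at most half of L.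
        idx≢⇒small : ¬ idx d q ≡ idx n q →
          ∃[ G ] Generator G × ∃[ r ] ∃[ t ] 2 ℕ.≤ r × L ≡ r ℕ.* t × G ^ t ≈ 1ℤ [ n ]
        idx≢⇒small neq = Q ^ ord d q , generator ,
          idx≢⇒order∣L d n L c d∣n φn≡Lφd kernel-order neq

      private
        factor-nonZero : ∀ k d → n ≡ k ℕ.* d → NonZero d
        factor-nonZero k d e = ℕ.≢-nonZero λ d≡0 →
          ℕ.≢-nonZero⁻¹ n (trans e (trans (cong (k ℕ.*_) d≡0) (ℕ.*-zeroʳ k)))

      kernel-∥ : ∀ {p} → Prime p → ∀ d → n ≡ p ℕ.* d → ¬ p ℕ.∣ d → Kernel d (ℕ.pred p)
      kernel-∥ {zero} pr = contradiction pr ¬prime[0]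
      kernel-∥ {p@(suc p-1)} pr d refl p∤d = record
        { d≢0 = factor-nonZero p d refl
        ; L≢0 = prime-pred-nonZero pr
        ; d∣n = ℕ.n∣m*n p
        ; φn≡Lφd = ℕ.+-cancelʳ-≡ (φ d) _ _ (trans (φ-*-prime pr d p∤d) (ℕ.+-comm (φ d) (p-1 ℕ.* φ d)))
        -- Mod p this is Fermat's theorem, mod d a power of 1.
        ; order = λ i h → ≈-crt (prime-coprime pr p∤d)
            (≈-trans (≡⇒≈ (trans (^-*-assoc Q i p-1) (trans (cong (Q ^_) (ℕ.*-comm i p-1)) (sym (^-*-assoc Q p-1 i)))))
              (≈1-^ i Q^[p-1]≈1))
            (≈1-^ p-1 h)
        }
        where
        Q^[p-1]≈1 : Q ^ p-1 ≈ 1ℤ [ p ]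
        Q^[p-1]≈1 = coprime-cancel Q (λ (e∣p , e∣q) → c (ℕ.∣-trans e∣p (ℕ.m∣m*n d) , e∣q))
          (≈-trans (fermat pr q) (≡⇒≈ (sym (*-identityʳ Q))))

      kernel-p² : ∀ {p} → Prime p → ∀ d → n ≡ p ℕ.* d → p ℕ.∣ d → Kernel d p
      kernel-p² {p} pr d refl p∣d = record
        { d≢0 = factor-nonZero p d refl
        ; L≢0 = prime⇒nonZero pr
        ; d∣n = ℕ.n∣m*n p
        ; φn≡Lφd = φ-*-∣ p d p∣d
        ; order = λ i h → ^-lift p d p∣d h
        }

      -- Each squaring lifts a congruence to 1 by a factor 2, from d over `2 * d` to n; the first of
      -- them uses that d is even.
      kernel-4 : ∀ d → n ≡ 2 ℕ.* (2 ℕ.* d) → 2 ℕ.∣ d → Kernel d 4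
      kernel-4 d refl 2∣d = record
        { d≢0 = factor-nonZero 4 d (sym (ℕ.*-assoc 2 2 d))
        ; d∣n = ℕ.∣n⇒∣m*n 2 (ℕ.n∣m*n 2)
        ; φn≡Lφd = trans (φ-*-∣ 2 (2 ℕ.* d) (ℕ.m∣m*n d)) (trans (cong (2 ℕ.*_) (φ-*-∣ 2 d 2∣d)) (sym (ℕ.*-assoc 2 2 (φ d))))
        ; order = λ i h → ≈-trans (≡⇒≈ (sym (^-*-assoc (Q ^ i) 2 2)))
            (^-lift 2 (2 ℕ.* d) (ℕ.m∣m*n d) (^-lift 2 d 2∣d h))
        }

  -- Constancy of the slopes modulo each prime power.

  module ConstantSlopes (q n : ℕ) .{{_ : NonZero n}} (c : Coprime n q) (s : ℤ → ℤ)
    (quotient∈⟨q⟩ : ∀ x y → ∃[ j ] s x - s y ≈ (x - y) * (+ q) ^ j [ n ])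
    (surjective : ∀ z → ∃[ y ] s (+ y) ≈ z [ n ]) where

    open Multipliers q

    Slopes : ℕ → Set
    Slopes N = ∀ x → s (+ (2 ℕ.+ x)) - s (+ (1 ℕ.+ x)) ≈ s (+ (1 ℕ.+ x)) - s (+ x) [ N ]

    s-cong : ∀ {d x y} → d ℕ.∣ n → x ≈ y [ d ] → s x ≈ s y [ d ]
    s-cong {d} {x} {y} d∣n x≈y = let j , e = quotient∈⟨q⟩ x y in
      x-y≈0⇒x≈y (≈-trans (≈-weaken d∣n e) (*-congʳ (Q ^ j) (x≈y⇒x-y≈0 x≈y)))

    -- Varying only the residue mod N and dividing by s 1 - s 0 confines the
    -- multipliers to those congruent to 1 mod m.
    module Component (N m : ℕ) (n≡N*m : n ≡ N ℕ.* m) (N⊥m : Coprime N m) where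

      H : ℤ → Set
      H h = ∃[ j ] Q ^ j ≈ 1ℤ [ m ] × h ≡ Q ^ j

      N∣n : N ℕ.∣ n
      N∣n = subst (N ℕ.∣_) (sym n≡N*m) (ℕ.m∣m*n m)

      m∣n : m ℕ.∣ n
      m∣n = subst (m ℕ.∣_) (sym n≡N*m) (ℕ.n∣m*n N)

      group : UnitGroup N H
      group = record { mul = mul ; inv = inv }
        where
        mul : ∀ {u v} → H u → H v → H (u * v)
        mul (i , hi , refl) (j , hj , refl) = i ℕ.+ j
          , ≈-trans (≡⇒≈ (^-distribˡ-+-* Q i j)) (*-cong {x′ = 1ℤ} {y′ = 1ℤ} hi hj) , sym (^-distribˡ-+-* Q i j)
        inv : ∀ {u} → H u → ∃[ w ] H w × w * u ≈ 1ℤ [ N ]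
        inv {u} (i , hi , refl) = let j , e = Q^-inverse n c i in
          Q ^ j , (j , lemma (Q ^ i) (Q ^ j) hi (≈-weaken m∣n e) , refl) , ≈-weaken N∣n e
          where
          lemma : ∀ u w → u ≈ 1ℤ [ m ] → w * u ≈ 1ℤ [ m ] → w ≈ 1ℤ [ m ]
          lemma u w u≈1 wu≈1 = lin₂ (- w) 1ℤ u≈1 wu≈1 (lemma′ u w)
            where
            lemma′ : ∀ u w → w - 1ℤ ≡ - w * (u - 1ℤ) + 1ℤ * (w * u - 1ℤ)
            lemma′ = solve-∀

      private
        slope₀ : ∃[ i ] s 1ℤ - s 0ℤ ≈ Q ^ i [ n ]
        slope₀ = let i , e = quotient∈⟨q⟩ 1ℤ 0ℤ in i , ≈-trans e (≡⇒≈ (*-identityˡ (Q ^ i)))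

        i₀ = proj₁ slope₀

        slope₀⁻¹ : ∃[ j ] Q ^ j * Q ^ i₀ ≈ 1ℤ [ n ]
        slope₀⁻¹ = Q^-inverse n c i₀

        j₀ = proj₁ slope₀⁻¹

      normalised : ℤ → ℤ
      normalised x = Q ^ j₀ * s x

      private
        -- X and Y are x and y mod N, but 1 and 0 mod m. The multiplier of this pair therefore
        -- serves x and y mod N, while mod m it is the slope from 0 to 1.
        multiplier : ∀ x y → ∃[ k ] Q ^ k ≈ s 1ℤ - s 0ℤ [ m ] × s x - s y ≈ (x - y) * Q ^ k [ N ]
        multiplier x y = k , k≈ , kN
          where
          e = proj₁ (crt-idempotent N⊥m)
          e≈1 = proj₁ (proj₂ (crt-idempotent N⊥m))
          e≈0 = proj₂ (proj₂ (crt-idempotent N⊥m))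
          X = e * x + (1ℤ - e)
          Y = e * y
          k = proj₁ (quotient∈⟨q⟩ X Y)
          eq = proj₂ (quotient∈⟨q⟩ X Y)
          X≈x : X ≈ x [ N ]
          X≈x = lin₁ (x - 1ℤ) e≈1 (lemma e x)
            where
            lemma : ∀ e x → e * x + (1ℤ - e) - x ≡ (x - 1ℤ) * (e - 1ℤ)
            lemma = solve-∀
          Y≈y : Y ≈ y [ N ]
          Y≈y = lin₁ y e≈1 (lemma e y)
            where
            lemma : ∀ e y → e * y - y ≡ y * (e - 1ℤ)
            lemma = solve-∀
          X≈1 : X ≈ 1ℤ [ m ]
          X≈1 = lin₁ (x - 1ℤ) e≈0 (lemma e x)
            where
            lemma : ∀ e x → e * x + (1ℤ - e) - 1ℤ ≡ (x - 1ℤ) * (e - 0ℤ)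
            lemma = solve-∀
          Y≈0 : Y ≈ 0ℤ [ m ]
          Y≈0 = lin₁ y e≈0 (lemma e y)
            where
            lemma : ∀ e y → e * y - 0ℤ ≡ y * (e - 0ℤ)
            lemma = solve-∀
          k≈ : Q ^ k ≈ s 1ℤ - s 0ℤ [ m ]
          k≈ = begin
            Q ^ k                  ≡⟨ *-identityˡ (Q ^ k) ⟨
            (1ℤ - 0ℤ) * Q ^ k      ≈⟨ *-congʳ (Q ^ k) (-‿cong X≈1 Y≈0) ⟨
            (X - Y) * Q ^ k        ≈⟨ ≈-weaken m∣n eq ⟨
            s X - s Y              ≈⟨ -‿cong (s-cong m∣n X≈1) (s-cong m∣n Y≈0) ⟩
            s 1ℤ - s 0ℤ            ∎
            where open ≈-Reasoning m
          kN : s x - s y ≈ (x - y) * Q ^ k [ N ]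
          kN = begin
            s x - s y              ≈⟨ -‿cong (s-cong N∣n X≈x) (s-cong N∣n Y≈y) ⟨
            s X - s Y              ≈⟨ ≈-weaken N∣n eq ⟩
            (X - Y) * Q ^ k        ≈⟨ *-congʳ (Q ^ k) (-‿cong X≈x Y≈y) ⟩
            (x - y) * Q ^ k        ∎
            where open ≈-Reasoning N

      quotient∈H : ∀ x y → ∃[ h ] H h × normalised x - normalised y ≈ (x - y) * h [ N ]
      quotient∈H x y = Q ^ (j₀ ℕ.+ k) , (j₀ ℕ.+ k , k-trivial , refl) , (begin
        Q ^ j₀ * s x - Q ^ j₀ * s y     ≡⟨ lemma₁ (Q ^ j₀) (s x) (s y) ⟩
        Q ^ j₀ * (s x - s y)            ≈⟨ *-congˡ (Q ^ j₀) (proj₂ (proj₂ (multiplier x y))) ⟩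
        Q ^ j₀ * ((x - y) * Q ^ k)      ≡⟨ lemma₂ (Q ^ j₀) (x - y) (Q ^ k) ⟩
        (x - y) * (Q ^ j₀ * Q ^ k)      ≡⟨ cong ((x - y) *_) (^-distribˡ-+-* Q j₀ k) ⟨
        (x - y) * Q ^ (j₀ ℕ.+ k)        ∎)
        where
        open ≈-Reasoning N
        k = proj₁ (multiplier x y)
        lemma₁ : ∀ c a b → c * a - c * b ≡ c * (a - b)
        lemma₁ = solve-∀
        lemma₂ : ∀ c a b → c * (a * b) ≡ a * (c * b)
        lemma₂ = solve-∀
        k-trivial : Q ^ (j₀ ℕ.+ k) ≈ 1ℤ [ m ]
        k-trivial = ≈-trans (≡⇒≈ (^-distribˡ-+-* Q j₀ k)) (≈-trans
          (*-congˡ (Q ^ j₀) (≈-trans (proj₁ (proj₂ (multiplier x y))) (≈-weaken m∣n (proj₂ slope₀))))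
          (≈-weaken m∣n (proj₂ slope₀⁻¹)))

      open LocallyAffine group normalised quotient∈H public

      denormalise :
        (∀ x → normalised (+ (2 ℕ.+ x)) - normalised (+ (1 ℕ.+ x)) ≈ normalised (+ (1 ℕ.+ x)) - normalised (+ x) [ N ]) →
        Slopes N
      denormalise h x = unit-cancel (Q ^ i₀) (Q ^ j₀)
        (≈-trans (≡⇒≈ (*-comm (Q ^ i₀) (Q ^ j₀))) (≈-weaken N∣n (proj₂ slope₀⁻¹)))
        (≈-trans (≡⇒≈ (lemma (Q ^ j₀) (s (+ (2 ℕ.+ x))) (s (+ (1 ℕ.+ x)))))
          (≈-trans (h x) (≡⇒≈ (sym (lemma (Q ^ j₀) (s (+ (1 ℕ.+ x))) (s (+ x)))))))
        where
        lemma : ∀ c a b → c * (a - b) ≡ c * a - c * b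
        lemma = solve-∀

      normalised-surjective : ∀ z → ∃[ y ] normalised (+ y) ≈ z [ N ]
      normalised-surjective z = let y , e = surjective (Q ^ i₀ * z) in
        y , ≈-trans (*-congˡ (Q ^ j₀) (≈-weaken N∣n e))
          (lin₁ z (≈-weaken N∣n (proj₂ slope₀⁻¹)) (lemma (Q ^ j₀) (Q ^ i₀) z))
        where
        lemma : ∀ a b z → a * (b * z) - z ≡ z * (a * b - 1ℤ)
        lemma = solve-∀

    private
      power-trivial : ∀ {G t k} → G ^ t ≈ 1ℤ [ n ] → (G ^ k) ^ t ≈ 1ℤ [ n ]
      power-trivial {G} {t} {k} h = ≈-trans
        (≡⇒≈ (trans (^-*-assoc G k t) (trans (cong (G ^_) (ℕ.*-comm k t)) (sym (^-*-assoc G t k))))) (≈1-^ k h)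

    slopes-∥ : ∀ {p} → Prime p → ∀ m → n ≡ p ℕ.* m → ¬ p ℕ.∣ m → ¬ idx m q ≡ idx n q → Slopes p
    slopes-∥ {p} pr m n≡ p∤m neq = go (idx≢⇒small neq)
      where
      open Kernel (kernel-∥ n c pr m n≡ p∤m)
      open Component p m n≡ (prime-coprime pr p∤m)
      go : ∃[ G ] Generator G × (∃[ r ] ∃[ t ] 2 ℕ.≤ r × ℕ.pred p ≡ r ℕ.* t × G ^ t ≈ 1ℤ [ n ]) → Slopes p
      go (G , generates , r , zero , _ , p-1≡ , _) =
        contradiction (trans p-1≡ (ℕ.*-zeroʳ r)) (ℕ.≢-nonZero⁻¹ (ℕ.pred p) {{prime-pred-nonZero pr}})
      go (G , generates , r , t@(suc _) , 2≤r , p-1≡ , G^t≈1) = denormalise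
        (constantSlope-if-small-exponent t pr (ℕ.s≤s ℕ.z≤n) t+t<p exponent normalised-surjective)
        where
        -- p - 1 = r t with r ≥ 2.
        t+t<p : t ℕ.+ t ℕ.< p
        t+t<p = ℕ.≤-<-trans (ℕ.≤-trans (ℕ.≤-reflexive (cong (t ℕ.+_) (sym (ℕ.+-identityʳ t))))
          (ℕ.≤-trans (ℕ.*-monoˡ-≤ t 2≤r) (ℕ.≤-reflexive (sym p-1≡))))
          (ℕ.≤-reflexive (ℕ.suc-pred p {{prime⇒nonZero pr}}))
        exponent : ∀ {h} → H h → h ^ t ≈ 1ℤ [ p ]
        exponent (j , hj , refl) = let k , e = generates j hj in
          ≈-weaken N∣n (≈-trans (^-cong t (≡⇒≈ e)) (power-trivial {G} {t} {k} G^t≈1))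

    slopes-p² : ∀ {p} → Prime p → ¬ 2 ℕ.∣ p → ∀ a m → n ≡ p ℕ.^ (2 ℕ.+ a) ℕ.* m → ¬ p ℕ.∣ m →
      ¬ idx (p ℕ.^ (1 ℕ.+ a) ℕ.* m) q ≡ idx n q → Slopes (p ℕ.^ (2 ℕ.+ a))
    slopes-p² {p} pr p-odd a m n≡ p∤m neq = go (idx≢⇒small neq)
      where
      instance _ = prime⇒nonZero pr
      d = p ℕ.^ (1 ℕ.+ a) ℕ.* m
      p^⊥m : ∀ b → Coprime (p ℕ.^ b) m
      p^⊥m b = coprime-^ˡ b (prime-coprime pr p∤m)
      open Kernel (kernel-p² n c pr d (trans n≡ (ℕ.*-assoc p _ m)) (ℕ.∣m⇒∣m*n m (p∣p^suc p a)))
      open Component (p ℕ.^ (2 ℕ.+ a)) m n≡ (p^⊥m (2 ℕ.+ a))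
      open Descent pr 0 (geometric≈p-odd pr p-odd)
      go : ∃[ G ] Generator G × (∃[ r ] ∃[ t ] 2 ℕ.≤ r × p ≡ r ℕ.* t × G ^ t ≈ 1ℤ [ n ]) → Slopes (p ℕ.^ (2 ℕ.+ a))
      go (G , generates , r , t , 2≤r , p≡ , G^t≈1) = denormalise λ x →
        constantSlope-if-H∩[1+p]-trivial p (p ℕ.^ a) refl trivial (+ x)
        where
        -- r ≥ 2 divides out the whole prime p = r t, so G itself is trivial and a power of q that
        -- is 1 mod n / p is 1 mod n.
        t≡1 : t ≡ 1
        t≡1 with prime⇒irreducible pr (ℕ.divides r p≡)
        ... | inj₁ t≡1 = t≡1
        ... | inj₂ refl = contradiction
          (ℕ.*-cancelʳ-≡ r 1 p (trans (sym p≡) (sym (ℕ.*-identityˡ p)))) (ℕ.<⇒≢ 2≤r ∘ sym)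
        G^k≈1 : ∀ k → G ^ k ≈ 1ℤ [ n ]
        G^k≈1 k = ≈1-^ k (≈-trans (≡⇒≈ (trans (sym (^-identityʳ G)) (cong (G ^_) (sym t≡1)))) G^t≈1)
        trivial : ∀ {u} → H u → u ≈ 1ℤ [ p ] → u ≈ 1ℤ [ p ℕ.^ (2 ℕ.+ a) ]
        trivial (j , hj , refl) u≈1 = lift-to-top (1 ℕ.+ a)
          (subst (Q ^ j ≈ 1ℤ [_]) (sym (ℕ.*-identityʳ p)) u≈1) boost (2 ℕ.+ a) ℕ.≤-refl
          where
          boost : ∀ k → (Q ^ j) ^ k ≈ 1ℤ [ p ℕ.^ (1 ℕ.+ a) ] → (Q ^ j) ^ (k ℕ.* 1) ≈ 1ℤ [ p ℕ.^ (2 ℕ.+ a) ]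
          boost k h = let l , e = generates (j ℕ.* k) (≈-trans (≡⇒≈ (sym (^-*-assoc Q j k)))
                            (≈-crt (p^⊥m (1 ℕ.+ a)) h (≈1-^ k hj))) in
            ≈-weaken N∣n (≈-trans
              (≡⇒≈ (trans (cong ((Q ^ j) ^_) (ℕ.*-identityʳ k)) (trans (^-*-assoc Q j k) e))) (G^k≈1 l))

    -- From 4 = r t with r ≥ 2 follows G ^ 2 = 1, so a power of q that is 1 mod n / 4 is 1 or G.
    -- Lifting then reaches only half of the modulus 2 ^ (3 + a), and `star` closes the gap.
    slopes-8 : ∀ a m → n ≡ 2 ℕ.^ (3 ℕ.+ a) ℕ.* m → ¬ 2 ℕ.∣ m →
      ¬ idx (2 ℕ.^ (1 ℕ.+ a) ℕ.* m) q ≡ idx n q → Slopes (2 ℕ.^ (3 ℕ.+ a))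
    slopes-8 a m n≡ 2∤m neq = go (idx≢⇒small neq)
      where
      d = 2 ℕ.^ (1 ℕ.+ a) ℕ.* m
      2^⊥m : ∀ b → Coprime (2 ℕ.^ b) m
      2^⊥m b = coprime-^ˡ b (prime-coprime prime[2] 2∤m)
      open Kernel (kernel-4 n c d
        (trans n≡ (trans (ℕ.*-assoc 2 (2 ℕ.^ (2 ℕ.+ a)) m) (cong (2 ℕ.*_) (ℕ.*-assoc 2 (2 ℕ.^ (1 ℕ.+ a)) m))))
        (ℕ.∣m⇒∣m*n m (p∣p^suc 2 a)))
      open Component (2 ℕ.^ (3 ℕ.+ a)) m n≡ (2^⊥m (3 ℕ.+ a))
      open Descent prime[2] 1 geometric≈p-even
      2∣N : 2 ℕ.∣ 2 ℕ.^ (3 ℕ.+ a)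
      2∣N = p∣p^suc 2 (2 ℕ.+ a)
      4∣N : 4 ℕ.∣ 2 ℕ.^ (3 ℕ.+ a)
      4∣N = subst (4 ℕ.∣_) (ℕ.*-assoc 2 2 (2 ℕ.^ (1 ℕ.+ a))) (ℕ.m∣m*n (2 ℕ.^ (1 ℕ.+ a)))
      go : ∃[ G ] Generator G × (∃[ r ] ∃[ t ] 2 ℕ.≤ r × 4 ≡ r ℕ.* t × G ^ t ≈ 1ℤ [ n ]) → Slopes (2 ℕ.^ (3 ℕ.+ a))
      go (G , generates , r , t , 2≤r , 4≡ , G^t≈1) = denormalise λ x → constantSlope-if-1+u≈2v⇒u≈1 star (+ x)
        where
        t∣2 : t ℕ.∣ 2
        t∣2 = t∣2′ t 4≡
          where
          t∣2′ : ∀ t → 4 ≡ r ℕ.* t → t ℕ.∣ 2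
          t∣2′ 0 e = contradiction (trans e (ℕ.*-zeroʳ r)) λ ()
          t∣2′ 1 e = ℕ.1∣ 2
          t∣2′ 2 e = ℕ.∣-refl
          t∣2′ (suc (suc (suc t))) e = contradiction
            (ℕ.≤-trans (ℕ.*-mono-≤ 2≤r (ℕ.s≤s (ℕ.s≤s (ℕ.s≤s (ℕ.z≤n {t}))))) (ℕ.≤-reflexive (sym e)))
            λ { (ℕ.s≤s (ℕ.s≤s (ℕ.s≤s (ℕ.s≤s ())))) }
        G²≈1 : G ^ 2 ≈ 1ℤ [ n ]
        G²≈1 = ≈-trans (≡⇒≈ (trans (cong (G ^_) (ℕ._∣_.equality t∣2))
          (trans (cong (G ^_) (ℕ.*-comm (ℕ.quotient t∣2) t)) (sym (^-*-assoc G t (ℕ.quotient t∣2))))))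
          (≈1-^ (ℕ.quotient t∣2) G^t≈1)
        1-or-G : ∀ k → G ^ k ≈ 1ℤ [ n ] ⊎ G ^ k ≈ G [ n ]
        1-or-G 0 = inj₁ ≈-refl
        1-or-G 1 = inj₂ (≡⇒≈ (^-identityʳ G))
        1-or-G (suc (suc k)) = Sum.map (≈-trans G^-period) (≈-trans G^-period) (1-or-G k)
          where
          G^-period : G ^ (2 ℕ.+ k) ≈ G ^ k [ n ]
          G^-period = ≈-trans (≡⇒≈ (^-distribˡ-+-* G 2 k)) (≈-trans (*-congʳ (G ^ k) G²≈1) (≡⇒≈ (*-identityˡ (G ^ k))))
        H∩ker : ∀ {u} → H u → u ≈ 1ℤ [ 2 ℕ.^ (1 ℕ.+ a) ] → u ≈ 1ℤ [ n ] ⊎ u ≈ G [ n ]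
        H∩ker (j , hj , refl) u≈1 = let k , e = generates j (≈-crt (2^⊥m (1 ℕ.+ a)) u≈1 hj) in
          Sum.map (≈-trans (≡⇒≈ e)) (≈-trans (≡⇒≈ e)) (1-or-G k)
        lift : ∀ {u} → H u → u ≈ 1ℤ [ 4 ] → u ≈ 1ℤ [ 2 ℕ.^ (2 ℕ.+ a) ]
        lift (j , hj , refl) u≈1 = lift-to-top (1 ℕ.+ a) u≈1 boost (2 ℕ.+ a) ℕ.≤-refl
          where
          boost : ∀ k → (Q ^ j) ^ k ≈ 1ℤ [ 2 ℕ.^ (1 ℕ.+ a) ] → (Q ^ j) ^ (k ℕ.* 2) ≈ 1ℤ [ 2 ℕ.^ (3 ℕ.+ a) ]
          boost k h = let l , e = generates (j ℕ.* k) (≈-trans (≡⇒≈ (sym (^-*-assoc Q j k)))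
                            (≈-crt (2^⊥m (1 ℕ.+ a)) h (≈1-^ k hj))) in
            ≈-weaken N∣n (≈-trans
              (≡⇒≈ (trans (sym (^-*-assoc (Q ^ j) k 2)) (cong (_^ 2) (trans (^-*-assoc Q j k) e))))
              (power-trivial {G} {2} {l} G²≈1))
        -- As v is odd, u is 1 mod 4, hence 1 mod 2 ^ (2 + a) by `lift`; then 2v = 1 + u makes v
        -- equal to 1 mod 2 ^ (1 + a). So both are 1 or G. If u = 1 nothing remains, v = 1 gives u =
        -- 2 - 1, and u = v = G turns the equation into 1 + u = 2u.
        star : ∀ {u v} → H u → H v → 1ℤ + u ≈ + 2 * v [ 2 ℕ.^ (3 ℕ.+ a) ] → u ≈ 1ℤ [ 2 ℕ.^ (3 ℕ.+ a) ]
        star {u} {v} Hu Hv h = conclude (H∩ker Hu (≈-weaken (ℕ.n∣m*n 2) u≈1)) (H∩ker Hv v≈1)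
          where
          u≈1 : u ≈ 1ℤ [ 2 ℕ.^ (2 ℕ.+ a) ]
          u≈1 = lift Hu (1+u≈2v⇒u≈1 {2} {u} {v} (odd⇒≈1 (nonzero′ Hv)) (≈-weaken 4∣N h))
            where
            open UnitGroup group
            nonzero′ : ∀ {v} → H v → ¬ v ≈ 0ℤ [ 2 ]
            nonzero′ = nonzero prime[2] 2∣N
          v≈1 : v ≈ 1ℤ [ 2 ℕ.^ (1 ℕ.+ a) ]
          v≈1 = *-unscale 2 (lin₂ -1ℤ 1ℤ (≈-weaken (ℕ.n∣m*n 2) h) u≈1 (lemma u v))
            where
            lemma : ∀ u v → + 2 * v - + 2 * 1ℤ ≡ -1ℤ * ((1ℤ + u) - + 2 * v) + 1ℤ * (u - 1ℤ)
            lemma = solve-∀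
          conclude : u ≈ 1ℤ [ n ] ⊎ u ≈ G [ n ] → v ≈ 1ℤ [ n ] ⊎ v ≈ G [ n ] → u ≈ 1ℤ [ 2 ℕ.^ (3 ℕ.+ a) ]
          conclude (inj₁ u≈1) _ = ≈-weaken N∣n u≈1
          conclude (inj₂ _) (inj₁ v≈1) = 1+u≈2v⇒u≈1 {2 ℕ.^ (2 ℕ.+ a)} {u} {v} (≈-weaken (ℕ.∣-trans (ℕ.n∣m*n 2) N∣n) v≈1) h
          conclude (inj₂ u≈G) (inj₂ v≈G) = lin₂ -1ℤ (+ 2) h (≈-weaken N∣n (≈-trans u≈G (≈-sym v≈G))) (lemma u v)
            where
            lemma : ∀ u v → u - 1ℤ ≡ -1ℤ * ((1ℤ + u) - + 2 * v) + + 2 * (u - v)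
            lemma = solve-∀

    module _ (p : ℕ) (pr : Prime p) (a m : ℕ) (n≡ : n ≡ p ℕ.^ suc a ℕ.* m) (p∤m : ¬ p ℕ.∣ m) where

      private
        p∣N : p ℕ.∣ p ℕ.^ suc a
        p∣N = p∣p^suc p a

        open Component (p ℕ.^ suc a) m n≡ (coprime-^ˡ (suc a) (prime-coprime pr p∤m))
        open UnitGroup group

      -- For the moduli 2, 4 and 3, where 1 + u = 2v is solved among all units at once.
      slopes-small : (∀ {u v} → ¬ u ≈ 0ℤ [ p ] → ¬ v ≈ 0ℤ [ p ] →
        1ℤ + u ≈ + 2 * v [ p ℕ.^ suc a ] → u ≈ 1ℤ [ p ℕ.^ suc a ]) → Slopes (p ℕ.^ suc a)
      slopes-small star = denormalise λ x → constantSlope-if-1+u≈2v⇒u≈1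
        (λ Hu Hv → star (nonzero pr p∣N Hu) (nonzero pr p∣N Hv)) (+ x)

    -- The prime powers 2, 4 and 3 are settled outright; each of the others has its own exception to
    -- be excluded. Writing n as a multiple of d, rather than d as a quotient, allows d to be given
    -- by its factorisation.
    slopes-at : ∀ {p} → Prime p → ∀ a m → n ≡ p ℕ.^ suc a ℕ.* m → ¬ p ℕ.∣ m →
      (5 ℕ.≤ p → p ∥ n → ∀ d → n ≡ p ℕ.* d → ¬ idx d q ≡ idx n q) →
      (¬ 2 ℕ.∣ p → p ℕ.^ 2 ℕ.∣ n → ∀ d → n ≡ p ℕ.* d → ¬ idx d q ≡ idx n q) →
      (8 ℕ.∣ n → ∀ d → n ≡ 4 ℕ.* d → ¬ idx d q ≡ idx n q) →
      Slopes (p ℕ.^ suc a)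
    slopes-at {p} pr a m n≡ p∤m ¬E₁ ¬E₂ ¬E₃ with 2 ℕ.∣? p
    slopes-at {p} pr a m n≡ p∤m ¬E₁ ¬E₂ ¬E₃ | yes 2∣p with prime⇒irreducible pr 2∣p
    slopes-at {.2} pr 0 m n≡ p∤m ¬E₁ ¬E₂ ¬E₃ | yes 2∣p | inj₂ refl =
      slopes-small 2 pr 0 m n≡ p∤m λ u≉0 v≉0 h → odd⇒≈1 u≉0
    slopes-at {.2} pr 1 m n≡ p∤m ¬E₁ ¬E₂ ¬E₃ | yes 2∣p | inj₂ refl =
      slopes-small 2 pr 1 m n≡ p∤m λ {u} {v} u≉0 v≉0 h → 1+u≈2v⇒u≈1 {2} {u} {v} (odd⇒≈1 v≉0) h
    slopes-at {.2} pr (suc (suc a)) m n≡ p∤m ¬E₁ ¬E₂ ¬E₃ | yes 2∣p | inj₂ refl =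
      slopes-8 a m n≡ p∤m (¬E₃ 8∣n (2 ℕ.^ (1 ℕ.+ a) ℕ.* m) (trans n≡ (trans (cong (ℕ._* m) (sym (ℕ.*-assoc 2 2 (2 ℕ.^ (1 ℕ.+ a))))) (ℕ.*-assoc 4 (2 ℕ.^ (1 ℕ.+ a)) m))))
      where
      8∣n : 8 ℕ.∣ n
      8∣n = subst (8 ℕ.∣_) (sym n≡) (ℕ.∣m⇒∣m*n m
        (subst (8 ℕ.∣_) (sym (ℕ.^-distribˡ-+-* 2 3 a)) (ℕ.m∣m*n (2 ℕ.^ a))))
    slopes-at {p} pr 0 m n≡ p∤m ¬E₁ ¬E₂ ¬E₃ | no 2∤p with 5 ℕ.≤? p
    ... | yes 5≤p = subst Slopes (sym (ℕ.*-identityʳ p))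
      (slopes-∥ pr m n≡p*m p∤m (¬E₁ 5≤p (subst (p ℕ.∣_) (sym n≡p*m) (ℕ.m∣m*n m) , p²∤n) m n≡p*m))
      where
      instance _ = prime⇒nonZero pr
      n≡p*m : n ≡ p ℕ.* m
      n≡p*m = trans n≡ (cong (ℕ._* m) (ℕ.*-identityʳ p))
      p²∤n : ¬ p ℕ.^ 2 ℕ.∣ n
      p²∤n h = p∤m (subst (ℕ._∣ m) (ℕ.*-identityʳ p) (ℕ.*-cancelˡ-∣ p (subst (p ℕ.^ 2 ℕ.∣_) n≡p*m h)))
    ... | no p≱5 = odd-small p pr 2∤p (ℕ.≰⇒> p≱5) n≡ p∤m
      where
      odd-small : ∀ p → Prime p → ¬ 2 ℕ.∣ p → p ℕ.< 5 → n ≡ p ℕ.^ 1 ℕ.* m → ¬ p ℕ.∣ m → Slopes (p ℕ.^ 1)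
      odd-small 0 pr = contradiction pr ¬prime[0]
      odd-small 1 pr = contradiction pr ¬prime[1]
      odd-small 2 pr 2∤2 = contradiction ℕ.∣-refl 2∤2
      odd-small 3 pr _ _ n≡ p∤m = slopes-small 3 pr 0 m n≡ p∤m star
        where
        star : ∀ {u v} → ¬ u ≈ 0ℤ [ 3 ] → ¬ v ≈ 0ℤ [ 3 ] → 1ℤ + u ≈ + 2 * v [ 3 ] → u ≈ 1ℤ [ 3 ]
        star {u} {v} u≉0 v≉0 h with residue-cases u 3
        ... | 0 , _ , e = contradiction e u≉0
        ... | 1 , _ , e = e
        -- Here 2v = 1 + u would be 0 mod 3.
        ... | 2 , _ , e = contradiction
          (coprime-cancel (+ 2) (prime-coprime pr λ { (ℕ.divides zero ()) ; (ℕ.divides (suc _) ()) })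
            (≈-trans (≈-sym h) (≈-trans (+-cong (≈-refl {x = 1ℤ}) e) (n≈0 {3})))) v≉0
        ... | suc (suc (suc r)) , ℕ.s≤s (ℕ.s≤s (ℕ.s≤s ())) , _
      odd-small 4 pr 2∤4 = contradiction (ℕ.divides 2 refl) 2∤4
      odd-small (suc (suc (suc (suc (suc _))))) _ _ (ℕ.s≤s (ℕ.s≤s (ℕ.s≤s (ℕ.s≤s (ℕ.s≤s ())))))
    slopes-at {p} pr (suc a) m n≡ p∤m ¬E₁ ¬E₂ ¬E₃ | no 2∤p =
      slopes-p² pr 2∤p a m n≡ p∤m (¬E₂ 2∤p p²∣n (p ℕ.^ suc a ℕ.* m) (trans n≡ (ℕ.*-assoc p (p ℕ.^ suc a) m)))
      where
      p²∣n : p ℕ.^ 2 ℕ.∣ n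
      p²∣n = subst (p ℕ.^ 2 ℕ.∣_) (sym n≡) (ℕ.∣m⇒∣m*n m
        (subst (p ℕ.^ 2 ℕ.∣_) (sym (ℕ.^-distribˡ-+-* p 2 a)) (ℕ.m∣m*n (p ℕ.^ a))))

  -- From prime powers back to n.

  prime-divisor : ∀ n .{{_ : NonZero n}} → n ≡ 1 ⊎ ∃[ p ] Prime p × p ℕ.∣ n
  prime-divisor n with factorise n
  ... | record { factors = [] ; isFactorisation = n≡1 } = inj₁ n≡1
  ... | record { factors = p ∷ ps ; isFactorisation = n≡ ; factorsPrime = pr ∷ _ } =
    inj₂ (p , pr , subst (p ℕ.∣_) (sym n≡) (ℕ.m∣m*n _))

  prime-part : ∀ {p} → Prime p → ∀ n .{{_ : NonZero n}} → p ℕ.∣ n →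
    ∃[ a ] ∃[ m ] n ≡ p ℕ.^ suc a ℕ.* m × ¬ p ℕ.∣ m
  prime-part {p} pr n p∣n = go n (<-wellFounded n) (ℕ.≢-nonZero⁻¹ n) p∣n
    where
    instance
      _ = prime⇒nonZero pr
      _ = prime⇒nonTrivial pr
    go : ∀ n → Acc ℕ._<_ n → n ≢ 0 → p ℕ.∣ n → ∃[ a ] ∃[ m ] n ≡ p ℕ.^ suc a ℕ.* m × ¬ p ℕ.∣ m
    go n (acc rs) n≢0 (ℕ.divides m n≡m*p) with p ℕ.∣? m
    ... | no p∤m = 0 , m , trans n≡m*p (trans (ℕ.*-comm m p) (cong (ℕ._* m) (sym (ℕ.*-identityʳ p)))) , p∤m
    ... | yes p∣m =
      let a , m′ , m≡ , p∤m′ = go m (rs m<n) m≢0 p∣m in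
      suc a , m′ , trans n≡m*p (trans (ℕ.*-comm m p) (trans (cong (p ℕ.*_) m≡) (sym (ℕ.*-assoc p (p ℕ.^ suc a) m′)))) , p∤m′
      where
      m≢0 : m ≢ 0
      m≢0 refl = n≢0 n≡m*p
      m<n : m ℕ.< n
      m<n = subst (m ℕ.<_) (sym n≡m*p) (ℕ.m<m*n m p {{ℕ.≢-nonZero m≢0}} (ℕ.nonTrivial⇒n>1 p))

  -- Write n = n′ g with g the gcd of n and D. A prime p dividing n′ would multiply the full p-part
  -- of n, which g already contains, and p times this part would still divide n.
  prime-powers∣⇒∣ : ∀ n .{{_ : NonZero n}} D →
    (∀ {p} → Prime p → ∀ a m → n ≡ p ℕ.^ suc a ℕ.* m → ¬ p ℕ.∣ m → p ℕ.^ suc a ℕ.∣ D) → n ℕ.∣ D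
  prime-powers∣⇒∣ n D h with gcd[m,n]∣m n D
  ... | ℕ.divides n′ n≡n′*g with prime-divisor n′ {{n′≢0}}
    where
    n′≢0 : NonZero n′
    n′≢0 = ℕ.≢-nonZero λ { refl → ℕ.≢-nonZero⁻¹ n n≡n′*g }
  ... | inj₁ refl = subst (ℕ._∣ D) (sym (trans n≡n′*g (ℕ.*-identityˡ _))) (gcd[m,n]∣n n D)
  ... | inj₂ (p , pr , p∣n′) = contradiction p∣m p∤m
    where
    instance _ = prime⇒nonZero pr
    part = prime-part pr n (subst (p ℕ.∣_) (sym n≡n′*g) (ℕ.∣m⇒∣m*n _ p∣n′))
    a = proj₁ part
    m = proj₁ (proj₂ part)
    n≡ = proj₁ (proj₂ (proj₂ part))
    p∤m = proj₂ (proj₂ (proj₂ part))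
    p^∣g : p ℕ.^ suc a ℕ.∣ gcd n D
    p^∣g = gcd-greatest (subst (p ℕ.^ suc a ℕ.∣_) (sym n≡) (ℕ.m∣m*n m)) (h pr a m n≡ p∤m)
    p∣m : p ℕ.∣ m
    p∣m = ℕ.*-cancelˡ-∣ (p ℕ.^ suc a) {{ℕ.m^n≢0 p (suc a)}}
      (subst₂ ℕ._∣_ (ℕ.*-comm p _) (trans (sym n≡n′*g) n≡) (ℕ.*-pres-∣ p∣n′ p^∣g))

  -- The scheme in terms of congruences, and affinity without exceptions.

  module Residues (n : ℕ) .{{_ : NonZero n}} where

    ι : Fin n → ℤ
    ι x = + toℕ x

    ρ : ℤ → Fin n
    ρ z = fromℕ< (n%ℕd<d z n)

    ι-ρ : ∀ z → ι (ρ z) ≈ z [ n ]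
    ι-ρ z = ≈-trans (≡⇒≈ (cong +_ (toℕ-fromℕ< (n%ℕd<d z n)))) (%ℕ-≈ z n)

    ι-injective : ∀ {x y} → ι x ≈ ι y [ n ] → x ≡ y
    ι-injective {x} {y} h = toℕ-injective (≈⇒≡ (toℕ<n x) (toℕ<n y) h)

    ρ-ι : ∀ x → ρ (ι x) ≡ x
    ρ-ι x = ι-injective (ι-ρ (ι x))

    ι-mod : ∀ a → ι (a ℕ.mod n) ≈ + a [ n ]
    ι-mod a = ≈-trans (≡⇒≈ (cong +_ (toℕ-fromℕ< (ℕ.m%n<n a n)))) (%ℕ-≈ (+ a) n)

  module Scheme (q n : ℕ) .{{_ : NonZero n}} (c : Coprime n q) where

    open Order q
    open Residues n public

    private
      ι-⊕ : ∀ x y → ι (_⊕_ q n x y) ≈ ι x + ι y [ n ]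
      ι-⊕ x y = ι-mod (toℕ x ℕ.+ toℕ y)

      ι-⊗ : ∀ x y → ι (_⊗_ q n x y) ≈ ι x * ι y [ n ]
      ι-⊗ x y = ≈-trans (ι-mod (toℕ x ℕ.* toℕ y)) (≡⇒≈ (pos-* (toℕ x) (toℕ y)))

      ι-⊖ : ∀ x y → ι (_⊖_ q n x y) ≈ ι x - ι y [ n ]
      ι-⊖ x y = ≈-trans (ι-mod (toℕ x ℕ.+ (n ℕ.∸ toℕ y))) (mk 1ℤ (begin
        + (toℕ x ℕ.+ (n ℕ.∸ toℕ y)) - (ι x - ι y)      ≡⟨ cong (λ z → (ι x + z) - (ι x - ι y)) (sym n-y) ⟩
        (ι x + (+ n - ι y)) - (ι x - ι y)              ≡⟨ lemma (ι x) (ι y) (+ n) ⟩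
        1ℤ * + n                                       ∎))
        where
        open ≡-Reasoning
        n-y : + n - ι y ≡ + (n ℕ.∸ toℕ y)
        n-y = trans (m-n≡m⊖n n (toℕ y)) (⊖-≥ (ℕ.<⇒≤ (toℕ<n y)))
        lemma : ∀ x y n → (x + (n - y)) - (x - y) ≡ 1ℤ * n
        lemma = solve-∀

      ι-q^ : ∀ j → ι ((q ℕ.^ j) ℕ.mod n) ≈ Q ^ j [ n ]
      ι-q^ j = ≈-trans (ι-mod (q ℕ.^ j)) (≡⇒≈ (pos-^ q j))

    colour⇒≈ : ∀ x y {z} → z ∈ colour q n x y → ∃[ j ] ι z ≈ (ι y - ι x) * Q ^ j [ n ]
    colour⇒≈ x y {z} (k , (j , refl) , refl) = j ,
      ≈-trans (ι-⊗ (_⊖_ q n y x) ((q ℕ.^ j) ℕ.mod n)) (*-cong (ι-⊖ y x) (ι-q^ j))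

    ≈⇒colour : ∀ x y {z} j → ι z ≈ (ι y - ι x) * Q ^ j [ n ] → z ∈ colour q n x y
    ≈⇒colour x y {z} j h = (q ℕ.^ j) ℕ.mod n , (j , refl) , ι-injective (≈-trans h
      (≈-sym (≈-trans (ι-⊗ (_⊖_ q n y x) ((q ℕ.^ j) ℕ.mod n)) (*-cong (ι-⊖ y x) (ι-q^ j)))))

    -- A difference lies in its own orbit (exponent 0), so preservation of colours puts the new
    -- difference in the orbit of the old one.
    Aut⇒≈ : ∀ {σ} → σ ∈ Aut q n → ∀ x y → ∃[ j ] ι (σ ⟨$⟩ʳ x) - ι (σ ⟨$⟩ʳ y) ≈ (ι x - ι y) * Q ^ j [ n ]
    Aut⇒≈ {σ} aut x y =
      let j , h = colour⇒≈ y x (proj₁ (aut y x) (≈⇒colour (σ ⟨$⟩ʳ y) (σ ⟨$⟩ʳ x) {d} 0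
                    (≈-trans (ι-⊖ (σ ⟨$⟩ʳ x) (σ ⟨$⟩ʳ y)) (≡⇒≈ (sym (*-identityʳ _))))))
      in j , ≈-trans (≈-sym (ι-⊖ (σ ⟨$⟩ʳ x) (σ ⟨$⟩ʳ y))) h
      where
      d = _⊖_ q n (σ ⟨$⟩ʳ x) (σ ⟨$⟩ʳ y)

    ≈⇒Aut : ∀ {σ} → (∀ x y → ∃[ j ] ι (σ ⟨$⟩ʳ x) - ι (σ ⟨$⟩ʳ y) ≈ (ι x - ι y) * Q ^ j [ n ]) → σ ∈ Aut q n
    ≈⇒Aut {σ} h x y = forth , back
      where
      j = proj₁ (h y x)
      e = proj₂ (h y x)
      j⁻¹ = proj₁ (Q^-inverse n c j)
      e⁻¹ = proj₂ (Q^-inverse n c j)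
      dσ = ι (σ ⟨$⟩ʳ y) - ι (σ ⟨$⟩ʳ x)
      forth : colour q n (σ ⟨$⟩ʳ x) (σ ⟨$⟩ʳ y) ⊆ colour q n x y
      forth {z} z∈ = let i , f = colour⇒≈ (σ ⟨$⟩ʳ x) (σ ⟨$⟩ʳ y) z∈ in ≈⇒colour x y (j ℕ.+ i) (begin
        ι z                                ≈⟨ f ⟩
        dσ * Q ^ i                         ≈⟨ *-congʳ (Q ^ i) e ⟩
        (ι y - ι x) * Q ^ j * Q ^ i        ≡⟨ *-assoc (ι y - ι x) (Q ^ j) (Q ^ i) ⟩
        (ι y - ι x) * (Q ^ j * Q ^ i)      ≡⟨ cong ((ι y - ι x) *_) (^-distribˡ-+-* Q j i) ⟨
        (ι y - ι x) * Q ^ (j ℕ.+ i)        ∎)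
        where open ≈-Reasoning n
      back : colour q n x y ⊆ colour q n (σ ⟨$⟩ʳ x) (σ ⟨$⟩ʳ y)
      back {z} z∈ = let i , f = colour⇒≈ x y z∈ in ≈⇒colour (σ ⟨$⟩ʳ x) (σ ⟨$⟩ʳ y) (j⁻¹ ℕ.+ i) (begin
        ι z                                                      ≈⟨ f ⟩
        (ι y - ι x) * Q ^ i                                      ≈⟨ lin₁ (- (ι y - ι x) * Q ^ i) e⁻¹ (lemma (ι y - ι x) (Q ^ j) (Q ^ i) (Q ^ j⁻¹)) ⟩
        (ι y - ι x) * Q ^ j * (Q ^ j⁻¹ * Q ^ i)                  ≈⟨ *-congʳ (Q ^ j⁻¹ * Q ^ i) e ⟨
        dσ * (Q ^ j⁻¹ * Q ^ i)                                   ≡⟨ cong (dσ *_) (^-distribˡ-+-* Q j⁻¹ i) ⟨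
        dσ * Q ^ (j⁻¹ ℕ.+ i)                                     ∎)
        where
        open ≈-Reasoning n
        lemma : ∀ d a b c → d * b - d * a * (c * b) ≡ - d * b * (c * a - 1ℤ)
        lemma = solve-∀

    Aff⇒≈ : ∀ {σ} → σ ∈ Aff q n → ∃[ j ] ∃[ b ] ∀ x → ι (σ ⟨$⟩ʳ x) ≈ ι x * Q ^ j + b [ n ]
    Aff⇒≈ {σ} (k , b , (j , refl) , h) = j , ι b , λ x → ≈-trans (≡⇒≈ (cong ι (h x)))
      (≈-trans (ι-⊕ (_⊗_ q n k x) b) (+-cong (≈-trans (ι-⊗ k x)
        (≈-trans (*-congʳ (ι x) (ι-q^ j)) (≡⇒≈ (*-comm (Q ^ j) (ι x))))) (≈-refl {x = ι b})))

    ≈⇒Aff : ∀ {σ} j b → (∀ x → ι (σ ⟨$⟩ʳ x) ≈ ι x * Q ^ j + b [ n ]) → σ ∈ Aff q n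
    ≈⇒Aff {σ} j b h = k , ρ b , (j , refl) , λ x → ι-injective (≈-trans (h x) (≈-sym
      (≈-trans (ι-⊕ (_⊗_ q n k x) (ρ b)) (+-cong (≈-trans (ι-⊗ k x)
        (≈-trans (*-congʳ (ι x) (ι-q^ j)) (≡⇒≈ (*-comm (Q ^ j) (ι x))))) (ι-ρ b)))))
      where
      k = (q ℕ.^ j) ℕ.mod n

    Aff⊆Aut : Aff q n ⊆ Aut q n
    Aff⊆Aut {σ} aff = let j , b , h = Aff⇒≈ {σ} aff in ≈⇒Aut {σ} λ x y →
      j , ≈-trans (-‿cong (h x) (h y)) (≡⇒≈ (lemma (ι x) (ι y) (Q ^ j) b))
      where
      lemma : ∀ x y k b → (x * k + b) - (y * k + b) ≡ (x - y) * k
      lemma = solve-∀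

    Exception₁ Exception₂ Exception₃ : Set
    Exception₁ = ∃[ p ] Σ[ pr ∈ Prime p ] 5 ℕ.≤ p × p ∥ n × idx (ℕ._/_ n p {{prime⇒nonZero pr}}) q ≡ idx n q
    Exception₂ = ∃[ p ] Σ[ pr ∈ Prime p ] ¬ (2 ℕ.∣ p) × p ℕ.^ 2 ℕ.∣ n × idx (ℕ._/_ n p {{prime⇒nonZero pr}}) q ≡ idx n q
    Exception₃ = 8 ℕ.∣ n × idx (n ℕ./ 4) q ≡ idx n q

    private
      quotient≡ : ∀ p .{{_ : NonZero p}} d → n ≡ p ℕ.* d → n ℕ./ p ≡ d
      quotient≡ p d n≡ = trans (ℕ./-congˡ {p} (trans n≡ (ℕ.*-comm p d))) (ℕ.m*n/n≡m d p)

    Aut⊆Aff : ¬ Exception₁ → ¬ Exception₂ → ¬ Exception₃ → Aut q n ⊆ Aff q n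
    Aut⊆Aff ¬E₁ ¬E₂ ¬E₃ {σ} aut = ≈⇒Aff {σ} k (s 0ℤ) λ x → ≈-trans
      (≡⇒≈ (cong (ι ∘ (σ ⟨$⟩ʳ_)) (sym (ρ-ι x))))
      (≈-trans (linear (toℕ x)) (+-cong (*-congˡ (ι x) slope≈) (≈-refl {x = s 0ℤ})))
      where
      s : ℤ → ℤ
      -- σ read as an n-periodic function on ℤ, so that it can be evaluated at integers built from
      -- idempotents and shifts.
      s z = ι (σ ⟨$⟩ʳ ρ z)
      quotient∈⟨q⟩ : ∀ x y → ∃[ j ] s x - s y ≈ (x - y) * Q ^ j [ n ]
      quotient∈⟨q⟩ x y = let j , h = Aut⇒≈ {σ} aut (ρ x) (ρ y) in
        j , ≈-trans h (*-congʳ (Q ^ j) (-‿cong (ι-ρ x) (ι-ρ y)))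
      surjective : ∀ z → ∃[ y ] s (+ y) ≈ z [ n ]
      surjective z = toℕ w , ≈-trans (≡⇒≈ (cong ι (trans (cong (σ ⟨$⟩ʳ_) (ρ-ι w)) (inverseʳ σ)))) (ι-ρ z)
        where
        w = σ ⟨$⟩ˡ ρ z
      k = proj₁ (quotient∈⟨q⟩ 1ℤ 0ℤ)
      slope≈ : s 1ℤ - s 0ℤ ≈ Q ^ k [ n ]
      slope≈ = ≈-trans (proj₂ (quotient∈⟨q⟩ 1ℤ 0ℤ)) (≡⇒≈ (*-identityˡ (Q ^ k)))
      open ConstantSlopes q n c s quotient∈⟨q⟩ surjective using (Slopes; slopes-at)
      slopes : Slopes n
      slopes x = ∣⇒≈ (prime-powers∣⇒∣ n _ λ {p} pr a m n≡ p∤m → ≈⇒∣ (slopes-at pr a m n≡ p∤m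
        (λ 5≤p p∥n d e eq → ¬E₁ (p , pr , 5≤p , p∥n ,
          trans (cong (λ d → idx d q) (quotient≡ p {{prime⇒nonZero pr}} d e)) eq))
        (λ 2∤p p²∣n d e eq → ¬E₂ (p , pr , 2∤p , p²∣n ,
          trans (cong (λ d → idx d q) (quotient≡ p {{prime⇒nonZero pr}} d e)) eq))
        (λ 8∣n d e eq → ¬E₃ (8∣n , trans (cong (λ d → idx d q) (quotient≡ 4 d e)) eq)) x))
      first-slope : ∀ x → s (+ (1 ℕ.+ x)) - s (+ x) ≈ s 1ℤ - s 0ℤ [ n ]
      first-slope zero    = ≈-refl
      first-slope (suc x) = ≈-trans (slopes x) (first-slope x)
      linear : ∀ x → s (+ x) ≈ + x * (s 1ℤ - s 0ℤ) + s 0ℤ [ n ]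
      linear zero    = ≡⇒≈ (sym (+-identityˡ (s 0ℤ)))
      linear (suc x) = lin₂ 1ℤ 1ℤ (first-slope x) (linear x)
        (lemma (s (+ (1 ℕ.+ x))) (s (+ x)) (s 1ℤ) (s 0ℤ) (+ x))
        where
        lemma : ∀ a b u v x → a - ((1ℤ + x) * (u - v) + v) ≡
          1ℤ * ((a - b) - (u - v)) + 1ℤ * (b - (x * (u - v) + v))
        lemma = solve-∀

    exception₁? : Dec Exception₁
    exception₁? = map′ (λ (p , _ , e) → p , e)
      (λ (p , e) → p , ℕ.s≤s (ℕ.∣⇒≤ (proj₁ (proj₁ (proj₂ (proj₂ e))))) , e)
      (ℕ.anyUpTo? at? (suc n))
      where
      at? : ∀ p → Dec (Σ[ pr ∈ Prime p ] 5 ℕ.≤ p × p ∥ n × idx (ℕ._/_ n p {{prime⇒nonZero pr}}) q ≡ idx n q)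
      at? p with prime? p
      ... | no ¬pr = no (¬pr ∘ proj₁)
      ... | yes pr = map′ (pr ,_) proj₂
        (5 ℕ.≤? p ×-dec (p ℕ.∣? n ×-dec ¬? (p ℕ.^ 2 ℕ.∣? n)) ×-dec _ ℕ.≟ _)

    exception₂? : Dec Exception₂
    exception₂? = map′ (λ (p , _ , e) → p , e)
      (λ (p , e) → p , ℕ.s≤s (ℕ.∣⇒≤ (p∣n p (proj₁ (proj₂ (proj₂ e))))) , e)
      (ℕ.anyUpTo? at? (suc n))
      where
      p∣n : ∀ p → p ℕ.^ 2 ℕ.∣ n → p ℕ.∣ n
      p∣n p = ℕ.∣-trans (ℕ.m∣m*n (p ℕ.^ 1))
      at? : ∀ p → Dec (Σ[ pr ∈ Prime p ] ¬ (2 ℕ.∣ p) × p ℕ.^ 2 ℕ.∣ n × idx (ℕ._/_ n p {{prime⇒nonZero pr}}) q ≡ idx n q)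
      at? p with prime? p
      ... | no ¬pr = no (¬pr ∘ proj₁)
      ... | yes pr = map′ (pr ,_) proj₂
        (¬? (2 ℕ.∣? p) ×-dec p ℕ.^ 2 ℕ.∣? n ×-dec _ ℕ.≟ _)

    exception₃? : Dec Exception₃
    exception₃? = 8 ℕ.∣? n ×-dec _ ℕ.≟ _

    -- The hypothesis is a negation, while an exception has to be produced; decidability of the
    -- three exceptions, with primes searched up to n, bridges the gap.
    Aut≢Aff⇒exception : ¬ (Aut q n ≐ Aff q n) → Exception₁ ⊎ Exception₂ ⊎ Exception₃
    Aut≢Aff⇒exception neq = decidable-stable (exception₁? ⊎-dec exception₂? ⊎-dec exception₃?) λ ¬E →
      neq ((λ {σ} → Aut⊆Aff (¬E ∘ inj₁) (¬E ∘ inj₂ ∘ inj₁) (¬E ∘ inj₂ ∘ inj₂) {σ}) , λ {σ} → Aff⊆Aut {σ})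

  -- Nonaffine automorphisms in the exceptional cases.

  private
    pos≉0 : ∀ {k n} → k ℕ.< n → k ≢ 0 → ¬ + k ≈ 0ℤ [ n ]
    pos≉0 {suc k} k<n _ h = ℕ.>⇒∤ k<n (≈0⇒∣ h)
    pos≉0 {zero} _ 0≢0 _ = 0≢0 refl

  prime-inverse : ∀ {p} → Prime p → ∀ {y} → ¬ y ≈ 0ℤ [ p ] → ∃[ z ] z * y ≈ 1ℤ [ p ]
  prime-inverse {p} pr {y} y≉0 =
    let e , e≈1 , e≈0 = crt-idempotent (prime-coprime pr {∣ y ∣} (y≉0 ∘ ∣⇒≈0))
        divides z e≡z*y = ∣ᵤ⇒∣ {y} {e} (≈0⇒∣ e≈0)
    in z , ≈-trans (≡⇒≈ (sym e≡z*y)) e≈1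

  1+_^≈ : ∀ {n} y k → y * y ≈ 0ℤ [ n ] → (1ℤ + y) ^ k ≈ 1ℤ + + k * y [ n ]
  1+_^≈ y zero    y²≈0 = ≡⇒≈ refl
  1+_^≈ {n} y (suc k) y²≈0 = ≈-trans (*-congˡ (1ℤ + y) (1+_^≈ y k y²≈0))
    (lin₁ (+ k) y²≈0 (lemma (+ k) y))
    where
    lemma : ∀ k y → (1ℤ + y) * (1ℤ + k * y) - (1ℤ + (1ℤ + k) * y) ≡ k * (y * y - 0ℤ)
    lemma = solve-∀

  -- If g has p - 1 distinct powers mod p, then a * g ^ k, k < p - 1, and b are p
  -- nonzero residues, so two of them coincide.
  powers-reach : ∀ {p} → Prime p → ∀ g → (∀ k → g ^ k ≈ 1ℤ [ p ] → ℕ.pred p ℕ.∣ k) → ¬ g ≈ 0ℤ [ p ] →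
    ∀ a b → ¬ a ≈ 0ℤ [ p ] → ¬ b ≈ 0ℤ [ p ] → ∃[ k ] a * g ^ k ≈ b [ p ]
  powers-reach {zero} pr = contradiction pr ¬prime[0]
  powers-reach {p@(suc L)} pr g full g≉0 a b a≉0 b≉0 =
    let i , j , i<j , eq = pigeonhole (ℕ.n<1+n L) (λ i → slot (family i) (family≉0 i)) in
    reach i j i<j (slot-injective (family≉0 i) (family≉0 j) eq)
    where
    family : Fin (suc L) → ℤ
    family Fin.zero    = b
    family (Fin.suc i) = a * g ^ toℕ i
    family≉0 : ∀ i → ¬ family i ≈ 0ℤ [ p ]
    family≉0 Fin.zero    = b≉0
    family≉0 (Fin.suc i) h = [ a≉0 , g≉0 ∘ prime-^≈0 pr (toℕ i) ]′ (prime-*≈0 {a} {g ^ toℕ i} pr h)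
    residue : ℤ → ℕ
    residue x = x %ℕ p
    residue≢0 : ∀ {x} → ¬ x ≈ 0ℤ [ p ] → residue x ≢ 0
    residue≢0 {x} x≉0 r≡0 = x≉0 (≈-trans (≈-sym (%ℕ-≈ x p)) (≡⇒≈ (cong +_ r≡0)))
    pred<L : ∀ {x} → ¬ x ≈ 0ℤ [ p ] → ℕ.pred (residue x) ℕ.< L
    pred<L {x} x≉0 = ℕ.≤-trans
      (ℕ.≤-reflexive (ℕ.suc-pred (residue x) {{ℕ.≢-nonZero (residue≢0 x≉0)}})) (ℕ.s≤s⁻¹ (n%ℕd<d x p))
    slot : ∀ x → ¬ x ≈ 0ℤ [ p ] → Fin L
    slot x x≉0 = fromℕ< (pred<L x≉0)
    slot-injective : ∀ {x y} (x≉0 : ¬ x ≈ 0ℤ [ p ]) (y≉0 : ¬ y ≈ 0ℤ [ p ]) →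
      slot x x≉0 ≡ slot y y≉0 → x ≈ y [ p ]
    slot-injective {x} {y} x≉0 y≉0 eq = ≈-trans (≈-sym (%ℕ-≈ x p)) (≈-trans (≡⇒≈ (cong +_ residues≡)) (%ℕ-≈ y p))
      where
      preds≡ : ℕ.pred (residue x) ≡ ℕ.pred (residue y)
      preds≡ = trans (sym (toℕ-fromℕ< (pred<L x≉0))) (trans (cong toℕ eq) (toℕ-fromℕ< (pred<L y≉0)))
      residues≡ : residue x ≡ residue y
      residues≡ = ℕ.pred-injective {{ℕ.≢-nonZero (residue≢0 x≉0)}} {{ℕ.≢-nonZero (residue≢0 y≉0)}} preds≡
    reach : ∀ i j → i Fin.< j → family i ≈ family j [ p ] → ∃[ k ] a * g ^ k ≈ b [ p ]
    reach Fin.zero (Fin.suc j) _ h = toℕ j , ≈-sym h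
    reach (Fin.suc i) (Fin.suc j) (ℕ.s≤s i<j) h = contradiction
      (full (suc e) g^1+e≈1) (ℕ.>⇒∤ (ℕ.≤-<-trans 1+e≤j (toℕ<n j)))
      where
      e = proj₁ (ℕ.m≤n⇒∃[o]m+o≡n i<j)
      1+i+e≡j = proj₂ (ℕ.m≤n⇒∃[o]m+o≡n i<j)
      1+e≤j : suc e ℕ.≤ toℕ j
      1+e≤j = ℕ.≤-trans (ℕ.s≤s (ℕ.m≤n+m e (toℕ i))) (ℕ.≤-reflexive 1+i+e≡j)
      c = a * g ^ toℕ i
      c≉0 : ¬ c ≈ 0ℤ [ p ]
      c≉0 = family≉0 (Fin.suc i)
      g^1+e≈1 : g ^ suc e ≈ 1ℤ [ p ]
      g^1+e≈1 = coprime-cancel c (prime-coprime pr (c≉0 ∘ ∣⇒≈0)) (begin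
        c * g ^ suc e                    ≡⟨ *-assoc a (g ^ toℕ i) (g ^ suc e) ⟩
        a * (g ^ toℕ i * g ^ suc e)      ≡⟨ cong (a *_) (^-distribˡ-+-* g (toℕ i) (suc e)) ⟨
        a * g ^ (toℕ i ℕ.+ suc e)        ≡⟨ cong (λ k → a * g ^ k) (trans (ℕ.+-suc (toℕ i) e) 1+i+e≡j) ⟩
        a * g ^ toℕ j                    ≈⟨ h ⟨
        c                                ≡⟨ *-identityʳ c ⟨
        c * 1ℤ                           ∎)
        where open ≈-Reasoning p

  module Exceptions (q n : ℕ) .{{_ : NonZero n}} (c : Coprime n q) where

    open Multipliers q
    open Scheme q n c

    module _ (F G : ℤ → ℤ)
      (F-cong : ∀ {x y} → x ≈ y [ n ] → F x ≈ F y [ n ])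
      (G-cong : ∀ {x y} → x ≈ y [ n ] → G x ≈ G y [ n ])
      (F∘G : ∀ x → F (G x) ≈ x [ n ]) (G∘F : ∀ x → G (F x) ≈ x [ n ]) where

      private
        left : (H : ℤ → ℤ) → (∀ {x y} → x ≈ y [ n ] → H x ≈ H y [ n ]) →
          (K : ℤ → ℤ) → (∀ x → H (K x) ≈ x [ n ]) → ∀ x → ρ (H (ι (ρ (K (ι x))))) ≡ x
        left H H-cong K H∘K x = ι-injective (≈-trans (ι-ρ (H (ι (ρ (K (ι x))))))
          (≈-trans (H-cong (ι-ρ (K (ι x)))) (H∘K (ι x))))

      residuePermutation : Permutation′ n
      residuePermutation = permutation (ρ ∘ F ∘ ι) (ρ ∘ G ∘ ι) (left F F-cong G F∘G) (left G G-cong F G∘F)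

      -- An affine map that fixes a and a + 1 has slope 1 and translation 0, so it would fix 0 as
      -- well.
      Aut≢Aff : (∀ x y → ∃[ j ] F x - F y ≈ (x - y) * Q ^ j [ n ]) →
        ∀ a → F a ≈ a [ n ] → F (a + 1ℤ) ≈ a + 1ℤ [ n ] → ¬ F 0ℤ ≈ 0ℤ [ n ] → ¬ (Aut q n ≐ Aff q n)
      Aut≢Aff quotients a Fa≈a F[a+1]≈a+1 F0≉0 (Aut⊆Aff′ , _) =
        let j , b , affine = Aff⇒≈ {residuePermutation} (Aut⊆Aff′ {residuePermutation} (≈⇒Aut {residuePermutation} λ x y →
              let j , h = quotients (ι x) (ι y) in j , ≈-trans (-‿cong (ι-ρ (F (ι x))) (ι-ρ (F (ι y)))) h))
            F-affine : ∀ x → F x ≈ x * Q ^ j + b [ n ]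
            F-affine x = ≈-trans (≈-sym (F-cong (ι-ρ x))) (≈-trans (≈-sym (ι-ρ (F (ι (ρ x)))))
              (≈-trans (affine (ρ x)) (+-cong (*-congʳ (Q ^ j) (ι-ρ x)) (≈-refl {x = b}))))
            at-a = ≈-trans (≈-sym (F-affine a)) Fa≈a
            at-a+1 = ≈-trans (≈-sym (F-affine (a + 1ℤ))) F[a+1]≈a+1
            k≈1 : Q ^ j ≈ 1ℤ [ n ]
            k≈1 = lin₂ 1ℤ -1ℤ at-a+1 at-a (lemma₁ a (Q ^ j) b)
            b≈0 : b ≈ 0ℤ [ n ]
            b≈0 = lin₂ 1ℤ (- a) at-a k≈1 (lemma₂ a (Q ^ j) b)
        in F0≉0 (≈-trans (F-affine 0ℤ) (≈-trans (≡⇒≈ (+-identityˡ b)) b≈0))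
        where
        lemma₁ : ∀ a k b → k - 1ℤ ≡ 1ℤ * (((a + 1ℤ) * k + b) - (a + 1ℤ)) + -1ℤ * ((a * k + b) - a)
        lemma₁ = solve-∀
        lemma₂ : ∀ a k b → b - 0ℤ ≡ 1ℤ * ((a * k + b) - a) + - a * (k - 1ℤ)
        lemma₂ = solve-∀

    module Shift (d : ℕ) (d∣n : d ℕ.∣ n) where

      -- Translates the multiples of d by e and leaves the rest; in the applications d is p or 4,
      -- and e is n / p or n / 2.
      shift : ℤ → ℤ → ℤ
      shift e x with x ≈? 0ℤ [ d ]
      ... | yes _ = x + e
      ... | no  _ = x

      shift-∣ : ∀ e {x} → x ≈ 0ℤ [ d ] → shift e x ≡ x + e
      shift-∣ e {x} h with x ≈? 0ℤ [ d ]
      ... | yes _ = refl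
      ... | no ¬h = contradiction h ¬h

      shift-∤ : ∀ e {x} → ¬ x ≈ 0ℤ [ d ] → shift e x ≡ x
      shift-∤ e {x} ¬h with x ≈? 0ℤ [ d ]
      ... | yes h = contradiction h ¬h
      ... | no _  = refl

      shift-cong : ∀ e {x y} → x ≈ y [ n ] → shift e x ≈ shift e y [ n ]
      shift-cong e {x} {y} x≈y = go (x ≈? 0ℤ [ d ])
        where
        go : Dec (x ≈ 0ℤ [ d ]) → shift e x ≈ shift e y [ n ]
        go (yes h) = ≈-trans (≡⇒≈ (shift-∣ e h)) (≈-trans (+-cong x≈y (≈-refl {x = e}))
          (≡⇒≈ (sym (shift-∣ e (≈-trans (≈-sym (≈-weaken d∣n x≈y)) h)))))
        go (no ¬h) = ≈-trans (≡⇒≈ (shift-∤ e ¬h)) (≈-trans x≈y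
          (≡⇒≈ (sym (shift-∤ e (¬h ∘ ≈-trans (≈-weaken d∣n x≈y))))))

      shift-shift : ∀ e f → f ≈ 0ℤ [ d ] → e + f ≡ 0ℤ → ∀ x → shift e (shift f x) ≈ x [ n ]
      shift-shift e f f≈0 e+f≡0 x = go (x ≈? 0ℤ [ d ])
        where
        go : Dec (x ≈ 0ℤ [ d ]) → shift e (shift f x) ≈ x [ n ]
        go (yes h) = ≡⇒≈ (trans (cong (shift e) (shift-∣ f h)) (trans
          (shift-∣ e (≈-trans (+-cong h f≈0) ≈-refl))
          (trans (+-assoc x f e) (trans (cong (λ z → x + z) (trans (+-comm f e) e+f≡0)) (+-identityʳ x)))))
        go (no ¬h) = ≡⇒≈ (trans (cong (shift e) (shift-∤ f ¬h)) (shift-∤ e ¬h))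

      -- Only the difference of a multiple and a nonmultiple of d changes, namely by e, and `absorb`
      -- says that this keeps it in its orbit. As d ≥ 3, the points 1 and 2 are fixed, while 0 goes
      -- to e.
      shift⇒Aut≢Aff : 3 ℕ.≤ d → ∀ e → e ≈ 0ℤ [ d ] → ¬ e ≈ 0ℤ [ n ] →
        (∀ x → ¬ x ≈ 0ℤ [ d ] → ∃[ j ] x + e ≈ x * Q ^ j [ n ]) → ¬ (Aut q n ≐ Aff q n)
      shift⇒Aut≢Aff 3≤d e e≈0 e≉0 absorb = Aut≢Aff (shift e) (shift (- e))
        (shift-cong e) (shift-cong (- e))
        (shift-shift e (- e) -e≈0 (+-inverseʳ e))
        (shift-shift (- e) e e≈0 (+-inverseˡ e))
        quotients 1ℤ
        (≡⇒≈ (shift-∤ e {1ℤ} (pos≉0 (ℕ.≤-trans (ℕ.s≤s (ℕ.s≤s ℕ.z≤n)) 3≤d) λ ())))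
        (≡⇒≈ (shift-∤ e {+ 2} (pos≉0 3≤d λ ())))
        (e≉0 ∘ ≈-trans (≡⇒≈ (sym (trans (shift-∣ e ≈-refl) (+-identityˡ e)))))
        where
        -e≈0 : - e ≈ 0ℤ [ d ]
        -e≈0 = ≈-trans (≡⇒≈ (sym (+-identityˡ (- e)))) (-‿cong (≈-refl {x = 0ℤ}) e≈0)
        quotients : ∀ x y → ∃[ j ] shift e x - shift e y ≈ (x - y) * Q ^ j [ n ]
        quotients x y = go (x ≈? 0ℤ [ d ]) (y ≈? 0ℤ [ d ])
          where
          go : Dec (x ≈ 0ℤ [ d ]) → Dec (y ≈ 0ℤ [ d ]) → ∃[ j ] shift e x - shift e y ≈ (x - y) * Q ^ j [ n ]
          go (yes hx) (yes hy) = 0 , ≡⇒≈ (trans (cong₂ _-_ (shift-∣ e hx) (shift-∣ e hy)) (lemma x y e))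
            where
            lemma : ∀ x y e → (x + e) - (y + e) ≡ (x - y) * 1ℤ
            lemma = solve-∀
          go (no ¬hx) (no ¬hy) = 0 , ≡⇒≈ (trans (cong₂ _-_ (shift-∤ e ¬hx) (shift-∤ e ¬hy)) (sym (*-identityʳ (x - y))))
          go (yes hx) (no ¬hy) = let j , h = absorb (x - y) (λ h → ¬hy (≈-trans (≈-sym (x-y≈0⇒x≈y h)) hx)) in
            j , ≈-trans (≡⇒≈ (trans (cong₂ _-_ (shift-∣ e hx) (shift-∤ e ¬hy)) (lemma x y e))) h
            where
            lemma : ∀ x y e → (x + e) - y ≡ (x - y) + e
            lemma = solve-∀
          go (no ¬hx) (yes hy) = let j , h = absorb (y - x) (λ h → ¬hx (≈-trans (≈-sym (x-y≈0⇒x≈y h)) hy)) in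
            j , lin₁ -1ℤ h (trans (cong (_- (x - y) * Q ^ j) (cong₂ _-_ (shift-∤ e ¬hx) (shift-∣ e hy))) (lemma x y e (Q ^ j)))
            where
            lemma : ∀ x y e k → (x - (y + e)) - (x - y) * k ≡ -1ℤ * (((y - x) + e) - (y - x) * k)
            lemma = solve-∀

    -- The multiples of p are shifted by d = n / p. With R = 1 + w d, p not dividing w, and d² = 0
    -- mod n, one has R ^ k = 1 + k w d; for x prime to p, taking k inverse to x w mod p gives x R ^
    -- k = x + d.
    exception₂⇒Aut≢Aff : Exception₂ → ¬ (Aut q n ≐ Aff q n)
    exception₂⇒Aut≢Aff (p , pr , 2∤p , p²∣n , eq) =
      let i , R≈1 , full = idx≡⇒full eq in from-generator (Q ^ i) i refl R≈1 full
      where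
      instance _ = prime⇒nonZero pr
      d = n ℕ./ p
      p∣n : p ℕ.∣ n
      p∣n = ℕ.∣-trans (ℕ.m∣m*n (p ℕ.^ 1)) p²∣n
      n≡p*d : n ≡ p ℕ.* d
      n≡p*d = sym (ℕ.m*[n/m]≡n p∣n)
      p∣d : p ℕ.∣ d
      p∣d = subst (ℕ._∣ d) (ℕ.*-identityʳ p) (ℕ.*-cancelˡ-∣ p (subst (p ℕ.^ 2 ℕ.∣_) n≡p*d p²∣n))
      n≡d*p : n ≡ d ℕ.* p
      n≡d*p = trans n≡p*d (ℕ.*-comm p d)
      open Kernel (kernel-p² n c pr d n≡p*d p∣d)
      open Shift p p∣n
      3≤p : 3 ℕ.≤ p
      3≤p = odd≥3 p pr 2∤p
        where
        odd≥3 : ∀ p → Prime p → ¬ 2 ℕ.∣ p → 3 ℕ.≤ p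
        odd≥3 0 pr = contradiction pr ¬prime[0]
        odd≥3 1 pr = contradiction pr ¬prime[1]
        odd≥3 2 _ 2∤2 = contradiction ℕ.∣-refl 2∤2
        odd≥3 (suc (suc (suc _))) _ _ = ℕ.s≤s (ℕ.s≤s (ℕ.s≤s ℕ.z≤n))
      scale : ∀ {x y} → x ≈ y [ p ] → + d * x ≈ + d * y [ n ]
      scale {x} {y} h = subst (+ d * x ≈ + d * y [_]) (sym n≡d*p) (*-scale d h)
      d≉0 : ¬ + d ≈ 0ℤ [ n ]
      d≉0 h = pos≉0 {1} (ℕ.≤-trans (ℕ.s≤s (ℕ.s≤s ℕ.z≤n)) 3≤p) (λ ())
        (*-unscale d {{d≢0}} (subst (+ d * 1ℤ ≈ + d * 0ℤ [_]) n≡d*p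
          (≈-trans (≡⇒≈ (*-identityʳ (+ d))) (≈-trans h (≡⇒≈ (sym (*-zeroʳ (+ d))))))))
      from-generator : ∀ R i → R ≡ Q ^ i → R ≈ 1ℤ [ d ] → (∀ k → R ^ k ≈ 1ℤ [ n ] → p ℕ.∣ k) → ¬ (Aut q n ≐ Aff q n)
      from-generator R i R≡ (mk w R-1≡) full = shift⇒Aut≢Aff 3≤p (+ d) (∣⇒≈0 p∣d) d≉0 absorb
        where
        y = w * + d
        R≡1+y : R ≡ 1ℤ + y
        R≡1+y = trans (lemma R) (cong (λ z → 1ℤ + z) R-1≡)
          where
          lemma : ∀ R → R ≡ 1ℤ + (R - 1ℤ)
          lemma = solve-∀
        w≉0 : ¬ w ≈ 0ℤ [ p ]
        w≉0 w≈0 = ¬prime[1] (subst Prime (ℕ.∣1⇒≡1 (full 1 R^1≈1)) pr)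
          where
          R^1≈1 : R ^ 1 ≈ 1ℤ [ n ]
          R^1≈1 = begin
            R ^ 1               ≡⟨ trans (^-identityʳ R) R≡1+y ⟩
            1ℤ + w * + d        ≡⟨ cong (λ z → 1ℤ + z) (*-comm w (+ d)) ⟩
            1ℤ + + d * w        ≈⟨ +-cong (≈-refl {x = 1ℤ}) (scale w≈0) ⟩
            1ℤ + + d * 0ℤ       ≡⟨ cong (λ z → 1ℤ + z) (*-zeroʳ (+ d)) ⟩
            1ℤ                  ∎
            where open ≈-Reasoning n
        y²≈0 : y * y ≈ 0ℤ [ n ]
        y²≈0 = ≈-trans (≡⇒≈ (lemma w (+ d))) (≈-trans
          (*-congˡ (w * w) (≈-trans (scale (∣⇒≈0 p∣d)) (≡⇒≈ (*-zeroʳ (+ d))))) (≡⇒≈ (*-zeroʳ (w * w))))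
          where
          lemma : ∀ w d → (w * d) * (w * d) ≡ (w * w) * (d * d)
          lemma = solve-∀
        absorb : ∀ x → ¬ x ≈ 0ℤ [ p ] → ∃[ j ] x + + d ≈ x * Q ^ j [ n ]
        absorb x x≉0 = i ℕ.* k , (begin
          x + + d                           ≡⟨ cong (λ z → x + z) (*-identityʳ (+ d)) ⟨
          x + + d * 1ℤ                      ≈⟨ +-cong (≈-refl {x = x}) (scale k*xw≈1) ⟨
          x + + d * (+ k * (x * w))         ≡⟨ lemma x (+ d) (+ k) w ⟩
          x * (1ℤ + + k * y)                ≈⟨ *-congˡ x (1+_^≈ y k y²≈0) ⟨
          x * (1ℤ + y) ^ k                  ≡⟨ cong (λ R → x * R ^ k) (trans (sym R≡1+y) R≡) ⟩
          x * (Q ^ i) ^ k                   ≡⟨ cong (x *_) (^-*-assoc Q i k) ⟩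
          x * Q ^ (i ℕ.* k)                 ∎)
          where
          open ≈-Reasoning n
          lemma : ∀ x d k w → x + d * (k * (x * w)) ≡ x * (1ℤ + k * (w * d))
          lemma = solve-∀
          inverse : ∃[ z ] z * (x * w) ≈ 1ℤ [ p ]
          inverse = prime-inverse pr ([ x≉0 , w≉0 ]′ ∘ prime-*≈0 {x} {w} pr)
          k = proj₁ inverse %ℕ p
          k*xw≈1 : + k * (x * w) ≈ 1ℤ [ p ]
          k*xw≈1 = ≈-trans (*-congʳ (x * w) (%ℕ-≈ (proj₁ inverse) p)) (proj₂ inverse)

    -- The multiples of 4 are shifted by e = n / 2 = 2d. As R has order 4, both w in R = 1 + w d and
    -- y in R ^ 2 = 1 + e y are odd. Hence R ^ 2 adds e to every odd x, and R adds e to every x that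
    -- is 2 mod 4.
    exception₃⇒Aut≢Aff : Exception₃ → ¬ (Aut q n ≐ Aff q n)
    exception₃⇒Aut≢Aff (8∣n , eq) =
      let i , R≈1 , full = idx≡⇒full eq in from-generator (Q ^ i) i refl R≈1 full
      where
      d = n ℕ./ 4
      4∣n : 4 ℕ.∣ n
      4∣n = ℕ.∣-trans (ℕ.divides 2 refl) 8∣n
      n≡4*d : n ≡ 4 ℕ.* d
      n≡4*d = sym (ℕ.m*[n/m]≡n 4∣n)
      n≡2*2d : n ≡ 2 ℕ.* (2 ℕ.* d)
      n≡2*2d = trans n≡4*d (ℕ.*-assoc 2 2 d)
      2∣d : 2 ℕ.∣ d
      2∣d = ℕ.*-cancelˡ-∣ 4 (subst (8 ℕ.∣_) n≡4*d 8∣n)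
      e = + (2 ℕ.* d)
      open Kernel (kernel-4 n c d n≡2*2d 2∣d)
      open Shift 4 4∣n
      n≡2d*2 : n ≡ 2 ℕ.* d ℕ.* 2
      n≡2d*2 = trans n≡2*2d (ℕ.*-comm 2 (2 ℕ.* d))
      scale : ∀ {x y} → x ≈ y [ 2 ] → e * x ≈ e * y [ n ]
      scale {x} {y} h = subst (e * x ≈ e * y [_]) (sym n≡2d*2) (*-scale (2 ℕ.* d) h)
      e≉0 : ¬ e ≈ 0ℤ [ n ]
      e≉0 h = pos≉0 {1} {2} (ℕ.s≤s (ℕ.s≤s ℕ.z≤n)) (λ ())
        (*-unscale (2 ℕ.* d) {{ℕ.m*n≢0 2 d {{_}} {{d≢0}}}} (subst (e * 1ℤ ≈ e * 0ℤ [_]) n≡2d*2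
          (≈-trans (≡⇒≈ (*-identityʳ e)) (≈-trans h (≡⇒≈ (sym (*-zeroʳ e)))))))
      e≡2d : e ≡ + 2 * + d
      e≡2d = pos-* 2 d
      from-generator : ∀ R i → R ≡ Q ^ i → R ≈ 1ℤ [ d ] → (∀ k → R ^ k ≈ 1ℤ [ n ] → 4 ℕ.∣ k) → ¬ (Aut q n ≐ Aff q n)
      from-generator R i R≡ R≈1@(mk w R-1≡) full = shift⇒Aut≢Aff (ℕ.s≤s (ℕ.s≤s (ℕ.s≤s ℕ.z≤n))) e
        (∣⇒≈0 (ℕ.*-monoʳ-∣ 2 2∣d)) e≉0 absorb
        where
        R²≉1 : ¬ R ^ 2 ≈ 1ℤ [ n ]
        R²≉1 h = ℕ.>⇒∤ (ℕ.s≤s (ℕ.s≤s (ℕ.s≤s ℕ.z≤n))) (full 2 h)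
        R≡1+wd : R ≡ 1ℤ + w * + d
        R≡1+wd = trans (lemma R) (cong (λ z → 1ℤ + z) R-1≡)
          where
          lemma : ∀ R → R ≡ 1ℤ + (R - 1ℤ)
          lemma = solve-∀
        w-odd : ¬ w ≈ 0ℤ [ 2 ]
        w-odd (mk w′ w-0≡) = R²≉1 (mk (w′ + w′ * w′ * + d) (begin
          R ^ 2 - 1ℤ                                                      ≡⟨ cong (λ R → R ^ 2 - 1ℤ) R≡1+2w′d ⟩
          (1ℤ + w′ * + 2 * + d) * ((1ℤ + w′ * + 2 * + d) * 1ℤ) - 1ℤ      ≡⟨ lemma w′ (+ d) ⟩
          (w′ + w′ * w′ * + d) * (+ 4 * + d)                              ≡⟨ cong ((w′ + w′ * w′ * + d) *_) (trans (sym (pos-* 4 d)) (cong +_ (sym n≡4*d))) ⟩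
          (w′ + w′ * w′ * + d) * + n                                      ∎))
          where
          open ≡-Reasoning
          R≡1+2w′d : R ≡ 1ℤ + w′ * + 2 * + d
          R≡1+2w′d = trans R≡1+wd (cong (λ w → 1ℤ + w * + d) (trans (sym (+-identityʳ w)) w-0≡))
          lemma : ∀ w d → (1ℤ + w * + 2 * d) * ((1ℤ + w * + 2 * d) * 1ℤ) - 1ℤ ≡ (w + w * w * d) * (+ 4 * d)
          lemma = solve-∀
        R²-1 : R ^ 2 ≈ 1ℤ [ 2 ℕ.* d ]
        R²-1 = ^-lift 2 d 2∣d R≈1
        y = _≈_[_].quot R²-1
        R²≡1+ye : R ^ 2 ≡ 1ℤ + e * y
        R²≡1+ye = trans (lemma (R ^ 2)) (cong (λ z → 1ℤ + z) (trans (_≈_[_].equality R²-1) (*-comm y e)))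
          where
          lemma : ∀ R → R ≡ 1ℤ + (R - 1ℤ)
          lemma = solve-∀
        y-odd : ¬ y ≈ 0ℤ [ 2 ]
        y-odd y≈0 = R²≉1 (≈-trans (≡⇒≈ R²≡1+ye) (≈-trans (+-cong (≈-refl {x = 1ℤ}) (scale y≈0))
          (≡⇒≈ (cong (λ z → 1ℤ + z) (*-zeroʳ e)))))
        odd-product : ∀ {x y} → ¬ x ≈ 0ℤ [ 2 ] → ¬ y ≈ 0ℤ [ 2 ] → x * y ≈ 1ℤ [ 2 ]
        odd-product {x} {y} x-odd y-odd = odd⇒≈1 ([ x-odd , y-odd ]′ ∘ prime-*≈0 {x} {y} prime[2])
        absorb : ∀ x → ¬ x ≈ 0ℤ [ 4 ] → ∃[ j ] x + e ≈ x * Q ^ j [ n ]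
        absorb x x≉0 = go (x ≈? 0ℤ [ 2 ])
          where
          open ≈-Reasoning n
          go : Dec (x ≈ 0ℤ [ 2 ]) → ∃[ j ] x + e ≈ x * Q ^ j [ n ]
          go (no x-odd) = i ℕ.* 2 , (begin
            x + e                    ≡⟨ cong (λ z → x + z) (*-identityʳ e) ⟨
            x + e * 1ℤ               ≈⟨ +-cong (≈-refl {x = x}) (scale (odd-product x-odd y-odd)) ⟨
            x + e * (x * y)          ≡⟨ lemma x e y ⟩
            x * (1ℤ + e * y)         ≡⟨ cong (x *_) R²≡1+ye ⟨
            x * R ^ 2                ≡⟨ cong (λ R → x * R ^ 2) R≡ ⟩
            x * (Q ^ i) ^ 2          ≡⟨ cong (x *_) (^-*-assoc Q i 2) ⟩
            x * Q ^ (i ℕ.* 2)        ∎)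
            where
            lemma : ∀ x e y → x + e * (x * y) ≡ x * (1ℤ + e * y)
            lemma = solve-∀
          go (yes (mk x′ x-0≡)) = i , (begin
            x + e                          ≡⟨ cong (λ z → x + z) (*-identityʳ e) ⟨
            x + e * 1ℤ                     ≈⟨ +-cong (≈-refl {x = x}) (scale (odd-product x′-odd w-odd)) ⟨
            x + e * (x′ * w)               ≡⟨ cong₂ (λ x e → x + e * (x′ * w)) x≡ e≡2d ⟩
            x′ * + 2 + + 2 * + d * (x′ * w) ≡⟨ lemma x′ (+ d) w ⟩
            x′ * + 2 * (1ℤ + w * + d)      ≡⟨ cong₂ _*_ x≡ R≡1+wd ⟨
            x * R                          ≡⟨ cong (x *_) R≡ ⟩
            x * Q ^ i                      ∎)
            where
            x≡ : x ≡ x′ * + 2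
            x≡ = trans (sym (+-identityʳ x)) x-0≡
            x′-odd : ¬ x′ ≈ 0ℤ [ 2 ]
            x′-odd h = x≉0 (≈-trans (≡⇒≈ (trans x≡ (*-comm x′ (+ 2)))) (*-scale 2 h))
            lemma : ∀ x d w → x * + 2 + + 2 * d * (x * w) ≡ x * + 2 * (1ℤ + w * d)
            lemma = solve-∀

    -- The classes 0 and 1 mod p are interchanged by an e that is 1 mod p and 0 mod n / p.
    -- Differences are unchanged mod n / p, and mod p they stay zero or stay nonzero; since R is 1
    -- mod n / p and its powers reach every nonzero residue mod p, a power of R accounts for the
    -- change.
    exception₁⇒Aut≢Aff : Exception₁ → ¬ (Aut q n ≐ Aff q n)
    exception₁⇒Aut≢Aff (p , pr , 5≤p , (p∣n , p²∤n) , eq) =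
      let i , R≈1 , full = idx≡⇒full eq
          e , e≈1 , e≈0 = crt-idempotent p⊥d
      in from-generator (Q ^ i) i refl R≈1 full e e≈1 e≈0
      where
      instance _ = prime⇒nonZero pr
      d = n ℕ./ p
      n≡p*d : n ≡ p ℕ.* d
      n≡p*d = sym (ℕ.m*[n/m]≡n p∣n)
      d∣n : d ℕ.∣ n
      d∣n = subst (d ℕ.∣_) (sym n≡p*d) (ℕ.n∣m*n p)
      p∤d : ¬ p ℕ.∣ d
      p∤d p∣d = p²∤n (subst₂ ℕ._∣_ (cong (p ℕ.*_) (sym (ℕ.*-identityʳ p))) (sym n≡p*d) (ℕ.*-monoʳ-∣ p p∣d))
      p⊥d : Coprime p d
      p⊥d = prime-coprime pr p∤d
      crt : ∀ {x y} → x ≈ y [ p ] → x ≈ y [ d ] → x ≈ y [ n ]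
      crt {x} {y} h g = subst (x ≈ y [_]) (sym n≡p*d) (≈-crt p⊥d h g)
      open Kernel (kernel-∥ n c pr d n≡p*d p∤d) using (idx≡⇒full)
      Q≉0 : ¬ Q ≈ 0ℤ [ p ]
      Q≉0 h = ¬prime[1] (subst Prime (c (p∣n , ≈0⇒∣ h)) pr)
      1≉0 : ¬ 1ℤ ≈ 0ℤ [ p ]
      1≉0 = pos≉0 (ℕ.≤-trans (ℕ.s≤s (ℕ.s≤s ℕ.z≤n)) 5≤p) λ ()

      from-generator : ∀ R i → R ≡ Q ^ i → R ≈ 1ℤ [ d ] → (∀ k → R ^ k ≈ 1ℤ [ n ] → ℕ.pred p ℕ.∣ k) →
        ∀ e → e ≈ 1ℤ [ p ] → e ≈ 0ℤ [ d ] → ¬ (Aut q n ≐ Aff q n)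
      from-generator R i R≡ R≈1 full e e≈1 e≈0 =
        -- Since p ≥ 5, the consecutive points 2 and 3 lie in neither of the two classes and are
        -- fixed.
        Aut≢Aff swap swap (swap-cong p∣n) (swap-cong p∣n) swap-involutive swap-involutive quotients (+ 2)
          (≡⇒≈ (swap-other {+ 2} (pos≉0 (ℕ.≤-trans (ℕ.s≤s (ℕ.s≤s (ℕ.s≤s ℕ.z≤n))) 5≤p) λ ()) (1≉0 ∘ minus-1)))
          (≡⇒≈ (swap-other {+ 3} (pos≉0 (ℕ.≤-trans (ℕ.s≤s (ℕ.s≤s (ℕ.s≤s (ℕ.s≤s ℕ.z≤n)))) 5≤p) λ ())
            (pos≉0 {2} (ℕ.≤-trans (ℕ.s≤s (ℕ.s≤s (ℕ.s≤s ℕ.z≤n))) 5≤p) (λ ()) ∘ minus-1)))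
          (λ h → 1≉0 (≈-trans (≈-sym e≈1) (≈-trans (≡⇒≈ (sym (trans (swap-0 ≈-refl) (+-identityˡ e)))) (≈-weaken p∣n h))))
        where
        minus-1 : ∀ {x} → 1ℤ + x ≈ 1ℤ [ p ] → x ≈ 0ℤ [ p ]
        minus-1 {x} h = lin₁ 1ℤ h (lemma x)
          where
          lemma : ∀ x → x - 0ℤ ≡ 1ℤ * ((1ℤ + x) - 1ℤ)
          lemma = solve-∀

        swap : ℤ → ℤ
        swap x with x ≈? 0ℤ [ p ] | x ≈? 1ℤ [ p ]
        ... | yes _ | _     = x + e
        ... | no _  | yes _ = x - e
        ... | no _  | no _  = x

        swap-0 : ∀ {x} → x ≈ 0ℤ [ p ] → swap x ≡ x + e
        swap-0 {x} h with x ≈? 0ℤ [ p ] | x ≈? 1ℤ [ p ]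
        ... | yes _ | _     = refl
        ... | no ¬h | _     = contradiction h ¬h

        swap-1 : ∀ {x} → x ≈ 1ℤ [ p ] → swap x ≡ x - e
        swap-1 {x} h with x ≈? 0ℤ [ p ] | x ≈? 1ℤ [ p ]
        ... | yes g | _     = contradiction (≈-trans (≈-sym h) g) 1≉0
        ... | no _  | yes _ = refl
        ... | no _  | no ¬h = contradiction h ¬h

        swap-other : ∀ {x} → ¬ x ≈ 0ℤ [ p ] → ¬ x ≈ 1ℤ [ p ] → swap x ≡ x
        swap-other {x} ¬h ¬g with x ≈? 0ℤ [ p ] | x ≈? 1ℤ [ p ]
        ... | yes h | _     = contradiction h ¬h
        ... | no _  | yes g = contradiction g ¬g
        ... | no _  | no _  = refl

        data Class (x : ℤ) : Set where
          is-0  : x ≈ 0ℤ [ p ] → Class x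
          is-1  : x ≈ 1ℤ [ p ] → Class x
          other : ¬ x ≈ 0ℤ [ p ] → ¬ x ≈ 1ℤ [ p ] → Class x

        class : ∀ x → Class x
        class x with x ≈? 0ℤ [ p ] | x ≈? 1ℤ [ p ]
        ... | yes h | _     = is-0 h
        ... | no _  | yes g = is-1 g
        ... | no ¬h | no ¬g = other ¬h ¬g

        swap-cong : ∀ {k} → p ℕ.∣ k → ∀ {x y} → x ≈ y [ k ] → swap x ≈ swap y [ k ]
        swap-cong {k} p∣k {x} {y} h = go (class x)
          where
          x≈y = ≈-weaken p∣k h
          go : Class x → swap x ≈ swap y [ k ]
          go (is-0 x≈0) = ≈-trans (≡⇒≈ (swap-0 x≈0)) (≈-trans (+-cong h (≈-refl {x = e}))
            (≡⇒≈ (sym (swap-0 (≈-trans (≈-sym x≈y) x≈0)))))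
          go (is-1 x≈1) = ≈-trans (≡⇒≈ (swap-1 x≈1)) (≈-trans (-‿cong h (≈-refl {x = e}))
            (≡⇒≈ (sym (swap-1 (≈-trans (≈-sym x≈y) x≈1)))))
          go (other x≉0 x≉1) = ≈-trans (≡⇒≈ (swap-other x≉0 x≉1)) (≈-trans h
            (≡⇒≈ (sym (swap-other (x≉0 ∘ ≈-trans x≈y) (x≉1 ∘ ≈-trans x≈y)))))

        swap-involutive : ∀ {k} x → swap (swap x) ≈ x [ k ]
        swap-involutive {k} x = ≡⇒≈ (go (class x))
          where
          go : Class x → swap (swap x) ≡ x
          go (is-0 h) = trans (cong swap (swap-0 h)) (trans (swap-1 (+-cong h e≈1)) (lemma x e))
            where
            lemma : ∀ x e → (x + e) - e ≡ x
            lemma = solve-∀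
          go (is-1 h) = trans (cong swap (swap-1 h)) (trans (swap-0 (-‿cong h e≈1)) (lemma x e))
            where
            lemma : ∀ x e → (x - e) + e ≡ x
            lemma = solve-∀
          go (other ¬h ¬g) = trans (cong swap (swap-other ¬h ¬g)) (swap-other ¬h ¬g)

        swap≈id : ∀ x → swap x ≈ x [ d ]
        swap≈id x = go (class x)
          where
          go : Class x → swap x ≈ x [ d ]
          go (is-0 h) = ≈-trans (≡⇒≈ (swap-0 h)) (≈-trans (+-cong (≈-refl {x = x}) e≈0) (≡⇒≈ (+-identityʳ x)))
          go (is-1 h) = ≈-trans (≡⇒≈ (swap-1 h)) (≈-trans (-‿cong (≈-refl {x = x}) e≈0) (≡⇒≈ (+-identityʳ x)))
          go (other ¬h ¬g) = ≡⇒≈ (swap-other ¬h ¬g)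

        swap-reflects : ∀ {x y} → swap x ≈ swap y [ p ] → x ≈ y [ p ]
        swap-reflects {x} {y} h = ≈-trans (≈-sym (swap-involutive x))
          (≈-trans (swap-cong ℕ.∣-refl h) (swap-involutive y))

        R≉0 : ¬ R ≈ 0ℤ [ p ]
        R≉0 h = Q≉0 (prime-^≈0 pr i (≈-trans (≡⇒≈ (sym R≡)) h))

        -- R is 1 mod n / p, so it has the same order mod p as mod n.
        full-p : ∀ k → R ^ k ≈ 1ℤ [ p ] → ℕ.pred p ℕ.∣ k
        full-p k h = full k (crt h (≈1-^ k R≈1))

        quotients : ∀ x y → ∃[ j ] swap x - swap y ≈ (x - y) * Q ^ j [ n ]
        quotients x y = go (x ≈? y [ p ])
          where
          mod-d : ∀ k → swap x - swap y ≈ (x - y) * R ^ k [ d ]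
          mod-d k = ≈-trans (-‿cong (swap≈id x) (swap≈id y))
            (≈-trans (≡⇒≈ (sym (*-identityʳ (x - y)))) (*-congˡ (x - y) (≈-sym (≈1-^ k R≈1))))
          from-k : ∃[ k ] (x - y) * R ^ k ≈ swap x - swap y [ p ] → ∃[ j ] swap x - swap y ≈ (x - y) * Q ^ j [ n ]
          from-k (k , h) = i ℕ.* k , ≈-trans (crt (≈-sym h) (mod-d k))
            (≡⇒≈ (cong ((x - y) *_) (trans (cong (_^ k) R≡) (^-*-assoc Q i k))))
          go : Dec (x ≈ y [ p ]) → ∃[ j ] swap x - swap y ≈ (x - y) * Q ^ j [ n ]
          go (yes h) = from-k (0 , ≈-trans (*-congʳ 1ℤ (x≈y⇒x-y≈0 h)) (≈-sym (x≈y⇒x-y≈0 (swap-cong ℕ.∣-refl h))))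
          go (no ¬h) = from-k (powers-reach pr R full-p R≉0 (x - y) (swap x - swap y)
            (¬h ∘ x-y≈0⇒x≈y) (¬h ∘ swap-reflects ∘ x-y≈0⇒x≈y))

    exception⇒Aut≢Aff : Exception₁ ⊎ Exception₂ ⊎ Exception₃ → ¬ (Aut q n ≐ Aff q n)
    exception⇒Aut≢Aff = [ exception₁⇒Aut≢Aff , [ exception₂⇒Aut≢Aff , exception₃⇒Aut≢Aff ]′ ]′

open import Data.Nat.Base using (ℕ; NonZero; _≤_; _^_; _/_)
open import Data.Nat.Coprimality using (gcd≡1⇒coprime)
open import Data.Nat.Divisibility using (_∣_)
open import Data.Nat.GCD using (gcd)
open import Data.Nat.Primality using (Prime; prime⇒nonZero)
open import Data.Product.Base using (_×_; Σ-syntax; ∃-syntax)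
open import Data.Sum.Base using (_⊎_)
open import Function.Bundles using (_⇔_; mk⇔)
open import Relation.Binary.PropositionalEquality.Core using (_≡_)
open import Relation.Nullary using (¬_)
open import Relation.Unary using (_≐_)

theorem2 : (q n : ℕ) .{{_ : NonZero n}} → PrimePower q → gcd n q ≡ 1 →
    (¬ (Aut q n ≐ Aff q n)) ⇔
    ( (∃[ p ] Σ[ pr ∈ Prime p ] 5 ≤ p × p ∥ n ×
         idx (_/_ n p {{prime⇒nonZero pr}}) q ≡ idx n q)
    ⊎ (∃[ p ] Σ[ pr ∈ Prime p ] ¬ (2 ∣ p) × p ^ 2 ∣ n ×
         idx (_/_ n p {{prime⇒nonZero pr}}) q ≡ idx n q)
    ⊎ (8 ∣ n × idx (n / 4) q ≡ idx n q) )
theorem2 q n _ gcd≡1 = mk⇔ (Scheme.Aut≢Aff⇒exception q n n⊥q) (Exceptions.exception⇒Aut≢Aff q n n⊥q)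
  where
  open CyclotomicScheme
  n⊥q = gcd≡1⇒coprime gcd≡1
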